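{- Let $(a_n)_{n\ge0}$ be the sequence, listed in increasing order, of the non-negative integers $m$ such that $240m+169$ is a perfect square. Then $$\sum_{n=0}^\infty(-1)^{\lfloor 5n/4\rfloor}q^{a_n}=\frac{(q^3,q^5,q^8;q^8)_\infty\,(q^2,q^{14};q^{16})_\infty}{(q^2,q^3;q^5)_\infty}.$$
   Context: Here $q$ is a complex number with $|q|<1$ (equivalently, the identity may be read as an identity of formal power series in $q$). For a complex number $a$, $(a;q)_\infty:=\prod_{i=0}^\infty(1-aq^i)$, and $(a_1,a_2,\dots,a_m;q)_\infty:=\prod_{j=1}^m(a_j;q)_\infty$. $\lfloor x\rfloor$ is the floor function. -}

module Defs where

open import Data.Nat as ℕ using (ℕ; zero; suc; _≡ᵇ_)
open import Data.Nat.Divisibility using (_∣?_)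
open import Data.Nat.DivMod using (_/_)
open import Data.Integer as ℤ using (ℤ; +_; -[1+_])
open import Data.Bool using (if_then_else_)
open import Relation.Nullary.Decidable using (⌊_⌋)

-- Formal power series in q with integer coefficients: f N = coefficient of q^N.
PS : Set
PS = ℕ → ℤ

sumTo : ℕ → (ℕ → ℤ) → ℤ
sumTo zero f = f zero
sumTo (suc n) f = sumTo n f ℤ.+ f (suc n)

infixl 7 _⊛_
_⊛_ : PS → PS → PS
(f ⊛ g) N = sumTo N (λ i → f i ℤ.* g (N ℕ.∸ i))

one : PS
one N = if N ≡ᵇ 0 then + 1 else + 0

oneMinusQ^ : ℕ → PS
oneMinusQ^ k N = one N ℤ.- (if N ≡ᵇ k then + 1 else + 0)

-- the series 1/(1 - q^k) = Σ_j q^{jk}  (used with k ≥ 1)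
geomQ^ : ℕ → PS
geomQ^ k N = if ⌊ k ∣? N ⌋ then + 1 else + 0

finProd : (ℕ → PS) → ℕ → PS
finProd F zero = one
finProd F (suc n) = finProd F n ⊛ F n

-- (q^b ; q^c)_∞ = ∏_{i≥0} (1 - q^{b + c i}), for b, c ≥ 1.
-- The coefficient of q^N only depends on the factors with i ≤ N
-- (since b + c i ≥ i + 1 > N for i ≥ N), so truncating there is exact.
poch : ℕ → ℕ → PS
poch b c N = finProd (λ i → oneMinusQ^ (b ℕ.+ c ℕ.* i)) (suc N) N

-- 1 / (q^b ; q^c)_∞ = ∏_{i≥0} 1/(1 - q^{b + c i}), for b, c ≥ 1 (same truncation).
pochInv : ℕ → ℕ → PS
pochInv b c N = finProd (λ i → geomQ^ (b ℕ.+ c ℕ.* i)) (suc N) N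

sign : ℕ → ℤ
sign n = -[1+ 0 ] ℤ.^ ((5 ℕ.* n) / 4)

-- Σ_{n≥0} (-1)^⌊5n/4⌋ q^{a n}, for a strictly increasing a : ℕ → ℕ.
-- Since a is strictly increasing, a n ≥ n, so only n ≤ N can contribute to q^N.
lhsSeries : (ℕ → ℕ) → PS
lhsSeries a N = sumTo N (λ n → if a n ≡ᵇ N then sign n else + 0)

rhsSeries : PS
rhsSeries = poch 3 8 ⊛ poch 5 8 ⊛ poch 8 8 ⊛ poch 2 16 ⊛ poch 14 16
            ⊛ pochInv 2 5 ⊛ pochInv 3 5

{-# OPTIONS --safe #-}
module Submission where

-- Write T(a,b) = Σ_j (-1)^j x^(a j(j+1)/2 + b j(j-1)/2), which by Jacobi's triple product is
-- (x^a, x^b, x^(a+b); x^(a+b))_∞.  Put q = x².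
--
-- Multiplying T(2,3) by T(9,1) and splitting the double sum by a residue mod 3 gives T(10,20) Q with
-- Q = Σ_l x^((15l²+7l)/2) - Σ_l x^((15l²-13l)/2+1); cancelling (x^10;x^10)_∞ this is the quintuple product
-- Q = (x²,x³,x⁵;x⁵)_∞ (x,x⁹;x^10)_∞ = (x;x²)_∞ (x²,x⁸,x^10;x^10)_∞, that is
-- Q · (x⁴;x⁴)_∞ = T(1,3) · (x²,x⁸,x^10;x^10)_∞.
--
-- Apart from Q and T(1,3) everything here is a series in q, so the odd parts in x may be compared.
-- An odd exponent E = 1 + 2m of Q satisfies 240 m + 169 = 120 E + 49 = (30l+7)² or (30l-13)², so the odd part
-- of Q is -x times the left-hand side; the odd part of T(1,3) is -x (-q,-q⁷,q⁸;q⁸)_∞.  Hence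
-- LHS · (q²;q²)_∞ = (-q,-q⁷,q⁸;q⁸)_∞ (q,q⁴,q⁵;q⁵)_∞, and RHS · (q²;q²)_∞ is the same product.

open import Defs
open import Algebra.Bundles using (CommutativeRing)
import Algebra.Solver.Ring
open import Algebra.Solver.Ring.AlmostCommutativeRing using (AlmostCommutativeRing; fromCommutativeRing; _-Raw-AlmostCommutative⟶_; Induced-equivalence)
open import Data.Bool.Base using (if_then_else_)
open import Data.Empty using (⊥-elim)
open import Data.Integer.Base as ℤ using (ℤ; +_; -[1+_]; 0ℤ; 1ℤ; -1ℤ; ∣_∣; _⊖_; _%ℕ_; _/ℕ_)
open import Data.Integer.DivMod using (n%ℕd<d; a≡a%ℕn+[a/ℕn]*n)
import Data.Integer.Properties as ℤ
import Algebra.Properties.AbelianGroup ℤ.+-0-abelianGroup as ℤ+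
open import Data.Integer.Tactic.RingSolver using (solve-∀)
open import Data.List.Base using (List; []; _∷_; applyUpTo; upTo; map; _++_; filter; cartesianProduct)
open import Data.List.Membership.Propositional using (_∈_)
open import Data.List.Membership.Propositional.Properties using (∈-map⁺; ∈-map⁻; ∈-++⁺ˡ; ∈-++⁺ʳ; ∈-filter⁺; ∈-filter⁻; ∈-applyUpTo⁺; ∈-upTo⁺; ∈-cartesianProduct⁺)
open import Data.List.Membership.Propositional.Properties.WithK using (unique∧set⇒bag)
open import Data.List.Properties using (filter-accept; filter-reject)
open import Data.List.Relation.Binary.BagAndSetEquality using (∼bag⇒↭)
open import Data.List.Relation.Binary.Permutation.Propositional as ↭ using (_↭_)
open import Data.List.Relation.Unary.All as All using ([]; _∷_)
open import Data.List.Relation.Unary.AllPairs using ([]; _∷_)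
open import Data.List.Relation.Unary.Any using (here; there)
open import Data.List.Relation.Unary.Unique.Propositional using (Unique)
import Data.List.Relation.Unary.Unique.Propositional.Properties as Unique
open import Data.Maybe.Base using (just; nothing)
open import Data.Nat using (ℕ; _+_; _*_; _<_)
open import Data.Nat.Base as ℕ using (zero; suc; _≤_; z≤n; s≤s; _∸_; _≡ᵇ_; _%_; _/_)
open import Data.Nat.Divisibility using (_∣_; _∣?_; ∣m+n∣m⇒∣n; ∣m∣n⇒∣m+n; ∣-refl; ∣⇒≤; _∣0; divides-refl)
import Data.Nat.DivMod as ℕ
import Data.Nat.Properties as ℕ
import Data.Nat.Tactic.RingSolver as ℕ-Solver
open import Data.Product using (_,_; _×_; ∃-syntax; proj₁; proj₂)
open import Data.Sum.Base using (_⊎_; inj₁; inj₂; [_,_])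
open import Data.Sum.Properties using (inj₁-injective; inj₂-injective)
open import Function.Base using (_∘_)
open import Function.Bundles using (_⇔_; mk⇔; module Equivalence)
open import Level using (0ℓ)
open import Relation.Binary.Bundles using (Setoid)
open import Relation.Binary.Definitions using (WeaklyDecidable)
open import Relation.Binary.PropositionalEquality using (_≡_; _≢_; refl; sym; trans; cong; cong₂; subst; subst₂; module ≡-Reasoning)
open import Relation.Nullary using (¬_; yes; no)
open import Relation.Nullary.Decidable using (isYes≗does; dec-true; dec-false; _→-dec_; toWitness)

-- Half-integral powers of q are introduced because the numbers m in question belong exactly to the
-- odd exponents of one quintuple product, while no theta series in q alone has them as its
-- exponents. T(2,3) T(9,1) is the product side of the quintuple product identity in base x⁵ at z =
-- x², completed by the factor (x^10;x^10)_∞ that makes both halves theta series. The exponents have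
-- quadratic part 5(m² + 2n²)/2, and (m + 2n)² + 2(m - n)² = 3(m² + 2n²): the new variables m + 2n
-- and m - n separate the form, at the price of a congruence mod 3. Taking odd parts is not
-- multiplicative, only linear over series in x². The factor (x⁴;x⁴)_∞ is such a series, and it
-- completes (x;x²)_∞ = (x,x³;x⁴)_∞ to a theta series, whose odd part can be read off. No limits are
-- available beyond agreement of coefficients up to q^N, so Jacobi's identity is derived from a
-- finite q-binomial identity, and equalities of theta series are bijections between weighted index
-- sets (`GF`).

infix 4 _≈_ _≈[_]_
infixl 6 _⊕_
infixl 7 _⊗_
infix 8 ⊖_

-- The ring of formal power series, exactly and up to q^N

record _≈_ (f g : PS) : Set where
  constructor mk≈
  field at : ∀ n → f n ≡ g n
open _≈_ public

record _≈[_]_ (f : PS) (N : ℕ) (g : PS) : Set where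
  constructor mk≈[]
  field upto : ∀ k → k ≤ N → f k ≡ g k
open _≈[_]_ public

≈-refl : ∀ {f} → f ≈ f
≈-refl = mk≈ λ _ → refl

≈-sym : ∀ {f g} → f ≈ g → g ≈ f
≈-sym p = mk≈ λ n → sym (at p n)

≈-trans : ∀ {f g h} → f ≈ g → g ≈ h → f ≈ h
≈-trans p q = mk≈ λ n → trans (at p n) (at q n)

≈[]-refl : ∀ {N f} → f ≈[ N ] f
≈[]-refl = mk≈[] λ _ _ → refl

≈[]-sym : ∀ {N f g} → f ≈[ N ] g → g ≈[ N ] f
≈[]-sym p = mk≈[] λ k k≤N → sym (upto p k k≤N)

≈[]-trans : ∀ {N f g h} → f ≈[ N ] g → g ≈[ N ] h → f ≈[ N ] h
≈[]-trans p q = mk≈[] λ k k≤N → trans (upto p k k≤N) (upto q k k≤N)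

≈⇒≈[] : ∀ {N f g} → f ≈ g → f ≈[ N ] g
≈⇒≈[] p = mk≈[] λ k _ → at p k

≈[]⇒≈ : ∀ {f g} → (∀ N → f ≈[ N ] g) → f ≈ g
≈[]⇒≈ p = mk≈ λ n → upto (p n) n ℕ.≤-refl

≈[]-mono : ∀ {M N f g} → M ≤ N → f ≈[ N ] g → f ≈[ M ] g
≈[]-mono M≤N p = mk≈[] λ k k≤M → upto p k (ℕ.≤-trans k≤M M≤N)

≈[]-setoid : ℕ → Setoid 0ℓ 0ℓ
≈[]-setoid N = record
  { Carrier = PS ; _≈_ = _≈[ N ]_
  ; isEquivalence = record { refl = ≈[]-refl ; sym = ≈[]-sym ; trans = ≈[]-trans } }

opaque
  𝟘 : PS
  𝟘 _ = 0ℤ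

  𝟙 : PS
  𝟙 = one

  _⊗_ : PS → PS → PS
  _⊗_ = _⊛_

  _⊕_ : PS → PS → PS
  (f ⊕ g) n = f n ℤ.+ g n

  ⊖_ : PS → PS
  (⊖ f) n = ℤ.- f n

  _·_ : ℤ → PS → PS
  (c · f) n = c ℤ.* f n

  tail : PS → PS
  tail f n = f (suc n)

  sumTo-cong : ∀ n {f g} → (∀ k → k ≤ n → f k ≡ g k) → sumTo n f ≡ sumTo n g
  sumTo-cong zero    p = p 0 z≤n
  sumTo-cong (suc n) p = cong₂ ℤ._+_ (sumTo-cong n (λ k k≤n → p k (ℕ.m≤n⇒m≤1+n k≤n))) (p (suc n) ℕ.≤-refl)

  sumTo-head : ∀ n f → sumTo (suc n) f ≡ f 0 ℤ.+ sumTo n (λ k → f (suc k))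
  sumTo-head zero    f = refl
  sumTo-head (suc n) f = trans (cong (ℤ._+ f (suc (suc n))) (sumTo-head n f)) (ℤ.+-assoc (f 0) _ _)

  -- Splitting off the constant term of the left factor. Commutativity, distributivity and
  -- associativity below are inductions on the exponent through this recursion, so no double sum has
  -- to be rearranged.
  ⊗-tailˡ : ∀ f g n → (f ⊗ g) (suc n) ≡ f 0 ℤ.* g (suc n) ℤ.+ (tail f ⊗ g) n
  ⊗-tailˡ f g n = sumTo-head n (λ i → f i ℤ.* g (suc n ∸ i))

  ⊗-tailʳ : ∀ f g n → (f ⊗ g) (suc n) ≡ (f ⊗ tail g) n ℤ.+ f (suc n) ℤ.* g 0
  ⊗-tailʳ f g n = cong₂ ℤ._+_
    (sumTo-cong n (λ k k≤n → cong (λ m → f k ℤ.* g m) (ℕ.+-∸-assoc 1 k≤n)))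
    (cong (λ m → f (suc n) ℤ.* g m) (ℕ.n∸n≡0 n))

  ⊗-cong[] : ∀ {N f f′ g g′} → f ≈[ N ] f′ → g ≈[ N ] g′ → f ⊗ g ≈[ N ] f′ ⊗ g′
  ⊗-cong[] p q = mk≈[] λ k k≤N → sumTo-cong k λ i i≤k →
    cong₂ ℤ._*_ (upto p i (ℕ.≤-trans i≤k k≤N)) (upto q (k ∸ i) (ℕ.≤-trans (ℕ.m∸n≤m k i) k≤N))

  ⊕-cong[] : ∀ {N f f′ g g′} → f ≈[ N ] f′ → g ≈[ N ] g′ → f ⊕ g ≈[ N ] f′ ⊕ g′
  ⊕-cong[] p q = mk≈[] λ k k≤N → cong₂ ℤ._+_ (upto p k k≤N) (upto q k k≤N)

  ⊗-cong : ∀ {f f′ g g′} → f ≈ f′ → g ≈ g′ → f ⊗ g ≈ f′ ⊗ g′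
  ⊗-cong p q = ≈[]⇒≈ λ N → ⊗-cong[] (≈⇒≈[] p) (≈⇒≈[] q)

  ⊕-cong : ∀ {f f′ g g′} → f ≈ f′ → g ≈ g′ → f ⊕ g ≈ f′ ⊕ g′
  ⊕-cong p q = mk≈ λ n → cong₂ ℤ._+_ (at p n) (at q n)

  ⊗-comm : ∀ f g → f ⊗ g ≈ g ⊗ f
  ⊗-comm f g = mk≈ (go f g) where
    go : ∀ f g n → (f ⊗ g) n ≡ (g ⊗ f) n
    go f g zero    = ℤ.*-comm (f 0) (g 0)
    go f g (suc n) = begin
      (f ⊗ g) (suc n)                         ≡⟨ ⊗-tailˡ f g n ⟩
      f 0 ℤ.* g (suc n) ℤ.+ (tail f ⊗ g) n     ≡⟨ cong₂ ℤ._+_ (ℤ.*-comm (f 0) _) (go (tail f) g n) ⟩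
      g (suc n) ℤ.* f 0 ℤ.+ (g ⊗ tail f) n     ≡⟨ ℤ.+-comm (g (suc n) ℤ.* f 0) _ ⟩
      (g ⊗ tail f) n ℤ.+ g (suc n) ℤ.* f 0     ≡⟨ ⊗-tailʳ g f n ⟨
      (g ⊗ f) (suc n)                         ∎
      where open ≡-Reasoning

  ⊗-distribʳ-⊕ : ∀ h f g → (f ⊕ g) ⊗ h ≈ f ⊗ h ⊕ g ⊗ h
  ⊗-distribʳ-⊕ h f g = mk≈ (go f g) where
    lemma : ∀ a b c x y → (a ℤ.+ b) ℤ.* c ℤ.+ (x ℤ.+ y) ≡ (a ℤ.* c ℤ.+ x) ℤ.+ (b ℤ.* c ℤ.+ y)
    lemma = solve-∀
    go : ∀ f g n → ((f ⊕ g) ⊗ h) n ≡ (f ⊗ h) n ℤ.+ (g ⊗ h) n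
    go f g zero    = ℤ.*-distribʳ-+ (h 0) (f 0) (g 0)
    go f g (suc n) = begin
      ((f ⊕ g) ⊗ h) (suc n)
        ≡⟨ ⊗-tailˡ (f ⊕ g) h n ⟩
      (f 0 ℤ.+ g 0) ℤ.* h (suc n) ℤ.+ ((tail f ⊕ tail g) ⊗ h) n
        ≡⟨ cong (ℤ._+_ ((f 0 ℤ.+ g 0) ℤ.* h (suc n))) (go (tail f) (tail g) n) ⟩
      (f 0 ℤ.+ g 0) ℤ.* h (suc n) ℤ.+ ((tail f ⊗ h) n ℤ.+ (tail g ⊗ h) n)
        ≡⟨ lemma (f 0) (g 0) (h (suc n)) _ _ ⟩
      (f 0 ℤ.* h (suc n) ℤ.+ (tail f ⊗ h) n) ℤ.+ (g 0 ℤ.* h (suc n) ℤ.+ (tail g ⊗ h) n)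
        ≡⟨ cong₂ ℤ._+_ (⊗-tailˡ f h n) (⊗-tailˡ g h n) ⟨
      (f ⊗ h) (suc n) ℤ.+ (g ⊗ h) (suc n) ∎
      where open ≡-Reasoning

  ·-⊗ : ∀ c f g n → ((c · f) ⊗ g) n ≡ c ℤ.* (f ⊗ g) n
  ·-⊗ c f g zero    = ℤ.*-assoc c (f 0) (g 0)
  ·-⊗ c f g (suc n) = begin
    ((c · f) ⊗ g) (suc n)                                    ≡⟨ ⊗-tailˡ (c · f) g n ⟩
    c ℤ.* f 0 ℤ.* g (suc n) ℤ.+ ((c · tail f) ⊗ g) n          ≡⟨ cong (ℤ._+_ (c ℤ.* f 0 ℤ.* g (suc n))) (·-⊗ c (tail f) g n) ⟩
    c ℤ.* f 0 ℤ.* g (suc n) ℤ.+ c ℤ.* (tail f ⊗ g) n          ≡⟨ lemma c (f 0) (g (suc n)) _ ⟩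
    c ℤ.* (f 0 ℤ.* g (suc n) ℤ.+ (tail f ⊗ g) n)              ≡⟨ cong (c ℤ.*_) (⊗-tailˡ f g n) ⟨
    c ℤ.* (f ⊗ g) (suc n) ∎
    where
    open ≡-Reasoning
    lemma : ∀ c a b x → c ℤ.* a ℤ.* b ℤ.+ c ℤ.* x ≡ c ℤ.* (a ℤ.* b ℤ.+ x)
    lemma = solve-∀

  ⊗-assoc : ∀ f g h → (f ⊗ g) ⊗ h ≈ f ⊗ (g ⊗ h)
  ⊗-assoc f g h = mk≈ (go f) where
    lemma : ∀ a b c x y → a ℤ.* b ℤ.* c ℤ.+ (a ℤ.* x ℤ.+ y) ≡ a ℤ.* (b ℤ.* c ℤ.+ x) ℤ.+ y
    lemma = solve-∀
    go : ∀ f n → ((f ⊗ g) ⊗ h) n ≡ (f ⊗ (g ⊗ h)) n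
    go f zero    = ℤ.*-assoc (f 0) (g 0) (h 0)
    go f (suc n) = begin
      ((f ⊗ g) ⊗ h) (suc n)
        ≡⟨ ⊗-tailˡ (f ⊗ g) h n ⟩
      f 0 ℤ.* g 0 ℤ.* h (suc n) ℤ.+ (tail (f ⊗ g) ⊗ h) n
        ≡⟨ cong (ℤ._+_ (f 0 ℤ.* g 0 ℤ.* h (suc n))) (at (⊗-cong {g = h} (mk≈ (⊗-tailˡ f g)) ≈-refl) n) ⟩
      f 0 ℤ.* g 0 ℤ.* h (suc n) ℤ.+ ((f 0 · tail g ⊕ tail f ⊗ g) ⊗ h) n
        ≡⟨ cong (ℤ._+_ (f 0 ℤ.* g 0 ℤ.* h (suc n))) (at (⊗-distribʳ-⊕ h (f 0 · tail g) (tail f ⊗ g)) n) ⟩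
      f 0 ℤ.* g 0 ℤ.* h (suc n) ℤ.+ (((f 0 · tail g) ⊗ h) n ℤ.+ ((tail f ⊗ g) ⊗ h) n)
        ≡⟨ cong (ℤ._+_ (f 0 ℤ.* g 0 ℤ.* h (suc n))) (cong₂ ℤ._+_ (·-⊗ (f 0) (tail g) h n) (go (tail f) n)) ⟩
      f 0 ℤ.* g 0 ℤ.* h (suc n) ℤ.+ (f 0 ℤ.* (tail g ⊗ h) n ℤ.+ (tail f ⊗ (g ⊗ h)) n)
        ≡⟨ lemma (f 0) (g 0) (h (suc n)) _ _ ⟩
      f 0 ℤ.* (g 0 ℤ.* h (suc n) ℤ.+ (tail g ⊗ h) n) ℤ.+ (tail f ⊗ (g ⊗ h)) n
        ≡⟨ cong (λ z → f 0 ℤ.* z ℤ.+ (tail f ⊗ (g ⊗ h)) n) (⊗-tailˡ g h n) ⟨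
      f 0 ℤ.* (g ⊗ h) (suc n) ℤ.+ (tail f ⊗ (g ⊗ h)) n
        ≡⟨ ⊗-tailˡ f (g ⊗ h) n ⟨
      (f ⊗ (g ⊗ h)) (suc n) ∎
      where open ≡-Reasoning

  ⊗-zeroˡ : ∀ f n → (𝟘 ⊗ f) n ≡ 0ℤ
  ⊗-zeroˡ f zero    = refl
  ⊗-zeroˡ f (suc n) = trans (⊗-tailˡ 𝟘 f n) (trans (ℤ.+-identityˡ _) (⊗-zeroˡ f n))

  ⊗-identityˡ : ∀ f → 𝟙 ⊗ f ≈ f
  ⊗-identityˡ f = mk≈ go where
    go : ∀ n → (𝟙 ⊗ f) n ≡ f n
    go zero    = ℤ.*-identityˡ (f 0)
    go (suc n) = begin
      (𝟙 ⊗ f) (suc n)                       ≡⟨ ⊗-tailˡ 𝟙 f n ⟩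
      1ℤ ℤ.* f (suc n) ℤ.+ (𝟘 ⊗ f) n           ≡⟨ cong₂ ℤ._+_ (ℤ.*-identityˡ (f (suc n))) (⊗-zeroˡ f n) ⟩
      f (suc n) ℤ.+ 0ℤ                         ≡⟨ ℤ.+-identityʳ _ ⟩
      f (suc n)                               ∎
      where open ≡-Reasoning

  ⊕-assoc : ∀ f g h → (f ⊕ g) ⊕ h ≈ f ⊕ (g ⊕ h)
  ⊕-assoc f g h = mk≈ λ n → ℤ.+-assoc (f n) (g n) (h n)

  ⊕-comm : ∀ f g → f ⊕ g ≈ g ⊕ f
  ⊕-comm f g = mk≈ λ n → ℤ.+-comm (f n) (g n)

  ⊕-identityˡ : ∀ f → 𝟘 ⊕ f ≈ f
  ⊕-identityˡ f = mk≈ λ n → ℤ.+-identityˡ (f n)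

  ⊕-identityʳ : ∀ f → f ⊕ 𝟘 ≈ f
  ⊕-identityʳ f = mk≈ λ n → ℤ.+-identityʳ (f n)

  ⊕-inverseˡ : ∀ f → (⊖ f) ⊕ f ≈ 𝟘
  ⊕-inverseˡ f = mk≈ λ n → ℤ.+-inverseˡ (f n)

  ⊕-inverseʳ : ∀ f → f ⊕ (⊖ f) ≈ 𝟘
  ⊕-inverseʳ f = mk≈ λ n → ℤ.+-inverseʳ (f n)

  ⊖-cong : ∀ {f g} → f ≈ g → ⊖ f ≈ ⊖ g
  ⊖-cong p = mk≈ λ n → cong ℤ.-_ (at p n)

PS-ring : CommutativeRing 0ℓ 0ℓ
PS-ring = record
  { _≈_ = _≈_ ; _+_ = _⊕_ ; _*_ = _⊗_ ; -_ = ⊖_ ; 0# = 𝟘 ; 1# = 𝟙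
  ; isCommutativeRing = record
    { isRing = record
      { +-isAbelianGroup = record
        { isGroup = record
          { isMonoid = record
            { isSemigroup = record
              { isMagma = record
                { isEquivalence = record { refl = ≈-refl ; sym = ≈-sym ; trans = ≈-trans }
                ; ∙-cong = ⊕-cong }
              ; assoc = ⊕-assoc }
            ; identity = ⊕-identityˡ , ⊕-identityʳ }
          ; inverse = ⊕-inverseˡ , ⊕-inverseʳ
          ; ⁻¹-cong = ⊖-cong }
        ; comm = ⊕-comm }
      ; *-cong = ⊗-cong
      ; *-assoc = ⊗-assoc
      ; *-identity = ⊗-identityˡ , (λ f → ≈-trans (⊗-comm f 𝟙) (⊗-identityˡ f))
      ; distrib = (λ h f g → ≈-trans (⊗-comm h (f ⊕ g))
                    (≈-trans (⊗-distribʳ-⊕ h f g) (⊕-cong (⊗-comm f h) (⊗-comm g h))))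
                , ⊗-distribʳ-⊕
      }
    ; *-comm = ⊗-comm
    }
  }

module PSR = CommutativeRing PS-ring

-- Monomials and cancellation

opaque
  unfolding _⊗_

  mono : ℤ → ℕ → PS
  mono c zero    zero    = c
  mono c zero    (suc n) = 0ℤ
  mono c (suc e) zero    = 0ℤ
  mono c (suc e) (suc n) = mono c e n

  mono-same : ∀ c e → mono c e e ≡ c
  mono-same c zero    = refl
  mono-same c (suc e) = mono-same c e

  mono-diff : ∀ c e n → e ≢ n → mono c e n ≡ 0ℤ
  mono-diff c zero    zero    e≢n = contradiction where
    contradiction : c ≡ 0ℤ
    contradiction with () ← e≢n refl
  mono-diff c zero    (suc n) e≢n = refl
  mono-diff c (suc e) zero    e≢n = refl
  mono-diff c (suc e) (suc n) e≢n = mono-diff c e n (λ p → e≢n (cong suc p))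

  mono0-⊗ : ∀ c f → mono c 0 ⊗ f ≈ c · f
  mono0-⊗ c f = mk≈ go where
    go : ∀ n → (mono c 0 ⊗ f) n ≡ c ℤ.* f n
    go zero    = refl
    go (suc n) = trans (⊗-tailˡ (mono c 0) f n) (trans (cong (ℤ._+_ (c ℤ.* f (suc n))) (⊗-zeroˡ f n)) (ℤ.+-identityʳ _))

  monosuc-⊗-suc : ∀ c e f n → (mono c (suc e) ⊗ f) (suc n) ≡ (mono c e ⊗ f) n
  monosuc-⊗-suc c e f n = trans (⊗-tailˡ (mono c (suc e)) f n) (ℤ.+-identityˡ _)

  mono-⊗-mono : ∀ c d a b → mono c a ⊗ mono d b ≈ mono (c ℤ.* d) (a ℕ.+ b)
  mono-⊗-mono c d a b = mk≈ (go a) where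
    scale : ∀ b n → c ℤ.* mono d b n ≡ mono (c ℤ.* d) b n
    scale zero    zero    = refl
    scale zero    (suc n) = ℤ.*-zeroʳ c
    scale (suc b) zero    = ℤ.*-zeroʳ c
    scale (suc b) (suc n) = scale b n
    go : ∀ a n → (mono c a ⊗ mono d b) n ≡ mono (c ℤ.* d) (a ℕ.+ b) n
    go zero    n       = trans (at (mono0-⊗ c (mono d b)) n) (scale b n)
    go (suc a) zero    = refl
    go (suc a) (suc n) = trans (monosuc-⊗-suc c a (mono d b) n) (go a n)

  -- The factor q^e adds e to the precision. `absorb` lives on this gain, because a Gaussian
  -- coefficient near the end of a row is close to its limit only to low order.
  mono-⊗-cong[] : ∀ c e {K f g} → f ≈[ K ] g → mono c e ⊗ f ≈[ e ℕ.+ K ] mono c e ⊗ g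
  mono-⊗-cong[] c e {K} {f} {g} p = mk≈[] (go e) where
    go : ∀ e k → k ≤ e ℕ.+ K → (mono c e ⊗ f) k ≡ (mono c e ⊗ g) k
    go zero    k       k≤ = upto (⊗-cong[] (≈[]-refl {f = mono c 0}) p) k k≤
    go (suc e) zero    k≤ = refl
    go (suc e) (suc k) (s≤s k≤) = trans (monosuc-⊗-suc c e f k) (trans (go e k k≤) (sym (monosuc-⊗-suc c e g k)))

  𝟙≈mono : 𝟙 ≈ mono 1ℤ 0
  𝟙≈mono = mk≈ λ { zero → refl ; (suc n) → refl }

  mono-cong : ∀ {c d a b} → c ≡ d → a ≡ b → mono c a ≈ mono d b
  mono-cong refl refl = ≈-refl

  ifᵇ≡mono : ∀ (c : ℤ) e n → (if e ≡ᵇ n then c else 0ℤ) ≡ mono c e n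
  ifᵇ≡mono c zero    zero    = refl
  ifᵇ≡mono c zero    (suc n) = refl
  ifᵇ≡mono c (suc e) zero    = refl
  ifᵇ≡mono c (suc e) (suc n) = ifᵇ≡mono c e n

  -- Coefficient n of the product is g n plus a combination of lower coefficients of g, so agreement
  -- propagates upwards one exponent at a time.
  ⊗-cancelˡ : ∀ f {g h} → f 0 ≡ 1ℤ → f ⊗ g ≈ f ⊗ h → g ≈ h
  ⊗-cancelˡ f {g} {h} f0≡1 p = ≈[]⇒≈ go where
    head : ∀ n {x y} → f 0 ℤ.* g n ℤ.+ x ≡ f 0 ℤ.* h n ℤ.+ y → x ≡ y → g n ≡ h n
    head n {x} q refl = begin
      g n             ≡⟨ ℤ.*-identityˡ (g n) ⟨
      1ℤ ℤ.* g n      ≡⟨ cong (ℤ._* g n) f0≡1 ⟨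
      f 0 ℤ.* g n     ≡⟨ ℤ+.∙-cancelʳ x (f 0 ℤ.* g n) (f 0 ℤ.* h n) q ⟩
      f 0 ℤ.* h n     ≡⟨ cong (ℤ._* h n) f0≡1 ⟩
      1ℤ ℤ.* h n      ≡⟨ ℤ.*-identityˡ (h n) ⟩
      h n             ∎
      where open ≡-Reasoning
    go : ∀ N → g ≈[ N ] h
    go zero    = mk≈[] λ { .0 z≤n → head 0 (cong (ℤ._+ 0ℤ) (at p 0)) refl }
    go (suc N) = mk≈[] step where
      step : ∀ k → k ≤ suc N → g k ≡ h k
      step k k≤ with ℕ.m≤n⇒m<n∨m≡n k≤
      ... | inj₁ (s≤s k≤N) = upto (go N) k k≤N
      ... | inj₂ refl = head (suc N)
        (trans (sym (⊗-tailˡ f g N)) (trans (at p (suc N)) (⊗-tailˡ f h N)))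
        (upto (⊗-cong[] (≈[]-refl {f = tail f}) (go N)) N ℕ.≤-refl)

  ⊕-at : ∀ f g n → (f ⊕ g) n ≡ f n ℤ.+ g n
  ⊕-at f g n = refl

  ⊖-at : ∀ f n → (⊖ f) n ≡ ℤ.- f n
  ⊖-at f n = refl

  𝟘-at : ∀ n → 𝟘 n ≡ 0ℤ
  𝟘-at n = refl

  𝟙≈one : 𝟙 ≈ one
  𝟙≈one = ≈-refl

  ⊗≈⊛ : ∀ f g → f ⊗ g ≈ f ⊛ g
  ⊗≈⊛ f g = ≈-refl

  mono-⊗-below : ∀ c e f n → n < e → (mono c e ⊗ f) n ≡ 0ℤ
  mono-⊗-below c (suc e) f zero    _         = refl
  mono-⊗-below c (suc e) f (suc n) (s≤s n<e) = trans (monosuc-⊗-suc c e f n) (mono-⊗-below c e f n n<e)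

  mono-⊗-above : ∀ c e f n → (mono c e ⊗ f) (e ℕ.+ n) ≡ c ℤ.* f n
  mono-⊗-above c zero    f n = at (mono0-⊗ c f) n
  mono-⊗-above c (suc e) f n = trans (monosuc-⊗-suc c e f (e ℕ.+ n)) (mono-⊗-above c e f n)

  mono-⊕ : ∀ c d e → mono c e ⊕ mono d e ≈ mono (c ℤ.+ d) e
  mono-⊕ c d e = mk≈ (go e) where
    go : ∀ e n → mono c e n ℤ.+ mono d e n ≡ mono (c ℤ.+ d) e n
    go zero    zero    = refl
    go zero    (suc n) = refl
    go (suc e) zero    = refl
    go (suc e) (suc n) = go e n

  mono-zero : ∀ e → mono 0ℤ e ≈ 𝟘
  mono-zero e = mk≈ (go e) where
    go : ∀ e n → mono 0ℤ e n ≡ 0ℤ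
    go zero    zero    = refl
    go zero    (suc n) = refl
    go (suc e) zero    = refl
    go (suc e) (suc n) = go e n

open import Algebra.Solver.CommutativeMonoid PSR.*-commutativeMonoid using (solve; _⊜_) renaming (_⊕_ to _:*_; id to :1)
import Relation.Binary.Reasoning.Setoid as SetoidReasoning

module ≈-Reasoning = SetoidReasoning PSR.setoid
module ≈[]-Reasoning (N : ℕ) = SetoidReasoning (≈[]-setoid N)

-- Finite and infinite products

prod : (ℕ → PS) → ℕ → PS
prod F zero    = 𝟙
prod F (suc n) = prod F n ⊗ F n

finProd≈prod : ∀ F n → finProd F n ≈ prod F n
finProd≈prod F zero    = ≈-sym 𝟙≈one
finProd≈prod F (suc n) = ≈-trans (≈-sym (⊗≈⊛ (finProd F n) (F n))) (⊗-cong (finProd≈prod F n) ≈-refl)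

prod-cong[] : ∀ {N F G} n → (∀ i → F i ≈[ N ] G i) → prod F n ≈[ N ] prod G n
prod-cong[] zero    p = ≈[]-refl
prod-cong[] (suc n) p = ⊗-cong[] (prod-cong[] n p) (p n)

prod-cong : ∀ {F G} n → (∀ i → F i ≈ G i) → prod F n ≈ prod G n
prod-cong n p = ≈[]⇒≈ λ N → prod-cong[] n (λ i → ≈⇒≈[] (p i))

prod-⊗ : ∀ F G n → prod (λ i → F i ⊗ G i) n ≈ prod F n ⊗ prod G n
prod-⊗ F G zero    = ≈-sym (⊗-identityˡ 𝟙)
prod-⊗ F G (suc n) = ≈-trans (⊗-cong (prod-⊗ F G n) ≈-refl)
  (solve 4 (λ a b c d → (a :* b) :* (c :* d) ⊜ (a :* c) :* (b :* d)) ≈-refl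
    (prod F n) (prod G n) (F n) (G n))

prod-+ : ∀ F m n → prod F (m ℕ.+ n) ≈ prod F m ⊗ prod (λ i → F (m ℕ.+ i)) n
prod-+ F m zero    = ≈-trans (PSR.reflexive (cong (prod F) (ℕ.+-identityʳ m))) (≈-sym (PSR.*-identityʳ _))
prod-+ F m (suc n) = begin
  prod F (m ℕ.+ suc n)                                           ≡⟨ cong (prod F) (ℕ.+-suc m n) ⟩
  prod F (m ℕ.+ n) ⊗ F (m ℕ.+ n)                                 ≈⟨ ⊗-cong (prod-+ F m n) ≈-refl ⟩
  prod F m ⊗ prod (λ i → F (m ℕ.+ i)) n ⊗ F (m ℕ.+ n)         ≈⟨ ⊗-assoc (prod F m) (prod (λ i → F (m ℕ.+ i)) n) (F (m ℕ.+ n)) ⟩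
  prod F m ⊗ (prod (λ i → F (m ℕ.+ i)) n ⊗ F (m ℕ.+ n))       ∎
  where open ≈-Reasoning

opaque
  -- The same truncation as in `poch` and `pochInv`, so that those differ from it only factor by
  -- factor. It has the meaning of an infinite product when the family is `Convergent`.
  infProd : (ℕ → PS) → PS
  infProd F N = prod F (suc N) N

  infProd-at : ∀ F n → infProd F n ≡ prod F (suc n) n
  infProd-at F n = refl

-- Factor i is 1 + O(q^(i+1)), so the first N factors already fix the coefficients up to q^N.
Convergent : (ℕ → PS) → Set
Convergent F = ∀ i → F i ≈[ i ] 𝟙

prod-stable : ∀ {F} → Convergent F → ∀ {N n} → N ≤ n → prod F n ≈[ N ] prod F N
prod-stable {F} conv {N} N≤n = subst (λ n → prod F n ≈[ N ] prod F N) (ℕ.m+[n∸m]≡n N≤n) (go _)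
  where
  go : ∀ d → prod F (N ℕ.+ d) ≈[ N ] prod F N
  go zero    = ≈⇒≈[] (PSR.reflexive (cong (prod F) (ℕ.+-identityʳ N)))
  go (suc d) = begin
    prod F (N ℕ.+ suc d)             ≡⟨ cong (prod F) (ℕ.+-suc N d) ⟩
    prod F (N ℕ.+ d) ⊗ F (N ℕ.+ d)   ≈⟨ ⊗-cong[] (go d) (≈[]-mono (ℕ.m≤m+n N d) (conv (N ℕ.+ d))) ⟩
    prod F N ⊗ 𝟙                   ≈⟨ ≈⇒≈[] (PSR.*-identityʳ _) ⟩
    prod F N                         ∎
    where open ≈[]-Reasoning N

infProd-trunc : ∀ {F} → Convergent F → ∀ {N n} → N ≤ n → infProd F ≈[ N ] prod F n
infProd-trunc {F} conv {N} {n} N≤n = mk≈[] λ k k≤N → trans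
  (trans (infProd-at F k) (upto (prod-stable conv (ℕ.n≤1+n k)) k ℕ.≤-refl))
  (sym (upto (prod-stable conv (ℕ.≤-trans k≤N N≤n)) k ℕ.≤-refl))

infProd-cong : ∀ {F G} → (∀ i → F i ≈ G i) → infProd F ≈ infProd G
infProd-cong {F} {G} p = mk≈ λ n →
  trans (infProd-at F n) (trans (at (prod-cong (suc n) p) n) (sym (infProd-at G n)))

infProd-⊗ : ∀ {F G} → Convergent F → Convergent G → infProd (λ i → F i ⊗ G i) ≈ infProd F ⊗ infProd G
infProd-⊗ {F} {G} convF convG = ≈[]⇒≈ λ N → let open ≈[]-Reasoning N in begin
  infProd (λ i → F i ⊗ G i)           ≈⟨ infProd-trunc conv (ℕ.≤-refl {N}) ⟩
  prod (λ i → F i ⊗ G i) N         ≈⟨ ≈⇒≈[] (prod-⊗ F G N) ⟩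
  prod F N ⊗ prod G N           ≈⟨ ⊗-cong[] (infProd-trunc convF ℕ.≤-refl) (infProd-trunc convG ℕ.≤-refl) ⟨
  infProd F ⊗ infProd G               ∎
  where
  conv : Convergent (λ i → F i ⊗ G i)
  conv i = ≈[]-trans (⊗-cong[] (convF i) (convG i)) (≈⇒≈[] (⊗-identityˡ 𝟙))

prod-blocks : ∀ k F n → prod F (n ℕ.* k) ≈ prod (λ r → prod (λ i → F (i ℕ.* k ℕ.+ r)) n) k
prod-blocks k F zero    = go k where
  go : ∀ k → 𝟙 ≈ prod (λ _ → 𝟙) k
  go zero    = ≈-refl
  go (suc k) = ≈-trans (go k) (≈-sym (PSR.*-identityʳ _))
prod-blocks k F (suc n) = begin
  prod F (k ℕ.+ n ℕ.* k)                                           ≡⟨ cong (prod F) (ℕ.+-comm k (n ℕ.* k)) ⟩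
  prod F (n ℕ.* k ℕ.+ k)                                           ≈⟨ prod-+ F (n ℕ.* k) k ⟩
  prod F (n ℕ.* k) ⊗ prod (λ r → F (n ℕ.* k ℕ.+ r)) k           ≈⟨ ⊗-cong (prod-blocks k F n) ≈-refl ⟩
  prod (λ r → prod (λ i → F (i ℕ.* k ℕ.+ r)) n) k ⊗ prod (λ r → F (n ℕ.* k ℕ.+ r)) k
                                                                      ≈⟨ prod-⊗ _ _ k ⟨
  prod (λ r → prod (λ i → F (i ℕ.* k ℕ.+ r)) (suc n)) k         ∎
  where open ≈-Reasoning

-- The product is cut after N k factors instead of N, so that every residue class mod k receives
-- exactly N of them.
infProd-blocks : ∀ k .{{_ : ℕ.NonZero k}} {F} → Convergent F →
  infProd F ≈ prod (λ r → infProd (λ i → F (i ℕ.* k ℕ.+ r))) k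
infProd-blocks k {F} conv = ≈[]⇒≈ λ N → let open ≈[]-Reasoning N in begin
  infProd F                                                ≈⟨ infProd-trunc conv (ℕ.m≤m*n N k) ⟩
  prod F (N ℕ.* k)                                      ≈⟨ ≈⇒≈[] (prod-blocks k F N) ⟩
  prod (λ r → prod (λ i → F (i ℕ.* k ℕ.+ r)) N) k    ≈⟨ prod-cong[] k (λ r → infProd-trunc (conv′ r) ℕ.≤-refl) ⟨
  prod (λ r → infProd (λ i → F (i ℕ.* k ℕ.+ r))) k      ∎
  where
  conv′ : ∀ r → Convergent (λ i → F (i ℕ.* k ℕ.+ r))
  conv′ r i = ≈[]-mono (ℕ.≤-trans (ℕ.m≤m*n i k) (ℕ.m≤m+n _ r)) (conv _)

-- Pochhammer products

1+q : ℤ → ℕ → PS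
1+q ε k = 𝟙 ⊕ mono ε k

-- (-ε q^b ; q^c)_∞
pochε : ℤ → ℕ → ℕ → PS
pochε ε b c = infProd (λ i → 1+q ε (b ℕ.+ c ℕ.* i))

1+q-trunc : ∀ ε {K k} → K < k → 1+q ε k ≈[ K ] 𝟙
1+q-trunc ε {K} {k} K<k = mk≈[] λ j j≤K → trans (⊕-at 𝟙 (mono ε k) j) (trans
  (cong (ℤ._+_ (𝟙 j)) (mono-diff ε k j (λ k≡j → ℕ.<⇒≢ (ℕ.≤-<-trans j≤K K<k) (sym k≡j)))) (ℤ.+-identityʳ _))

index-< : ∀ b c .{{_ : ℕ.NonZero b}} .{{_ : ℕ.NonZero c}} i → i < b ℕ.+ c ℕ.* i
index-< (suc b) c i = s≤s (ℕ.≤-trans (ℕ.m≤n*m i c) (ℕ.m≤n+m _ b))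

1+q-convergent : ∀ ε b c .{{_ : ℕ.NonZero b}} .{{_ : ℕ.NonZero c}} → Convergent (λ i → 1+q ε (b ℕ.+ c ℕ.* i))
1+q-convergent ε b c i = 1+q-trunc ε (index-< b c i)

oneMinusQ≈1+q : ∀ k → oneMinusQ^ k ≈ 1+q -1ℤ k
oneMinusQ≈1+q k = mk≈ λ n → trans
  (cong₂ ℤ._+_ (sym (at 𝟙≈one n)) (trans (go k n) (ifᵇ≡mono -1ℤ k n))) (sym (⊕-at 𝟙 (mono -1ℤ k) n))
  where
  go : ∀ k n → ℤ.- (if n ≡ᵇ k then 1ℤ else 0ℤ) ≡ (if k ≡ᵇ n then -1ℤ else 0ℤ)
  go zero    zero    = refl
  go zero    (suc n) = refl
  go (suc k) zero    = refl
  go (suc k) (suc n) = go k n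

poch≈pochε : ∀ b c → poch b c ≈ pochε -1ℤ b c
poch≈pochε b c = mk≈ λ n → trans
  (at (≈-trans (finProd≈prod _ (suc n)) (prod-cong (suc n) (λ i → oneMinusQ≈1+q (b ℕ.+ c ℕ.* i)))) n)
  (sym (infProd-at (λ i → 1+q -1ℤ (b ℕ.+ c ℕ.* i)) n))

pochε-blocks : ∀ ε k b c .{{_ : ℕ.NonZero k}} .{{_ : ℕ.NonZero b}} .{{_ : ℕ.NonZero c}} →
  pochε ε b c ≈ prod (λ r → pochε ε (b ℕ.+ c ℕ.* r) (c ℕ.* k)) k
pochε-blocks ε k b c = ≈-trans (infProd-blocks k (1+q-convergent ε b c))
  (prod-cong k λ r → infProd-cong λ i → PSR.reflexive (cong (1+q ε) (eq b c i k r)))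
  where
  eq : ∀ b c i k r → b ℕ.+ c ℕ.* (i ℕ.* k ℕ.+ r) ≡ b ℕ.+ c ℕ.* r ℕ.+ c ℕ.* k ℕ.* i
  eq = ℕ-Solver.solve-∀

pochε-zero : ∀ ε b c .{{_ : ℕ.NonZero b}} .{{_ : ℕ.NonZero c}} → pochε ε b c 0 ≡ 1ℤ
pochε-zero ε b c = trans (upto (infProd-trunc (1+q-convergent ε b c) (z≤n {0})) 0 z≤n) (at 𝟙≈one 0)

[1-q][1+q] : ∀ k → 1+q -1ℤ k ⊗ 1+q 1ℤ k ≈ 1+q -1ℤ (2 ℕ.* k)
[1-q][1+q] k = begin
  1+q -1ℤ k ⊗ 1+q 1ℤ k
    ≈⟨ PSR.distribʳ (1+q 1ℤ k) 𝟙 (mono -1ℤ k) ⟩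
  𝟙 ⊗ 1+q 1ℤ k ⊕ mono -1ℤ k ⊗ 1+q 1ℤ k
    ≈⟨ ⊕-cong (⊗-identityˡ _) (PSR.distribˡ (mono -1ℤ k) 𝟙 (mono 1ℤ k)) ⟩
  1+q 1ℤ k ⊕ (mono -1ℤ k ⊗ 𝟙 ⊕ mono -1ℤ k ⊗ mono 1ℤ k)
    ≈⟨ ⊕-cong ≈-refl (⊕-cong (PSR.*-identityʳ _) (≈-trans (mono-⊗-mono -1ℤ 1ℤ k k) (mono-cong refl (cong (k ℕ.+_) (sym (ℕ.+-identityʳ k)))))) ⟩
  (𝟙 ⊕ mono 1ℤ k) ⊕ (mono -1ℤ k ⊕ mono -1ℤ (2 ℕ.* k))
    ≈⟨ lemma 𝟙 (mono 1ℤ k) (mono -1ℤ k) (mono -1ℤ (2 ℕ.* k)) opp ⟩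
  1+q -1ℤ (2 ℕ.* k) ∎
  where
  open ≈-Reasoning
  opp : mono 1ℤ k ⊕ mono -1ℤ k ≈ 𝟘
  opp = ≈-trans (mono-⊕ 1ℤ -1ℤ k) (mono-zero k)
  lemma : ∀ a b c d → b ⊕ c ≈ 𝟘 → (a ⊕ b) ⊕ (c ⊕ d) ≈ a ⊕ d
  lemma a b c d p = ≈-trans (⊕-assoc a b (c ⊕ d)) (⊕-cong ≈-refl
    (≈-trans (≈-sym (⊕-assoc b c d)) (≈-trans (⊕-cong p ≈-refl) (⊕-identityˡ d))))

pochε-double : ∀ b c .{{_ : ℕ.NonZero b}} .{{_ : ℕ.NonZero c}} →
  pochε -1ℤ b c ⊗ pochε 1ℤ b c ≈ pochε -1ℤ (2 ℕ.* b) (2 ℕ.* c)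
pochε-double b c = begin
  pochε -1ℤ b c ⊗ pochε 1ℤ b c
    ≈⟨ infProd-⊗ (1+q-convergent -1ℤ b c) (1+q-convergent 1ℤ b c) ⟨
  infProd (λ i → 1+q -1ℤ (b ℕ.+ c ℕ.* i) ⊗ 1+q 1ℤ (b ℕ.+ c ℕ.* i))
    ≈⟨ infProd-cong (λ i → ≈-trans ([1-q][1+q] (b ℕ.+ c ℕ.* i)) (PSR.reflexive (cong (1+q -1ℤ) (eq b c i)))) ⟩
  pochε -1ℤ (2 ℕ.* b) (2 ℕ.* c) ∎
  where
  open ≈-Reasoning
  eq : ∀ b c i → 2 ℕ.* (b ℕ.+ c ℕ.* i) ≡ 2 ℕ.* b ℕ.+ 2 ℕ.* c ℕ.* i
  eq = ℕ-Solver.solve-∀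

-- Geometric series and reciprocals of Pochhammer products

geomQ-yes : ∀ {k n} → k ∣ n → geomQ^ k n ≡ 1ℤ
geomQ-yes {k} {n} k∣n = cong (λ b → if b then 1ℤ else 0ℤ) (trans (isYes≗does (k ∣? n)) (dec-true (k ∣? n) k∣n))

geomQ-no : ∀ {k n} → ¬ (k ∣ n) → geomQ^ k n ≡ 0ℤ
geomQ-no {k} {n} k∤n = cong (λ b → if b then 1ℤ else 0ℤ) (trans (isYes≗does (k ∣? n)) (dec-false (k ∣? n) k∤n))

geomQ-trunc : ∀ {K k} → K < k → geomQ^ k ≈[ K ] 𝟙
geomQ-trunc {K} {k} K<k = mk≈[] λ where
  zero    _   → trans (geomQ-yes (k ∣0)) (sym (at 𝟙≈one 0))
  (suc j) j<K → trans (geomQ-no λ k∣ → ℕ.<⇒≱ (ℕ.≤-<-trans j<K K<k) (∣⇒≤ k∣)) (sym (at 𝟙≈one (suc j)))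

geomQ-shift : ∀ k n → geomQ^ k (k ℕ.+ n) ≡ geomQ^ k n
geomQ-shift k n with k ∣? n
... | yes k∣n = geomQ-yes (∣m∣n⇒∣m+n ∣-refl k∣n)
... | no  k∤n = geomQ-no λ k∣ → k∤n (∣m+n∣m⇒∣n k∣ ∣-refl)

-- Below q^k the shifted copy has not begun and the geometric series agrees with 1; from q^k on the
-- two copies cancel by periodicity.
[1-q]⊗geomQ : ∀ k .{{_ : ℕ.NonZero k}} → 1+q -1ℤ k ⊗ geomQ^ k ≈ 𝟙
[1-q]⊗geomQ k@(suc _) = begin
  1+q -1ℤ k ⊗ geomQ^ k                          ≈⟨ PSR.distribʳ (geomQ^ k) 𝟙 (mono -1ℤ k) ⟩
  𝟙 ⊗ geomQ^ k ⊕ mono -1ℤ k ⊗ geomQ^ k        ≈⟨ ⊕-cong (⊗-identityˡ (geomQ^ k)) ≈-refl ⟩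
  geomQ^ k ⊕ mono -1ℤ k ⊗ geomQ^ k              ≈⟨ mk≈ (λ n → trans (⊕-at (geomQ^ k) (mono -1ℤ k ⊗ geomQ^ k) n) (go n)) ⟩
  𝟙                                             ∎
  where
  open ≈-Reasoning
  go : ∀ n → geomQ^ k n ℤ.+ (mono -1ℤ k ⊗ geomQ^ k) n ≡ 𝟙 n
  go n with n ℕ.<? k
  ... | yes n<k = trans (cong (ℤ._+_ (geomQ^ k n)) (mono-⊗-below -1ℤ k (geomQ^ k) n n<k))
                    (trans (ℤ.+-identityʳ _) (upto (geomQ-trunc n<k) n ℕ.≤-refl))
  ... | no  n≮k = subst (λ n → geomQ^ k n ℤ.+ (mono -1ℤ k ⊗ geomQ^ k) n ≡ 𝟙 n) (ℕ.m+[n∸m]≡n (ℕ.≮⇒≥ n≮k)) (eq (n ∸ k))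
    where
    eq : ∀ m → geomQ^ k (k ℕ.+ m) ℤ.+ (mono -1ℤ k ⊗ geomQ^ k) (k ℕ.+ m) ≡ 𝟙 (k ℕ.+ m)
    eq m = trans (cong₂ ℤ._+_ (geomQ-shift k m) (trans (mono-⊗-above -1ℤ k (geomQ^ k) m) (ℤ.-1*i≡-i (geomQ^ k m))))
                 (trans (ℤ.+-inverseʳ (geomQ^ k m)) (sym (at 𝟙≈one (k ℕ.+ m))))

pochInv≈infProd : ∀ b c → pochInv b c ≈ infProd (λ i → geomQ^ (b ℕ.+ c ℕ.* i))
pochInv≈infProd b c = mk≈ λ n → trans (at (finProd≈prod _ (suc n)) n) (sym (infProd-at _ n))

pochε⊗pochInv : ∀ b c .{{_ : ℕ.NonZero b}} .{{_ : ℕ.NonZero c}} → pochε -1ℤ b c ⊗ pochInv b c ≈ 𝟙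
pochε⊗pochInv b@(suc _) c = begin
  pochε -1ℤ b c ⊗ pochInv b c
    ≈⟨ ⊗-cong ≈-refl (pochInv≈infProd b c) ⟩
  pochε -1ℤ b c ⊗ infProd (λ i → geomQ^ (b ℕ.+ c ℕ.* i))
    ≈⟨ infProd-⊗ (1+q-convergent -1ℤ b c) (λ i → geomQ-trunc (index-< b c i)) ⟨
  infProd (λ i → 1+q -1ℤ (b ℕ.+ c ℕ.* i) ⊗ geomQ^ (b ℕ.+ c ℕ.* i))
    ≈⟨ infProd-cong (λ i → [1-q]⊗geomQ (b ℕ.+ c ℕ.* i)) ⟩
  infProd (λ _ → 𝟙)
    ≈⟨ mk≈ (λ n → trans (infProd-at (λ _ → 𝟙) n) (at (ones (suc n)) n)) ⟩
  𝟙 ∎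
  where
  open ≈-Reasoning
  ones : ∀ n → prod (λ _ → 𝟙) n ≈ 𝟙
  ones zero    = ≈-refl
  ones (suc n) = ≈-trans (PSR.*-identityʳ _) (ones n)

⊖-mono : ∀ c e → ⊖ mono c e ≈ mono (ℤ.- c) e
⊖-mono c e = begin
  ⊖ mono c e                                          ≈⟨ ⊕-identityʳ _ ⟨
  ⊖ mono c e ⊕ 𝟘                                      ≈⟨ ⊕-cong ≈-refl (≈-trans (mono-⊕ c (ℤ.- c) e) (≈-trans (mono-cong (ℤ.+-inverseʳ c) refl) (mono-zero e))) ⟨
  ⊖ mono c e ⊕ (mono c e ⊕ mono (ℤ.- c) e)            ≈⟨ ⊕-assoc _ _ _ ⟨
  (⊖ mono c e ⊕ mono c e) ⊕ mono (ℤ.- c) e            ≈⟨ ⊕-cong (⊕-inverseˡ _) ≈-refl ⟩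
  𝟘 ⊕ mono (ℤ.- c) e                                  ≈⟨ ⊕-identityˡ _ ⟩
  mono (ℤ.- c) e                                      ∎
  where open ≈-Reasoning

PS-almostRing : AlmostCommutativeRing _ _
PS-almostRing = fromCommutativeRing PS-ring

constants : ℤ.+-*-rawRing -Raw-AlmostCommutative⟶ PS-almostRing
constants = record
  { ⟦_⟧    = λ c → mono c 0
  ; +-homo = λ c d → ≈-sym (mono-⊕ c d 0)
  ; *-homo = λ c d → ≈-sym (mono-⊗-mono c d 0 0)
  ; -‿homo = λ c → ≈-sym (⊖-mono c 0)
  ; 0-homo = mono-zero 0
  ; 1-homo = ≈-sym 𝟙≈mono
  }

constants-≟ : WeaklyDecidable (Induced-equivalence constants)
constants-≟ c d with c ℤ.≟ d
... | yes refl = just ≈-refl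
... | no  _    = nothing

module PS-Solver = Algebra.Solver.Ring ℤ.+-*-rawRing PS-almostRing constants constants-≟

-- Gaussian binomial coefficients

module Gaussian (c : ℕ) where

  Q^ : ℕ → PS
  Q^ n = mono 1ℤ (c ℕ.* n)

  Q^-+ : ∀ m n → Q^ m ⊗ Q^ n ≈ Q^ (m ℕ.+ n)
  Q^-+ m n = ≈-trans (mono-⊗-mono 1ℤ 1ℤ _ _) (mono-cong refl (sym (ℕ.*-distribˡ-+ c m n)))

  -- gauss m n is [m+n choose n] in base q^c, indexed so that no subtraction occurs.
  gauss : ℕ → ℕ → PS
  gauss zero    n       = 𝟙
  gauss (suc m) zero    = 𝟙
  gauss (suc m) (suc n) = gauss m (suc n) ⊕ Q^ (suc m) ⊗ gauss (suc m) n

  gauss-zeroʳ : ∀ m → gauss m 0 ≈ 𝟙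
  gauss-zeroʳ zero    = ≈-refl
  gauss-zeroʳ (suc m) = ≈-refl

  private
    open PS-Solver using (_:=_; :-_; _:+_) renaming (_:*_ to _:×_)

    step₁ : ∀ x y A G → A ⊕ ⊖ (y ⊗ A) ≈ G ⊕ ⊖ (x ⊗ G) →
      (A ⊕ x ⊗ G) ⊕ ⊖ (y ⊗ (A ⊕ x ⊗ G)) ≈ G ⊕ ⊖ ((x ⊗ y) ⊗ G)
    step₁ x y A G p = begin
      (A ⊕ x ⊗ G) ⊕ ⊖ (y ⊗ (A ⊕ x ⊗ G))
        ≈⟨ PS-Solver.solve 4 (λ x y A G → (A :+ x :× G) :+ :- (y :× (A :+ x :× G)) := (A :+ :- (y :× A)) :+ (x :× G :+ :- (y :× (x :× G)))) ≈-refl x y A G ⟩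
      (A ⊕ ⊖ (y ⊗ A)) ⊕ (x ⊗ G ⊕ ⊖ (y ⊗ (x ⊗ G)))
        ≈⟨ ⊕-cong p ≈-refl ⟩
      (G ⊕ ⊖ (x ⊗ G)) ⊕ (x ⊗ G ⊕ ⊖ (y ⊗ (x ⊗ G)))
        ≈⟨ PS-Solver.solve 3 (λ x y G → (G :+ :- (x :× G)) :+ (x :× G :+ :- (y :× (x :× G))) := G :+ :- ((x :× y) :× G)) ≈-refl x y G ⟩
      G ⊕ ⊖ ((x ⊗ y) ⊗ G) ∎
      where open ≈-Reasoning

    step₂ : ∀ x y G B → G ⊕ ⊖ (y ⊗ G) ≈ B ⊕ ⊖ (x ⊗ B) →
      (G ⊕ x ⊗ B) ⊕ ⊖ (x ⊗ (G ⊕ x ⊗ B)) ≈ G ⊕ ⊖ ((x ⊗ y) ⊗ G)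
    step₂ x y G B p = begin
      (G ⊕ x ⊗ B) ⊕ ⊖ (x ⊗ (G ⊕ x ⊗ B))
        ≈⟨ PS-Solver.solve 3 (λ x G B → (G :+ x :× B) :+ :- (x :× (G :+ x :× B)) := (G :+ :- (x :× G)) :+ x :× (B :+ :- (x :× B))) ≈-refl x G B ⟩
      (G ⊕ ⊖ (x ⊗ G)) ⊕ x ⊗ (B ⊕ ⊖ (x ⊗ B))
        ≈⟨ ⊕-cong ≈-refl (⊗-cong ≈-refl p) ⟨
      (G ⊕ ⊖ (x ⊗ G)) ⊕ x ⊗ (G ⊕ ⊖ (y ⊗ G))
        ≈⟨ PS-Solver.solve 3 (λ x y G → (G :+ :- (x :× G)) :+ x :× (G :+ :- (y :× G)) := G :+ :- ((x :× y) :× G)) ≈-refl x y G ⟩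
      G ⊕ ⊖ ((x ⊗ y) ⊗ G) ∎
      where open ≈-Reasoning

    minus : ∀ {m n m′ n′} G → m ℕ.+ n ≡ m′ ℕ.+ n′ → G ⊕ ⊖ ((Q^ m ⊗ Q^ n) ⊗ G) ≈ G ⊕ ⊖ ((Q^ m′ ⊗ Q^ n′) ⊗ G)
    minus {m} {n} {m′} {n′} G eq = ⊕-cong ≈-refl (⊖-cong (⊗-cong
      (≈-trans (Q^-+ m n) (≈-trans (mono-cong refl (cong (c ℕ.*_) eq)) (≈-sym (Q^-+ m′ n′)))) ≈-refl))

    minus₁ : ∀ {m n k} G → m ℕ.+ n ≡ k → G ⊕ ⊖ ((Q^ m ⊗ Q^ n) ⊗ G) ≈ G ⊕ ⊖ (Q^ k ⊗ G)
    minus₁ {m} {n} G refl = ⊕-cong ≈-refl (⊖-cong (⊗-cong (Q^-+ m n) ≈-refl))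

  -- The quotient of two neighbouring q-binomials, cleared of denominators. Both sides equal (1 -
  -- Q^(m+n+1)) `gauss m n`: `step₁` reduces the left one by induction on m, `step₂` the right one
  -- by induction on n.
  gauss-ratio : ∀ m n → gauss m (suc n) ⊕ ⊖ (Q^ (suc n) ⊗ gauss m (suc n))
                      ≈ gauss (suc m) n ⊕ ⊖ (Q^ (suc m) ⊗ gauss (suc m) n)
  gauss-ratio zero    zero    = ≈-refl
  gauss-ratio zero    (suc n) = ≈-sym (≈-trans
    (step₂ (Q^ 1) (Q^ (suc n)) 𝟙 (gauss 1 n) (gauss-ratio zero n))
    (minus₁ {1} {suc n} 𝟙 refl))
  gauss-ratio (suc m) zero    = ≈-trans
    (step₁ (Q^ (suc m)) (Q^ 1) (gauss m 1) 𝟙 (gauss-ratio m zero))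
    (minus₁ {suc m} {1} 𝟙 (ℕ.+-comm (suc m) 1))
  gauss-ratio (suc m) (suc n) = ≈-trans
    (step₁ (Q^ (suc m)) (Q^ (2 ℕ.+ n)) (gauss m (2 ℕ.+ n)) G (gauss-ratio m (suc n)))
    (≈-trans (minus {suc m} {2 ℕ.+ n} {2 ℕ.+ m} {suc n} G (cong suc (ℕ.+-suc m (suc n))))
    (≈-sym (step₂ (Q^ (2 ℕ.+ m)) (Q^ (suc n)) G (gauss (2 ℕ.+ m) n) (gauss-ratio (suc m) n))))
    where G = gauss (suc m) (suc n)

  -- The second q-Pascal rule. With A, B, x, y as below, A + xB = yA + B is `gauss-ratio` A - yA = B
  -- - xB with the terms moved across.
  gauss-pascal′ : ∀ m n → gauss (suc m) (suc n) ≈ Q^ (suc n) ⊗ gauss m (suc n) ⊕ gauss (suc m) n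
  gauss-pascal′ m n = begin
    A ⊕ x ⊗ B                                 ≈⟨ PS-Solver.solve 4 (λ x y A B → A :+ x :× B := (A :+ :- (y :× A)) :+ (y :× A :+ x :× B)) ≈-refl x y A B ⟩
    (A ⊕ ⊖ (y ⊗ A)) ⊕ (y ⊗ A ⊕ x ⊗ B)         ≈⟨ ⊕-cong (gauss-ratio m n) ≈-refl ⟩
    (B ⊕ ⊖ (x ⊗ B)) ⊕ (y ⊗ A ⊕ x ⊗ B)         ≈⟨ PS-Solver.solve 4 (λ x y A B → (B :+ :- (x :× B)) :+ (y :× A :+ x :× B) := y :× A :+ B) ≈-refl x y A B ⟩
    y ⊗ A ⊕ B                                 ∎
    where
    open ≈-Reasoning
    x = Q^ (suc m)
    y = Q^ (suc n)
    A = gauss m (suc n)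
    B = gauss (suc m) n

  -- (q^c ; q^c)_n
  qfac : ℕ → PS
  qfac = prod (λ i → 1+q -1ℤ (c ℕ.+ c ℕ.* i))

  1+q⊗ : ∀ n f → 1+q -1ℤ (c ℕ.* n) ⊗ f ≈ f ⊕ ⊖ (Q^ n ⊗ f)
  1+q⊗ n f = begin
    (𝟙 ⊕ mono -1ℤ (c ℕ.* n)) ⊗ f           ≈⟨ ⊗-distribʳ-⊕ f 𝟙 _ ⟩
    𝟙 ⊗ f ⊕ mono -1ℤ (c ℕ.* n) ⊗ f         ≈⟨ ⊕-cong (⊗-identityˡ f) (⊗-cong (≈-sym (⊖-mono 1ℤ (c ℕ.* n))) ≈-refl) ⟩
    f ⊕ (⊖ Q^ n) ⊗ f                       ≈⟨ PS-Solver.solve 2 (λ f q → f :+ (:- q) :× f := f :+ :- (q :× f)) ≈-refl f (Q^ n) ⟩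
    f ⊕ ⊖ (Q^ n ⊗ f)                       ∎
    where open ≈-Reasoning

  -- By `gauss-ratio` each factor 1 - Q^(n+1) of `qfac` is traded for a factor 1 - Q^(m+1), which is
  -- 1 up to q^m.
  gauss-limʳ : .{{_ : ℕ.NonZero c}} → ∀ m n → gauss m n ⊗ qfac n ≈[ m ] 𝟙
  gauss-limʳ m zero    = ≈⇒≈[] (≈-trans (PSR.*-identityʳ _) (gauss-zeroʳ m))
  gauss-limʳ m (suc n) = begin
    gauss m (suc n) ⊗ (qfac n ⊗ 1+q -1ℤ (c ℕ.+ c ℕ.* n))
      ≈⟨ ≈⇒≈[] (solve 3 (λ a b d → a :* (b :* d) ⊜ (d :* a) :* b) ≈-refl (gauss m (suc n)) (qfac n) (1+q -1ℤ (c ℕ.+ c ℕ.* n))) ⟩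
    1+q -1ℤ (c ℕ.+ c ℕ.* n) ⊗ gauss m (suc n) ⊗ qfac n
      ≡⟨ cong (λ k → 1+q -1ℤ k ⊗ gauss m (suc n) ⊗ qfac n) (sym (ℕ.*-suc c n)) ⟩
    1+q -1ℤ (c ℕ.* suc n) ⊗ gauss m (suc n) ⊗ qfac n
      ≈⟨ ≈⇒≈[] (⊗-cong (≈-trans (1+q⊗ (suc n) _) (≈-trans (gauss-ratio m n) (≈-sym (1+q⊗ (suc m) _)))) ≈-refl) ⟩
    1+q -1ℤ (c ℕ.* suc m) ⊗ gauss (suc m) n ⊗ qfac n
      ≈⟨ ≈⇒≈[] (⊗-assoc _ _ _) ⟩
    1+q -1ℤ (c ℕ.* suc m) ⊗ (gauss (suc m) n ⊗ qfac n)
      ≈⟨ ⊗-cong[] (1+q-trunc -1ℤ (ℕ.m≤n*m (suc m) c)) (≈[]-mono (ℕ.n≤1+n m) (gauss-limʳ (suc m) n)) ⟩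
    𝟙 ⊗ 𝟙
      ≈⟨ ≈⇒≈[] (⊗-identityˡ 𝟙) ⟩
    𝟙 ∎
    where open ≈[]-Reasoning m

  -- Transposing the indices turns the first Pascal rule into the second.
  gauss-sym : ∀ m n → gauss m n ≈ gauss n m
  gauss-sym zero    n       = ≈-sym (gauss-zeroʳ n)
  gauss-sym (suc m) zero    = ≈-refl
  gauss-sym (suc m) (suc n) = begin
    gauss m (suc n) ⊕ Q^ (suc m) ⊗ gauss (suc m) n     ≈⟨ ⊕-cong (gauss-sym m (suc n)) (⊗-cong ≈-refl (gauss-sym (suc m) n)) ⟩
    gauss (suc n) m ⊕ Q^ (suc m) ⊗ gauss n (suc m)     ≈⟨ ⊕-comm _ _ ⟩
    Q^ (suc m) ⊗ gauss n (suc m) ⊕ gauss (suc n) m     ≈⟨ gauss-pascal′ n m ⟨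
    gauss (suc n) (suc m)                              ∎
    where open ≈-Reasoning

  qfac-trunc : .{{_ : ℕ.NonZero c}} → ∀ {m n} → m ≤ n → qfac n ≈[ m ] qfac m
  qfac-trunc m≤n = prod-stable (1+q-convergent -1ℤ c c) m≤n

-- Sums over antidiagonals

-- The sum of Y p r over p + r = M, in the order of increasing r. Keeping both indices avoids the
-- truncated difference M ∸ r.
antidiagonal : ℕ → (ℕ → ℕ → PS) → PS
antidiagonal zero    Y = Y 0 0
antidiagonal (suc M) Y = Y (suc M) 0 ⊕ antidiagonal M (λ p r → Y p (suc r))

antidiagonal-cong[] : ∀ {N} M {Y Z} → (∀ p r → p ℕ.+ r ≡ M → Y p r ≈[ N ] Z p r) → antidiagonal M Y ≈[ N ] antidiagonal M Z
antidiagonal-cong[] zero    h = h 0 0 refl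
antidiagonal-cong[] (suc M) h = ⊕-cong[] (h (suc M) 0 (ℕ.+-identityʳ _))
  (antidiagonal-cong[] M λ p r p+r≡M → h p (suc r) (trans (ℕ.+-suc p r) (cong suc p+r≡M)))

antidiagonal-cong : ∀ M {Y Z} → (∀ p r → p ℕ.+ r ≡ M → Y p r ≈ Z p r) → antidiagonal M Y ≈ antidiagonal M Z
antidiagonal-cong M h = ≈[]⇒≈ λ N → antidiagonal-cong[] M λ p r eq → ≈⇒≈[] (h p r eq)

antidiagonal-⊗ : ∀ M u Y → antidiagonal M (λ p r → Y p r ⊗ u) ≈ antidiagonal M Y ⊗ u
antidiagonal-⊗ zero    u Y = ≈-refl
antidiagonal-⊗ (suc M) u Y = ≈-trans (⊕-cong ≈-refl (antidiagonal-⊗ M u _)) (≈-sym (⊗-distribʳ-⊕ u _ _))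

-- The summed form of a Pascal rule: A p r is collected at (suc p, r) and B p r at (p, suc r), and
-- the two ends of the row receive one contribution each.
antidiagonal-split : ∀ M Y A B →
  (∀ p → Y (suc p) 0 ≈ A p 0) → (∀ r → Y 0 (suc r) ≈ B 0 r) →
  (∀ p r → Y (suc p) (suc r) ≈ A p (suc r) ⊕ B (suc p) r) →
  antidiagonal (suc M) Y ≈ antidiagonal M A ⊕ antidiagonal M B
antidiagonal-split M Y A B hA hB hAB =
  ≈-trans (⊕-cong (hA M) ≈-refl) (≈-trans (⊕-comm (A M 0) _) (go M Y A B hB hAB))
  where
  open PS-Solver using (_:=_; _:+_)
  -- The induction shifts r, after which the hypothesis about r = 0 is no longer available. The
  -- first entry of the row is therefore already replaced by `A M 0` and kept apart.
  go : ∀ M Y A B → (∀ r → Y 0 (suc r) ≈ B 0 r) →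
    (∀ p r → Y (suc p) (suc r) ≈ A p (suc r) ⊕ B (suc p) r) →
    antidiagonal M (λ p r → Y p (suc r)) ⊕ A M 0 ≈ antidiagonal M A ⊕ antidiagonal M B
  go zero    Y A B hB hAB = ≈-trans (⊕-cong (hB 0) ≈-refl) (⊕-comm (B 0 0) (A 0 0))
  go (suc M) Y A B hB hAB = begin
    (Y (suc M) 1 ⊕ antidiagonal M (λ p r → Y p (suc (suc r)))) ⊕ A (suc M) 0
      ≈⟨ ⊕-cong (⊕-cong (hAB M 0) ≈-refl) ≈-refl ⟩
    ((A M 1 ⊕ B (suc M) 0) ⊕ antidiagonal M (λ p r → Y p (suc (suc r)))) ⊕ A (suc M) 0
      ≈⟨ PS-Solver.solve 4 (λ a b y z → ((a :+ b) :+ y) :+ z := (z :+ b) :+ (y :+ a)) ≈-refl (A M 1) (B (suc M) 0) _ (A (suc M) 0) ⟩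
    (A (suc M) 0 ⊕ B (suc M) 0) ⊕ (antidiagonal M (λ p r → Y p (suc (suc r))) ⊕ A M 1)
      ≈⟨ ⊕-cong ≈-refl (go M (λ p r → Y p (suc r)) (λ p r → A p (suc r)) (λ p r → B p (suc r)) (λ r → hB (suc r)) (λ p r → hAB p (suc r))) ⟩
    (A (suc M) 0 ⊕ B (suc M) 0) ⊕ (antidiagonal M (λ p r → A p (suc r)) ⊕ antidiagonal M (λ p r → B p (suc r)))
      ≈⟨ PS-Solver.solve 4 (λ a b y z → (a :+ b) :+ (y :+ z) := (a :+ y) :+ (b :+ z)) ≈-refl (A (suc M) 0) (B (suc M) 0) _ _ ⟩
    antidiagonal (suc M) A ⊕ antidiagonal (suc M) B ∎
    where open ≈-Reasoning

-- The Jacobi triple product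

tri : ℕ → ℕ
tri zero    = 0
tri (suc n) = suc n ℕ.+ tri n

-- a j(j+1)/2 + b j(j-1)/2
θ : ℕ → ℕ → ℤ → ℕ
θ a b (+ n)    = a ℕ.* tri n ℕ.+ b ℕ.* tri (n ∸ 1)
θ a b -[1+ n ] = a ℕ.* tri n ℕ.+ b ℕ.* tri (suc n)

2*-injective : ∀ {m n} → + 2 ℤ.* + m ≡ + 2 ℤ.* + n → m ≡ n
2*-injective {m} {n} p = ℤ.+-injective (ℤ.*-cancelˡ-≡ (+ 2) (+ m) (+ n) p)

tri-spec : ∀ n → + 2 ℤ.* + tri n ≡ + n ℤ.* (+ n ℤ.+ 1ℤ)
tri-spec zero    = refl
tri-spec (suc n) = begin
  + 2 ℤ.* (+ suc n ℤ.+ + tri n)                    ≡⟨ ℤ.*-distribˡ-+ (+ 2) (+ suc n) (+ tri n) ⟩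
  + 2 ℤ.* + suc n ℤ.+ + 2 ℤ.* + tri n              ≡⟨ cong (ℤ._+_ (+ 2 ℤ.* + suc n)) (tri-spec n) ⟩
  + 2 ℤ.* (1ℤ ℤ.+ + n) ℤ.+ + n ℤ.* (+ n ℤ.+ 1ℤ)    ≡⟨ lemma (+ n) ⟩
  (1ℤ ℤ.+ + n) ℤ.* ((1ℤ ℤ.+ + n) ℤ.+ 1ℤ)           ∎
  where
  open ≡-Reasoning
  lemma : ∀ n → + 2 ℤ.* (1ℤ ℤ.+ n) ℤ.+ n ℤ.* (n ℤ.+ 1ℤ) ≡ (1ℤ ℤ.+ n) ℤ.* ((1ℤ ℤ.+ n) ℤ.+ 1ℤ)
  lemma = solve-∀

-- Doubling clears the denominators: together with `2*-injective`, an equation between exponents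
-- becomes a polynomial identity over ℤ that a ring solver decides.
θ-spec : ∀ a b j → + 2 ℤ.* + θ a b j ≡ (+ a ℤ.+ + b) ℤ.* (j ℤ.* j) ℤ.+ (+ a ℤ.- + b) ℤ.* j
θ-spec a b j = trans (expand j) (poly j)
  where
  A B : ℤ → ℕ
  A (+ n)    = tri n
  A -[1+ n ] = tri n
  B (+ n)    = tri (n ∸ 1)
  B -[1+ n ] = tri (suc n)
  Aspec : ∀ j → + 2 ℤ.* + A j ≡ j ℤ.* (j ℤ.+ 1ℤ)
  Aspec (+ n)    = tri-spec n
  Aspec -[1+ n ] = trans (tri-spec n) (lemma (+ n)) where
    lemma : ∀ n → n ℤ.* (n ℤ.+ 1ℤ) ≡ (ℤ.- (1ℤ ℤ.+ n)) ℤ.* ((ℤ.- (1ℤ ℤ.+ n)) ℤ.+ 1ℤ)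
    lemma = solve-∀
  Bspec : ∀ j → + 2 ℤ.* + B j ≡ j ℤ.* (j ℤ.- 1ℤ)
  Bspec (+ zero)  = refl
  Bspec (+ suc n) = trans (tri-spec n) (lemma (+ n)) where
    lemma : ∀ n → n ℤ.* (n ℤ.+ 1ℤ) ≡ (1ℤ ℤ.+ n) ℤ.* ((1ℤ ℤ.+ n) ℤ.- 1ℤ)
    lemma = solve-∀
  Bspec -[1+ n ]  = trans (tri-spec (suc n)) (lemma (+ n)) where
    lemma : ∀ n → (1ℤ ℤ.+ n) ℤ.* ((1ℤ ℤ.+ n) ℤ.+ 1ℤ) ≡ (ℤ.- (1ℤ ℤ.+ n)) ℤ.* ((ℤ.- (1ℤ ℤ.+ n)) ℤ.- 1ℤ)
    lemma = solve-∀
  cast : ∀ m n → + 2 ℤ.* + (a ℕ.* m ℕ.+ b ℕ.* n) ≡ + a ℤ.* (+ 2 ℤ.* + m) ℤ.+ + b ℤ.* (+ 2 ℤ.* + n)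
  cast m n = trans (cong (+ 2 ℤ.*_) (cong₂ ℤ._+_ (ℤ.pos-* a m) (ℤ.pos-* b n))) (lemma (+ a) (+ b) (+ m) (+ n)) where
    lemma : ∀ a b m n → + 2 ℤ.* (a ℤ.* m ℤ.+ b ℤ.* n) ≡ a ℤ.* (+ 2 ℤ.* m) ℤ.+ b ℤ.* (+ 2 ℤ.* n)
    lemma = solve-∀
  expand : ∀ j → + 2 ℤ.* + θ a b j ≡ + a ℤ.* (+ 2 ℤ.* + A j) ℤ.+ + b ℤ.* (+ 2 ℤ.* + B j)
  expand (+ n)    = cast (tri n) (tri (n ∸ 1))
  expand -[1+ n ] = cast (tri n) (tri (suc n))
  poly : ∀ j → + a ℤ.* (+ 2 ℤ.* + A j) ℤ.+ + b ℤ.* (+ 2 ℤ.* + B j) ≡ (+ a ℤ.+ + b) ℤ.* (j ℤ.* j) ℤ.+ (+ a ℤ.- + b) ℤ.* j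
  poly j = trans (cong₂ (λ x y → + a ℤ.* x ℤ.+ + b ℤ.* y) (Aspec j) (Bspec j)) (lemma (+ a) (+ b) j) where
    lemma : ∀ a b j → a ℤ.* (j ℤ.* (j ℤ.+ 1ℤ)) ℤ.+ b ℤ.* (j ℤ.* (j ℤ.- 1ℤ)) ≡ (a ℤ.+ b) ℤ.* (j ℤ.* j) ℤ.+ (a ℤ.- b) ℤ.* j
    lemma = solve-∀

n≤tri : ∀ n → n ≤ tri n
n≤tri zero    = z≤n
n≤tri (suc n) = ℕ.m≤m+n (suc n) (tri n)

-- Ensures that the indices from -N to N account for all exponents up to N.
∣j∣≤θ : ∀ a b .{{_ : ℕ.NonZero a}} .{{_ : ℕ.NonZero b}} j → ∣ j ∣ ≤ θ a b j
∣j∣≤θ a b (+ n)    = ℕ.≤-trans (n≤tri n) (ℕ.≤-trans (ℕ.m≤n*m (tri n) a) (ℕ.m≤m+n _ _))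
∣j∣≤θ a b -[1+ n ] = ℕ.≤-trans (n≤tri (suc n)) (ℕ.≤-trans (ℕ.m≤n*m (tri (suc n)) b) (ℕ.m≤n+m _ _))

-- This is ε^j only for ε = ±1.
pow : ℤ → ℤ → ℤ
pow ε j = ε ℤ.^ ∣ j ∣

module _ (ε : ℤ) (ε²≡1 : ε ℤ.* ε ≡ 1ℤ) where

  pow-suc : ∀ j → pow ε (ℤ.suc j) ≡ ε ℤ.* pow ε j
  pow-suc (+ n)          = refl
  pow-suc -[1+ zero ]    = sym (trans (cong (ε ℤ.*_) (ℤ.*-identityʳ ε)) ε²≡1)
  pow-suc -[1+ suc n ]   = begin
    ε ℤ.* ε ℤ.^ n                     ≡⟨ ℤ.*-identityˡ _ ⟨
    1ℤ ℤ.* (ε ℤ.* ε ℤ.^ n)            ≡⟨ cong (ℤ._* (ε ℤ.* ε ℤ.^ n)) ε²≡1 ⟨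
    ε ℤ.* ε ℤ.* (ε ℤ.* ε ℤ.^ n)       ≡⟨ ℤ.*-assoc ε ε _ ⟩
    ε ℤ.* (ε ℤ.* (ε ℤ.* ε ℤ.^ n))     ∎
    where open ≡-Reasoning

  pow-pred : ∀ j → pow ε (ℤ.pred j) ≡ ε ℤ.* pow ε j
  pow-pred j = begin
    pow ε (ℤ.pred j)                     ≡⟨ ℤ.*-identityˡ _ ⟨
    1ℤ ℤ.* pow ε (ℤ.pred j)              ≡⟨ cong (ℤ._* pow ε (ℤ.pred j)) ε²≡1 ⟨
    ε ℤ.* ε ℤ.* pow ε (ℤ.pred j)         ≡⟨ ℤ.*-assoc ε ε _ ⟩
    ε ℤ.* (ε ℤ.* pow ε (ℤ.pred j))       ≡⟨ cong (ε ℤ.*_) (pow-suc (ℤ.pred j)) ⟨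
    ε ℤ.* pow ε (ℤ.suc (ℤ.pred j))       ≡⟨ cong (λ k → ε ℤ.* pow ε k) (ℤ.suc-pred j) ⟩
    ε ℤ.* pow ε j                        ∎
    where open ≡-Reasoning

  pow-+ : ∀ i j → pow ε (i ℤ.+ j) ≡ pow ε i ℤ.* pow ε j
  pow-+ (+ zero)       j = trans (cong (pow ε) (ℤ.+-identityˡ j)) (sym (ℤ.*-identityˡ _))
  pow-+ (+ suc n)      j = begin
    pow ε (+ suc n ℤ.+ j)                ≡⟨ cong (pow ε) (ℤ.+-assoc 1ℤ (+ n) j) ⟩
    pow ε (ℤ.suc (+ n ℤ.+ j))            ≡⟨ pow-suc (+ n ℤ.+ j) ⟩
    ε ℤ.* pow ε (+ n ℤ.+ j)              ≡⟨ cong (ε ℤ.*_) (pow-+ (+ n) j) ⟩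
    ε ℤ.* (pow ε (+ n) ℤ.* pow ε j)      ≡⟨ ℤ.*-assoc ε _ _ ⟨
    ε ℤ.* pow ε (+ n) ℤ.* pow ε j        ∎
    where open ≡-Reasoning
  pow-+ -[1+ zero ]    j = trans (pow-pred j) (cong (ℤ._* pow ε j) (sym (ℤ.*-identityʳ ε)))
  pow-+ -[1+ suc n ]   j = begin
    pow ε (-[1+ suc n ] ℤ.+ j)           ≡⟨ cong (pow ε) (ℤ.+-assoc -1ℤ -[1+ n ] j) ⟩
    pow ε (ℤ.pred (-[1+ n ] ℤ.+ j))      ≡⟨ pow-pred (-[1+ n ] ℤ.+ j) ⟩
    ε ℤ.* pow ε (-[1+ n ] ℤ.+ j)         ≡⟨ cong (ε ℤ.*_) (pow-+ -[1+ n ] j) ⟩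
    ε ℤ.* (pow ε -[1+ n ] ℤ.* pow ε j)   ≡⟨ ℤ.*-assoc ε _ _ ⟨
    ε ℤ.* pow ε -[1+ n ] ℤ.* pow ε j     ∎
    where open ≡-Reasoning

module _ (ε : ℤ) (ε²≡1 : ε ℤ.* ε ≡ 1ℤ) (a b : ℕ) where

  private
    c = a ℕ.+ b

  open Gaussian c

  term : ℤ → PS
  term j = mono (pow ε j) (θ a b j)

  private
    -- θ(j+1) - θ(j) = a + c j. At j = r - n, adding c p leaves a + c (p + r - n) = a + c m.
    shift-a : ∀ m n p r → p ℕ.+ r ≡ m ℕ.+ n → Q^ p ⊗ term (suc r ⊖ n) ≈ term (r ⊖ n) ⊗ mono ε (a ℕ.+ c ℕ.* m)
    shift-a m n p r p+r≡m+n = ≈-trans (mono-⊗-mono 1ℤ _ _ _)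
      (≈-trans (mono-cong sgn (2*-injective expo)) (≈-sym (mono-⊗-mono _ ε _ _)))
      where
      open ≡-Reasoning
      next : suc r ⊖ n ≡ ℤ.suc (r ⊖ n)
      next = sym (ℤ.distribʳ-⊖-+-pos 1 r n)
      sgn : 1ℤ ℤ.* pow ε (suc r ⊖ n) ≡ pow ε (r ⊖ n) ℤ.* ε
      sgn = begin
        1ℤ ℤ.* pow ε (suc r ⊖ n)    ≡⟨ ℤ.*-identityˡ _ ⟩
        pow ε (suc r ⊖ n)           ≡⟨ cong (pow ε) next ⟩
        pow ε (ℤ.suc (r ⊖ n))       ≡⟨ pow-suc ε ε²≡1 (r ⊖ n) ⟩
        ε ℤ.* pow ε (r ⊖ n)         ≡⟨ ℤ.*-comm ε _ ⟩
        pow ε (r ⊖ n) ℤ.* ε         ∎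
      lemma : ∀ a b p r n m → p ≡ (m ℤ.+ n) ℤ.- r →
        + 2 ℤ.* ((a ℤ.+ b) ℤ.* p) ℤ.+ ((a ℤ.+ b) ℤ.* ((1ℤ ℤ.+ (r ℤ.- n)) ℤ.* (1ℤ ℤ.+ (r ℤ.- n))) ℤ.+ (a ℤ.- b) ℤ.* (1ℤ ℤ.+ (r ℤ.- n)))
        ≡ ((a ℤ.+ b) ℤ.* ((r ℤ.- n) ℤ.* (r ℤ.- n)) ℤ.+ (a ℤ.- b) ℤ.* (r ℤ.- n)) ℤ.+ + 2 ℤ.* (a ℤ.+ (a ℤ.+ b) ℤ.* m)
      lemma a b p r n m refl = poly a b r n m where
        poly : ∀ a b r n m →
          + 2 ℤ.* ((a ℤ.+ b) ℤ.* ((m ℤ.+ n) ℤ.- r)) ℤ.+ ((a ℤ.+ b) ℤ.* ((1ℤ ℤ.+ (r ℤ.- n)) ℤ.* (1ℤ ℤ.+ (r ℤ.- n))) ℤ.+ (a ℤ.- b) ℤ.* (1ℤ ℤ.+ (r ℤ.- n)))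
          ≡ ((a ℤ.+ b) ℤ.* ((r ℤ.- n) ℤ.* (r ℤ.- n)) ℤ.+ (a ℤ.- b) ℤ.* (r ℤ.- n)) ℤ.+ + 2 ℤ.* (a ℤ.+ (a ℤ.+ b) ℤ.* m)
        poly = solve-∀
      p≡ : + p ≡ (+ m ℤ.+ + n) ℤ.- + r
      p≡ = begin
        + p                        ≡⟨ cancel (+ p) (+ r) ⟩
        (+ p ℤ.+ + r) ℤ.- + r      ≡⟨ cong (λ k → + k ℤ.- + r) p+r≡m+n ⟩
        (+ m ℤ.+ + n) ℤ.- + r      ∎
        where
        cancel : ∀ x y → x ≡ (x ℤ.+ y) ℤ.- y
        cancel = solve-∀
      expo : + 2 ℤ.* + (c ℕ.* p ℕ.+ θ a b (suc r ⊖ n)) ≡ + 2 ℤ.* + (θ a b (r ⊖ n) ℕ.+ (a ℕ.+ c ℕ.* m))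
      expo = begin
        + 2 ℤ.* (+ (c ℕ.* p) ℤ.+ + θ a b (suc r ⊖ n))
          ≡⟨ ℤ.*-distribˡ-+ (+ 2) (+ (c ℕ.* p)) _ ⟩
        + 2 ℤ.* + (c ℕ.* p) ℤ.+ + 2 ℤ.* + θ a b (suc r ⊖ n)
          ≡⟨ cong₂ ℤ._+_ (cong (+ 2 ℤ.*_) (ℤ.pos-* c p)) (trans (cong (λ j → + 2 ℤ.* + θ a b j) (trans next (cong ℤ.suc (sym (ℤ.m-n≡m⊖n r n))))) (θ-spec a b _)) ⟩
        _ ≡⟨ lemma (+ a) (+ b) (+ p) (+ r) (+ n) (+ m) p≡ ⟩
        _ ≡⟨ cong₂ ℤ._+_ (trans (cong (λ j → + 2 ℤ.* + θ a b j) (sym (ℤ.m-n≡m⊖n r n))) (θ-spec a b _)) (cong (λ k → + 2 ℤ.* (+ a ℤ.+ k)) (ℤ.pos-* c m)) ⟨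
        + 2 ℤ.* + θ a b (r ⊖ n) ℤ.+ + 2 ℤ.* (+ a ℤ.+ + (c ℕ.* m))
          ≡⟨ ℤ.*-distribˡ-+ (+ 2) (+ θ a b (r ⊖ n)) _ ⟨
        + 2 ℤ.* (+ θ a b (r ⊖ n) ℤ.+ (+ a ℤ.+ + (c ℕ.* m))) ∎

    -- θ(j-1) - θ(j) = b - c j. At j = r - n, adding c r leaves b + c n, whatever p is.
    shift-b : ∀ n r → Q^ r ⊗ term (r ⊖ suc n) ≈ term (r ⊖ n) ⊗ mono ε (b ℕ.+ c ℕ.* n)
    shift-b n r = ≈-trans (mono-⊗-mono 1ℤ _ _ _)
      (≈-trans (mono-cong sgn (2*-injective expo)) (≈-sym (mono-⊗-mono _ ε _ _)))
      where
      open ≡-Reasoning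
      prev : r ⊖ suc n ≡ ℤ.pred (r ⊖ n)
      prev = begin
        r ⊖ suc n              ≡⟨ ℤ.m-n≡m⊖n r (suc n) ⟨
        + r ℤ.- + suc n        ≡⟨ lem (+ r) (+ n) ⟩
        ℤ.pred (+ r ℤ.- + n)   ≡⟨ cong ℤ.pred (ℤ.m-n≡m⊖n r n) ⟩
        ℤ.pred (r ⊖ n)         ∎
        where
        lem : ∀ r n → r ℤ.- (1ℤ ℤ.+ n) ≡ -1ℤ ℤ.+ (r ℤ.- n)
        lem = solve-∀
      sgn : 1ℤ ℤ.* pow ε (r ⊖ suc n) ≡ pow ε (r ⊖ n) ℤ.* ε
      sgn = begin
        1ℤ ℤ.* pow ε (r ⊖ suc n)    ≡⟨ ℤ.*-identityˡ _ ⟩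
        pow ε (r ⊖ suc n)           ≡⟨ cong (pow ε) prev ⟩
        pow ε (ℤ.pred (r ⊖ n))      ≡⟨ pow-pred ε ε²≡1 (r ⊖ n) ⟩
        ε ℤ.* pow ε (r ⊖ n)         ≡⟨ ℤ.*-comm ε _ ⟩
        pow ε (r ⊖ n) ℤ.* ε         ∎
      poly : ∀ a b r n →
        + 2 ℤ.* ((a ℤ.+ b) ℤ.* r) ℤ.+ ((a ℤ.+ b) ℤ.* ((-1ℤ ℤ.+ (r ℤ.- n)) ℤ.* (-1ℤ ℤ.+ (r ℤ.- n))) ℤ.+ (a ℤ.- b) ℤ.* (-1ℤ ℤ.+ (r ℤ.- n)))
        ≡ ((a ℤ.+ b) ℤ.* ((r ℤ.- n) ℤ.* (r ℤ.- n)) ℤ.+ (a ℤ.- b) ℤ.* (r ℤ.- n)) ℤ.+ + 2 ℤ.* (b ℤ.+ (a ℤ.+ b) ℤ.* n)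
      poly = solve-∀
      expo : + 2 ℤ.* + (c ℕ.* r ℕ.+ θ a b (r ⊖ suc n)) ≡ + 2 ℤ.* + (θ a b (r ⊖ n) ℕ.+ (b ℕ.+ c ℕ.* n))
      expo = begin
        + 2 ℤ.* (+ (c ℕ.* r) ℤ.+ + θ a b (r ⊖ suc n))
          ≡⟨ ℤ.*-distribˡ-+ (+ 2) (+ (c ℕ.* r)) _ ⟩
        + 2 ℤ.* + (c ℕ.* r) ℤ.+ + 2 ℤ.* + θ a b (r ⊖ suc n)
          ≡⟨ cong₂ ℤ._+_ (cong (+ 2 ℤ.*_) (ℤ.pos-* c r)) (trans (cong (λ j → + 2 ℤ.* + θ a b j) (trans prev (cong ℤ.pred (sym (ℤ.m-n≡m⊖n r n))))) (θ-spec a b _)) ⟩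
        _ ≡⟨ poly (+ a) (+ b) (+ r) (+ n) ⟩
        _ ≡⟨ cong₂ ℤ._+_ (trans (cong (λ j → + 2 ℤ.* + θ a b j) (sym (ℤ.m-n≡m⊖n r n))) (θ-spec a b _)) (cong (λ k → + 2 ℤ.* (+ b ℤ.+ k)) (ℤ.pos-* c n)) ⟨
        + 2 ℤ.* + θ a b (r ⊖ n) ℤ.+ + 2 ℤ.* (+ b ℤ.+ + (c ℕ.* n))
          ≡⟨ ℤ.*-distribˡ-+ (+ 2) (+ θ a b (r ⊖ n)) _ ⟨
        + 2 ℤ.* (+ θ a b (r ⊖ n) ℤ.+ (+ b ℤ.+ + (c ℕ.* n))) ∎

  private
    Y : ℕ → ℕ → ℕ → PS
    Y n p r = gauss p r ⊗ term (r ⊖ n)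

    factor : ∀ f k → f ⊗ mono ε k ⊕ f ≈ f ⊗ 1+q ε k
    factor f k = begin
      f ⊗ mono ε k ⊕ f          ≈⟨ ⊕-comm _ f ⟩
      f ⊕ f ⊗ mono ε k          ≈⟨ ⊕-cong (PSR.*-identityʳ f) ≈-refl ⟨
      f ⊗ 𝟙 ⊕ f ⊗ mono ε k      ≈⟨ PSR.distribˡ f 𝟙 (mono ε k) ⟨
      f ⊗ 1+q ε k               ∎
      where open ≈-Reasoning

    -- The centre of the row moves from n to n + 1. In the second Pascal rule the unweighted part
    -- keeps its index r - n, while the part weighted by Q^r has its index lowered by one, which by
    -- `shift-b` produces the monomial of the new factor.
    step-b : ∀ n → antidiagonal (suc n) (Y (suc n)) ≈ antidiagonal n (Y n) ⊗ 1+q ε (b ℕ.+ c ℕ.* n)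
    step-b n = begin
      antidiagonal (suc n) (Y (suc n))
        ≈⟨ antidiagonal-split n (Y (suc n)) A B hA hB hAB ⟩
      antidiagonal n A ⊕ antidiagonal n B
        ≈⟨ ⊕-cong (antidiagonal-cong n λ p r _ → A≈ p r) (antidiagonal-cong n λ p r _ → B≈ p r) ⟩
      antidiagonal n (λ p r → Y n p r ⊗ u) ⊕ antidiagonal n (Y n)
        ≈⟨ ⊕-cong (antidiagonal-⊗ n u (Y n)) ≈-refl ⟩
      antidiagonal n (Y n) ⊗ u ⊕ antidiagonal n (Y n)
        ≈⟨ factor (antidiagonal n (Y n)) _ ⟩
      antidiagonal n (Y n) ⊗ 1+q ε (b ℕ.+ c ℕ.* n) ∎
      where
      open ≈-Reasoning
      u = mono ε (b ℕ.+ c ℕ.* n)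
      A B : ℕ → ℕ → PS
      A p r = Q^ r ⊗ gauss p r ⊗ term (r ⊖ suc n)
      B p r = gauss p r ⊗ term (suc r ⊖ suc n)
      hA : ∀ p → Y (suc n) (suc p) 0 ≈ A p 0
      hA p = ⊗-cong (≈-sym (≈-trans (⊗-cong (≈-trans (mono-cong refl (ℕ.*-zeroʳ c)) (≈-sym 𝟙≈mono)) (gauss-zeroʳ p)) (⊗-identityˡ 𝟙))) ≈-refl
      hB : ∀ r → Y (suc n) 0 (suc r) ≈ B 0 r
      hB r = ≈-refl
      hAB : ∀ p r → Y (suc n) (suc p) (suc r) ≈ A p (suc r) ⊕ B (suc p) r
      hAB p r = ≈-trans (⊗-cong (gauss-pascal′ p r) ≈-refl) (⊗-distribʳ-⊕ _ _ _)
      A≈ : ∀ p r → A p r ≈ Y n p r ⊗ u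
      A≈ p r = begin
        Q^ r ⊗ gauss p r ⊗ term (r ⊖ suc n)     ≈⟨ solve 3 (λ x y z → (x :* y) :* z ⊜ y :* (x :* z)) ≈-refl (Q^ r) (gauss p r) (term (r ⊖ suc n)) ⟩
        gauss p r ⊗ (Q^ r ⊗ term (r ⊖ suc n))   ≈⟨ ⊗-cong ≈-refl (shift-b n r) ⟩
        gauss p r ⊗ (term (r ⊖ n) ⊗ u)          ≈⟨ ⊗-assoc _ _ _ ⟨
        gauss p r ⊗ term (r ⊖ n) ⊗ u            ∎
      B≈ : ∀ p r → B p r ≈ Y n p r
      B≈ p r = ⊗-cong ≈-refl (PSR.reflexive (cong term (ℤ.[1+m]⊖[1+n]≡m⊖n r n)))

    -- Here the centre stays, and the first Pascal rule applies: its part weighted by Q^p has its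
    -- index raised by one, which `shift-a` turns into the monomial of the new factor.
    step-a : ∀ m n → antidiagonal (suc (m ℕ.+ n)) (Y n) ≈ antidiagonal (m ℕ.+ n) (Y n) ⊗ 1+q ε (a ℕ.+ c ℕ.* m)
    step-a m n = begin
      antidiagonal (suc (m ℕ.+ n)) (Y n)
        ≈⟨ antidiagonal-split (m ℕ.+ n) (Y n) (Y n) B hA hB hAB ⟩
      antidiagonal (m ℕ.+ n) (Y n) ⊕ antidiagonal (m ℕ.+ n) B
        ≈⟨ ⊕-cong ≈-refl (≈-trans (antidiagonal-cong (m ℕ.+ n) B≈) (antidiagonal-⊗ (m ℕ.+ n) u (Y n))) ⟩
      antidiagonal (m ℕ.+ n) (Y n) ⊕ antidiagonal (m ℕ.+ n) (Y n) ⊗ u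
        ≈⟨ ≈-trans (⊕-comm _ _) (factor _ _) ⟩
      antidiagonal (m ℕ.+ n) (Y n) ⊗ 1+q ε (a ℕ.+ c ℕ.* m) ∎
      where
      open ≈-Reasoning
      u = mono ε (a ℕ.+ c ℕ.* m)
      B : ℕ → ℕ → PS
      B p r = Q^ p ⊗ gauss p r ⊗ term (suc r ⊖ n)
      hA : ∀ p → Y n (suc p) 0 ≈ Y n p 0
      hA p = ⊗-cong (≈-sym (gauss-zeroʳ p)) ≈-refl
      hB : ∀ r → Y n 0 (suc r) ≈ B 0 r
      hB r = ⊗-cong (≈-sym (≈-trans (⊗-cong (≈-trans (mono-cong refl (ℕ.*-zeroʳ c)) (≈-sym 𝟙≈mono)) ≈-refl) (⊗-identityˡ 𝟙))) ≈-refl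
      hAB : ∀ p r → Y n (suc p) (suc r) ≈ Y n p (suc r) ⊕ B (suc p) r
      hAB p r = ⊗-distribʳ-⊕ _ _ _
      B≈ : ∀ p r → p ℕ.+ r ≡ m ℕ.+ n → B p r ≈ Y n p r ⊗ u
      B≈ p r eq = begin
        Q^ p ⊗ gauss p r ⊗ term (suc r ⊖ n)     ≈⟨ solve 3 (λ x y z → (x :* y) :* z ⊜ y :* (x :* z)) ≈-refl (Q^ p) (gauss p r) (term (suc r ⊖ n)) ⟩
        gauss p r ⊗ (Q^ p ⊗ term (suc r ⊖ n))   ≈⟨ ⊗-cong ≈-refl (shift-a m n p r eq) ⟩
        gauss p r ⊗ (term (r ⊖ n) ⊗ u)          ≈⟨ ⊗-assoc _ _ _ ⟨
        gauss p r ⊗ term (r ⊖ n) ⊗ u            ∎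

  -- The q-binomial theorem in the symmetric form that precedes Jacobi's limit. The b-factors are
  -- adjoined first, with m = 0, and then the a-factors.
  finite-triple : ∀ m n →
    prod (λ i → 1+q ε (a ℕ.+ c ℕ.* i)) m ⊗ prod (λ i → 1+q ε (b ℕ.+ c ℕ.* i)) n
      ≈ antidiagonal (m ℕ.+ n) (λ p r → gauss p r ⊗ term (r ⊖ n))
  finite-triple zero    zero    = ⊗-cong ≈-refl (≈-trans 𝟙≈mono (mono-cong refl (sym (cong₂ ℕ._+_ (ℕ.*-zeroʳ a) (ℕ.*-zeroʳ b)))))
  finite-triple zero    (suc n) = begin
    𝟙 ⊗ (prod _ n ⊗ 1+q ε (b ℕ.+ c ℕ.* n))   ≈⟨ ⊗-assoc _ _ _ ⟨
    𝟙 ⊗ prod _ n ⊗ 1+q ε (b ℕ.+ c ℕ.* n)     ≈⟨ ⊗-cong (finite-triple zero n) ≈-refl ⟩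
    antidiagonal n (Y n) ⊗ 1+q ε (b ℕ.+ c ℕ.* n) ≈⟨ step-b n ⟨
    antidiagonal (suc n) (Y (suc n))         ∎
    where open ≈-Reasoning
  finite-triple (suc m) n       = begin
    (PA m ⊗ 1+q ε (a ℕ.+ c ℕ.* m)) ⊗ PB n    ≈⟨ solve 3 (λ x y z → (x :* y) :* z ⊜ (x :* z) :* y) ≈-refl (PA m) (1+q ε (a ℕ.+ c ℕ.* m)) (PB n) ⟩
    (PA m ⊗ PB n) ⊗ 1+q ε (a ℕ.+ c ℕ.* m)    ≈⟨ ⊗-cong (finite-triple m n) ≈-refl ⟩
    antidiagonal (m ℕ.+ n) (Y n) ⊗ 1+q ε (a ℕ.+ c ℕ.* m) ≈⟨ step-a m n ⟨
    antidiagonal (suc (m ℕ.+ n)) (Y n)       ∎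
    where
    open ≈-Reasoning
    PA = prod (λ i → 1+q ε (a ℕ.+ c ℕ.* i))
    PB = prod (λ i → 1+q ε (b ℕ.+ c ℕ.* i))

-- Series as weighted sums of monomials

sumL : {I : Set} → (I → PS) → List I → PS
sumL F []       = 𝟘
sumL F (i ∷ is) = F i ⊕ sumL F is

sumL-map : {I J : Set} (F : J → PS) (G : I → PS) (f : I → J) → (∀ i → F (f i) ≈ G i) → ∀ is → sumL F (map f is) ≈ sumL G is
sumL-map F G f h []       = ≈-refl
sumL-map F G f h (i ∷ is) = ⊕-cong (h i) (sumL-map F G f h is)

sumL-++ : {I : Set} (F : I → PS) → ∀ is js → sumL F (is ++ js) ≈ sumL F is ⊕ sumL F js
sumL-++ F []       js = ≈-sym (⊕-identityˡ _)
sumL-++ F (i ∷ is) js = ≈-trans (⊕-cong ≈-refl (sumL-++ F is js)) (≈-sym (⊕-assoc _ _ _))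

sumL-⊗ˡ : {I : Set} (f : PS) (F : I → PS) → ∀ is → f ⊗ sumL F is ≈ sumL (λ i → f ⊗ F i) is
sumL-⊗ˡ f F []       = PSR.zeroʳ f
sumL-⊗ˡ f F (i ∷ is) = ≈-trans (PSR.distribˡ f _ _) (⊕-cong ≈-refl (sumL-⊗ˡ f F is))

sumL-cartesianProduct : {I J : Set} (F : I → PS) (G : J → PS) (H : I × J → PS) → (∀ i j → F i ⊗ G j ≈ H (i , j)) →
  ∀ is js → sumL F is ⊗ sumL G js ≈ sumL H (cartesianProduct is js)
sumL-cartesianProduct F G H h []       js = PSR.zeroˡ _
sumL-cartesianProduct F G H h (i ∷ is) js = begin
  (F i ⊕ sumL F is) ⊗ sumL G js                             ≈⟨ ⊗-distribʳ-⊕ _ _ _ ⟩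
  F i ⊗ sumL G js ⊕ sumL F is ⊗ sumL G js                   ≈⟨ ⊕-cong (row js) (sumL-cartesianProduct F G H h is js) ⟩
  sumL H (map (i ,_) js) ⊕ sumL H (cartesianProduct is js)  ≈⟨ sumL-++ H (map (i ,_) js) _ ⟨
  sumL H (map (i ,_) js ++ cartesianProduct is js)          ∎
  where
  open ≈-Reasoning
  row : ∀ js → F i ⊗ sumL G js ≈ sumL H (map (i ,_) js)
  row js = ≈-trans (sumL-⊗ˡ (F i) G js) (≈-sym (sumL-map H (λ j → F i ⊗ G j) (i ,_) (λ j → ≈-sym (h i j)) js))

-- GF e σ S says S = Σᵢ σᵢ q^(eᵢ): for each N, finitely many i account for all exponents up to N.
record GF {I : Set} (e : I → ℕ) (σ : I → ℤ) (S : PS) : Set where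
  field
    cover  : ℕ → List I
    unique : ∀ N → Unique (cover N)
    covers : ∀ N i → e i ≤ N → i ∈ cover N
    value  : ∀ N → S N ≡ sumL (λ i → mono (σ i) (e i)) (cover N) N

module _ {I : Set} (e : I → ℕ) (σ : I → ℤ) where

  private
    F : I → PS
    F i = mono (σ i) (e i)

    weight : List I → ℤ
    weight []       = 0ℤ
    weight (i ∷ is) = σ i ℤ.+ weight is

    weight-↭ : ∀ {is js} → is ↭ js → weight is ≡ weight js
    weight-↭ ↭.refl         = refl
    weight-↭ (↭.prep i p)   = cong (ℤ._+_ (σ i)) (weight-↭ p)
    weight-↭ (↭.swap i j p) = trans (lemma (σ i) (σ j) _) (cong (λ w → σ j ℤ.+ (σ i ℤ.+ w)) (weight-↭ p)) where
      lemma : ∀ x y z → x ℤ.+ (y ℤ.+ z) ≡ y ℤ.+ (x ℤ.+ z)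
      lemma = solve-∀
    weight-↭ (↭.trans p q)  = trans (weight-↭ p) (weight-↭ q)

    sumL-at : ∀ is n → sumL F is n ≡ weight (filter (λ i → e i ℕ.≟ n) is)
    sumL-at []       n = 𝟘-at n
    sumL-at (i ∷ is) n with e i ℕ.≟ n
    ... | yes p = trans (⊕-at (F i) (sumL F is) n) (trans
      (cong₂ ℤ._+_ (trans (cong (F i) (sym p)) (mono-same (σ i) (e i))) (sumL-at is n))
      (cong weight (sym (filter-accept (λ i → e i ℕ.≟ n) p))))
    ... | no ¬p = trans (⊕-at (F i) (sumL F is) n) (trans
      (trans (cong₂ ℤ._+_ (mono-diff (σ i) (e i) n ¬p) (sumL-at is n)) (ℤ.+-identityˡ _))
      (cong weight (sym (filter-reject (λ i → e i ℕ.≟ n) ¬p))))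

  -- Only the indices of exponent n contribute. Filtered to these, both lists are free of
  -- repetitions and have the same members, hence are permutations of each other.
  sumL-cover : ∀ {is js} → Unique is → Unique js → ∀ n →
    (∀ i → e i ≡ n → i ∈ is) → (∀ i → e i ≡ n → i ∈ js) → sumL F is n ≡ sumL F js n
  sumL-cover {is} {js} uis ujs n his hjs = begin
    sumL F is n               ≡⟨ sumL-at is n ⟩
    weight (filter P? is)     ≡⟨ weight-↭ (∼bag⇒↭ (unique∧set⇒bag (Unique.filter⁺ P? uis) (Unique.filter⁺ P? ujs)
                                   (mk⇔ (λ x∈ → let q = proj₂ (∈-filter⁻ P? {xs = is} x∈) in ∈-filter⁺ P? (hjs _ q) q)
                                        (λ x∈ → let q = proj₂ (∈-filter⁻ P? {xs = js} x∈) in ∈-filter⁺ P? (his _ q) q)))) ⟩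
    weight (filter P? js)     ≡⟨ sumL-at js n ⟨
    sumL F js n               ∎
    where
    open ≡-Reasoning
    P? = λ i → e i ℕ.≟ n

  GF-value[] : ∀ {S} (gf : GF e σ S) N → S ≈[ N ] sumL F (GF.cover gf N)
  GF-value[] gf N = mk≈[] λ k k≤N → trans (GF.value gf k)
    (sumL-cover (GF.unique gf k) (GF.unique gf N) k
      (λ i p → GF.covers gf k i (ℕ.≤-reflexive p))
      (λ i p → GF.covers gf N i (ℕ.≤-trans (ℕ.≤-reflexive p) k≤N)))

  -- The principle behind all equalities of theta series here: the coefficients do not depend on the
  -- chosen covers, so it suffices to present both series over one weighted index set.
  GF-unique : ∀ {S S′} → GF e σ S → GF e σ S′ → S ≈ S′
  GF-unique gf gf′ = mk≈ λ n → trans (GF.value gf n) (trans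
    (sumL-cover (GF.unique gf n) (GF.unique gf′ n) n
      (λ i p → GF.covers gf n i (ℕ.≤-reflexive p)) (λ i p → GF.covers gf′ n i (ℕ.≤-reflexive p)))
    (sym (GF.value gf′ n)))

GF-reindex : {I J : Set} {e : I → ℕ} {σ : I → ℤ} {e′ : J → ℕ} {σ′ : J → ℤ} {S : PS}
  (φ : J → I) (ψ : I → J) → (∀ i → φ (ψ i) ≡ i) → (∀ j → ψ (φ j) ≡ j) →
  (∀ j → e (φ j) ≡ e′ j) → (∀ j → σ (φ j) ≡ σ′ j) → GF e σ S → GF e′ σ′ S
GF-reindex {I} {J} {e} {σ} {e′} {σ′} φ ψ φψ ψφ he hσ gf = record
  { cover  = λ N → map ψ (cover N)
  ; unique = λ N → Unique.map⁺ (λ {x} {y} p → trans (sym (φψ x)) (trans (cong φ p) (φψ y))) (unique N)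
  ; covers = λ N j h → subst (_∈ map ψ (cover N)) (ψφ j)
      (∈-map⁺ ψ (covers N (φ j) (ℕ.≤-trans (ℕ.≤-reflexive (he j)) h)))
  ; value  = λ N → trans (value N) (sym (at (sumL-map (λ j → mono (σ′ j) (e′ j)) _ ψ
      (λ i → mono-cong (trans (sym (hσ (ψ i))) (cong σ (φψ i))) (trans (sym (he (ψ i))) (cong e (φψ i)))) (cover N)) N))
  }
  where open GF gf

GF-⊎ : {I J : Set} {e : I → ℕ} {σ : I → ℤ} {e′ : J → ℕ} {σ′ : J → ℤ} {S S′ : PS} →
  GF e σ S → GF e′ σ′ S′ → GF [ e , e′ ] [ σ , σ′ ] (S ⊕ S′)
GF-⊎ {I} {J} {e} {σ} {e′} {σ′} {S} {S′} gf gf′ = record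
  { cover  = λ N → map inj₁ (L.cover N) ++ map inj₂ (R.cover N)
  ; unique = λ N → Unique.++⁺ (Unique.map⁺ inj₁-injective (L.unique N)) (Unique.map⁺ inj₂-injective (R.unique N)) (disjoint N)
  ; covers = λ where
      N (inj₁ i) h → ∈-++⁺ˡ (∈-map⁺ inj₁ (L.covers N i h))
      N (inj₂ j) h → ∈-++⁺ʳ (map inj₁ (L.cover N)) (∈-map⁺ inj₂ (R.covers N j h))
  ; value  = λ N → trans (⊕-at S S′ N) (trans (cong₂ ℤ._+_ (L.value N) (R.value N)) (trans (sym (⊕-at _ _ N)) (sym (at (total N) N))))
  }
  where
  module L = GF gf
  module R = GF gf′
  F : I ⊎ J → PS
  F k = mono ([ σ , σ′ ] k) ([ e , e′ ] k)
  disjoint : ∀ N {v} → ¬ (v ∈ map inj₁ (L.cover N) × v ∈ map inj₂ (R.cover N))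
  disjoint N (p , q) with ∈-map⁻ inj₁ p | ∈-map⁻ inj₂ q
  ... | _ , _ , refl | _ , _ , ()
  total : ∀ N → sumL F (map inj₁ (L.cover N) ++ map inj₂ (R.cover N))
              ≈ sumL (λ i → mono (σ i) (e i)) (L.cover N) ⊕ sumL (λ j → mono (σ′ j) (e′ j)) (R.cover N)
  total N = ≈-trans (sumL-++ F (map inj₁ (L.cover N)) _)
    (⊕-cong (sumL-map F _ inj₁ (λ _ → ≈-refl) (L.cover N)) (sumL-map F _ inj₂ (λ _ → ≈-refl) (R.cover N)))

GF-⊗ : {I J : Set} {e : I → ℕ} {σ : I → ℤ} {e′ : J → ℕ} {σ′ : J → ℤ} {S S′ : PS} →
  GF e σ S → GF e′ σ′ S′ → GF {I × J} (λ (i , j) → e i ℕ.+ e′ j) (λ (i , j) → σ i ℤ.* σ′ j) (S ⊗ S′)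
GF-⊗ {I} {J} {e} {σ} {e′} {σ′} {S} {S′} gf gf′ = record
  { cover  = λ N → cartesianProduct (L.cover N) (R.cover N)
  ; unique = λ N → Unique.cartesianProduct⁺ (L.unique N) (R.unique N)
  ; covers = λ N (i , j) h → ∈-cartesianProduct⁺
      (L.covers N i (ℕ.≤-trans (ℕ.m≤m+n (e i) (e′ j)) h)) (R.covers N j (ℕ.≤-trans (ℕ.m≤n+m (e′ j) (e i)) h))
  ; value  = λ N → trans
      (upto (⊗-cong[] (GF-value[] e σ gf N) (GF-value[] e′ σ′ gf′ N)) N ℕ.≤-refl)
      (at (sumL-cartesianProduct _ _ _ (λ i j → mono-⊗-mono (σ i) (σ′ j) (e i) (e′ j)) (L.cover N) (R.cover N)) N)
  }
  where
  module L = GF gf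
  module R = GF gf′

GF-⊖ : {I : Set} {e : I → ℕ} {σ : I → ℤ} {S : PS} → GF e σ S → GF e (λ i → ℤ.- σ i) (⊖ S)
GF-⊖ {I} {e} {σ} {S} gf = record
  { cover = cover ; unique = unique ; covers = covers
  ; value = λ N → trans (⊖-at S N) (trans (cong ℤ.-_ (value N)) (trans (sym (⊖-at _ N)) (at (neg (cover N)) N))) }
  where
  open GF gf
  neg : ∀ is → ⊖ sumL (λ i → mono (σ i) (e i)) is ≈ sumL (λ i → mono (ℤ.- σ i) (e i)) is
  neg []       = ≈-trans (≈-sym (⊕-identityʳ _)) (⊕-inverseˡ 𝟘)
  neg (i ∷ is) = ≈-trans (PS-Solver.solve 2 (λ x y → :- (x :+ y) := (:- x) :+ (:- y)) ≈-refl _ _)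
    (⊕-cong (⊖-mono (σ i) (e i)) (neg is))
    where open PS-Solver using (_:=_; :-_; _:+_)

x≡-x⇒x≡0 : ∀ x → x ≡ ℤ.- x → x ≡ 0ℤ
x≡-x⇒x≡0 (+ zero)  _  = refl
x≡-x⇒x≡0 (+ suc n) ()
x≡-x⇒x≡0 -[1+ n ]  ()

-- Reindexing along the involution φ turns the series into its own negative, and ℤ has no 2-torsion.
GF-antisymmetric : {I : Set} {e : I → ℕ} {σ : I → ℤ} {S : PS} (φ : I → I) → (∀ i → φ (φ i) ≡ i) →
  (∀ i → e (φ i) ≡ e i) → (∀ i → σ (φ i) ≡ ℤ.- σ i) → GF e σ S → S ≈ 𝟘
GF-antisymmetric {e = e} {σ} {S} φ φφ he hσ gf = mk≈ λ n → trans (x≡-x⇒x≡0 (S n)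
  (trans (at (GF-unique e (λ i → ℤ.- σ i) (GF-reindex φ φ φφ φφ he hσ gf) (GF-⊖ gf)) n) (⊖-at S n)))
  (sym (𝟘-at n))

-- Series indexed by ℤ and the limit of the finite triple product

-- The integers from -N to N, written as r ⊖ N so as to match the row of `finite-triple` at m = n =
-- N.
interval : ℕ → List ℤ
interval N = applyUpTo (_⊖ N) (suc (N ℕ.+ N))

⊖-injectiveˡ : ∀ N {k l} → k ⊖ N ≡ l ⊖ N → k ≡ l
⊖-injectiveˡ N {k} {l} p = ℤ.+-injective (begin
  + k                        ≡⟨ lemma (+ k) (+ N) ⟩
  (+ k ℤ.- + N) ℤ.+ + N      ≡⟨ cong (ℤ._+ + N) (trans (ℤ.m-n≡m⊖n k N) (trans p (sym (ℤ.m-n≡m⊖n l N)))) ⟩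
  (+ l ℤ.- + N) ℤ.+ + N      ≡⟨ lemma (+ l) (+ N) ⟨
  + l                        ∎)
  where
  open ≡-Reasoning
  lemma : ∀ x y → x ≡ (x ℤ.- y) ℤ.+ y
  lemma = solve-∀

interval-unique : ∀ N → Unique (interval N)
interval-unique N = Unique.applyUpTo⁺₁ (_⊖ N) (suc (N ℕ.+ N)) λ i<j _ p → ℕ.<⇒≢ i<j (⊖-injectiveˡ N p)

∈-interval : ∀ N j → ∣ j ∣ ≤ N → j ∈ interval N
∈-interval N (+ n)    h = subst (_∈ interval N) eq (∈-applyUpTo⁺ (_⊖ N) (s≤s (ℕ.+-monoˡ-≤ N h)))
  where
  eq : (n ℕ.+ N) ⊖ N ≡ + n
  eq = trans (sym (ℤ.distribʳ-⊖-+-pos n N N)) (trans (cong (ℤ._+_ (+ n)) (ℤ.n⊖n≡0 N)) (ℤ.+-identityʳ (+ n)))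
∈-interval N -[1+ n ] h = subst (_∈ interval N) eq (∈-applyUpTo⁺ (_⊖ N) (s≤s (ℕ.≤-trans (ℕ.m∸n≤m N (suc n)) (ℕ.m≤m+n N N))))
  where
  eq : (N ∸ suc n) ⊖ N ≡ -[1+ n ]
  eq = trans (ℤ.⊖-≤ (ℕ.m∸n≤m N (suc n))) (cong (λ k → ℤ.- + k) (ℕ.m∸[m∸n]≡n h))

opaque
  seriesℤ : (ℤ → ℕ) → (ℤ → ℤ) → PS
  seriesℤ e σ N = sumL (λ j → mono (σ j) (e j)) (interval N) N

  GF-ℤ : ∀ {e} {σ} → (∀ j → ∣ j ∣ ≤ e j) → GF e σ (seriesℤ e σ)
  GF-ℤ h = record
    { cover  = interval
    ; unique = interval-unique
    ; covers = λ N j p → ∈-interval N j (ℕ.≤-trans (h j) p)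
    ; value  = λ N → refl
    }

-- T(a,b) for ε = -1. For ε = 1 the first two factors become (-q^a, -q^b; q^(a+b))_∞, while
-- (q^(a+b); q^(a+b))_∞ keeps its sign.
triple : ℤ → ℕ → ℕ → PS
triple ε a b = pochε ε a (a ℕ.+ b) ⊗ pochε ε b (a ℕ.+ b) ⊗ pochε -1ℤ (a ℕ.+ b) (a ℕ.+ b)

module _ (ε : ℤ) (ε²≡1 : ε ℤ.* ε ≡ 1ℤ) (a b : ℕ) .{{_ : ℕ.NonZero a}} .{{_ : ℕ.NonZero b}} where

  private
    c = a ℕ.+ b

    instance
      c≢0 : ℕ.NonZero c
      c≢0 = ℕ.>-nonZero (ℕ.<-≤-trans (ℕ.>-nonZero⁻¹ a) (ℕ.m≤m+n a b))

  open Gaussian c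

  private
    n≤r+∣r⊖n∣ : ∀ n r → n ≤ r ℕ.+ ∣ r ⊖ n ∣
    n≤r+∣r⊖n∣ n r with ℕ.≤-total n r
    ... | inj₁ n≤r = ℕ.≤-trans n≤r (ℕ.m≤m+n r _)
    ... | inj₂ r≤n = ℕ.≤-reflexive (sym (trans (cong (r ℕ.+_) (ℤ.∣⊖∣-≤ r≤n)) (ℕ.m+[n∸m]≡n r≤n)))

    r≤n+∣r⊖n∣ : ∀ n r → r ≤ n ℕ.+ ∣ r ⊖ n ∣
    r≤n+∣r⊖n∣ n r = subst (λ k → r ≤ n ℕ.+ k) (ℤ.∣m⊖n∣≡∣n⊖m∣ n r) (n≤r+∣r⊖n∣ r n)

    n≤p+∣r⊖n∣ : ∀ n p r → p ℕ.+ r ≡ n ℕ.+ n → n ≤ p ℕ.+ ∣ r ⊖ n ∣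
    n≤p+∣r⊖n∣ n p r eq = ℕ.+-cancelʳ-≤ n n (p ℕ.+ ∣ r ⊖ n ∣) (begin
      n ℕ.+ n                     ≡⟨ eq ⟨
      p ℕ.+ r                     ≤⟨ ℕ.+-monoʳ-≤ p (r≤n+∣r⊖n∣ n r) ⟩
      p ℕ.+ (n ℕ.+ ∣ r ⊖ n ∣)     ≡⟨ cong (p ℕ.+_) (ℕ.+-comm n _) ⟩
      p ℕ.+ (∣ r ⊖ n ∣ ℕ.+ n)     ≡⟨ ℕ.+-assoc p _ n ⟨
      p ℕ.+ ∣ r ⊖ n ∣ ℕ.+ n       ∎)
      where open ℕ.≤-Reasoning

    -- A factor known to be 1 only up to q^K can still be dropped up to q^n when the exponent of the
    -- term, which is at least |j|, makes up the difference.
    absorb : ∀ {n K} j f → f ≈[ K ] 𝟙 → n ≤ K ℕ.+ ∣ j ∣ → f ⊗ term ε ε²≡1 a b j ≈[ n ] term ε ε²≡1 a b j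
    absorb {n} {K} j f f≈1 n≤ = ≈[]-mono bound (≈[]-trans (≈⇒≈[] (⊗-comm f _))
      (≈[]-trans (mono-⊗-cong[] (pow ε j) (θ a b j) f≈1) (≈⇒≈[] (PSR.*-identityʳ _))))
      where
      bound : n ≤ θ a b j ℕ.+ K
      bound = ℕ.≤-trans n≤ (ℕ.≤-trans (ℕ.≤-reflexive (ℕ.+-comm K _)) (ℕ.+-monoˡ-≤ K (∣j∣≤θ a b j)))

    -- By `gauss-limʳ` and, if p is the smaller index, `gauss-sym`, the coefficient times `qfac n`
    -- is 1 up to q^min(p,r). Since p + r = 2n, this minimum is n - |r - n|, exactly what `absorb`
    -- tolerates.
    limit : ∀ n p r → p ℕ.+ r ≡ n ℕ.+ n → gauss p r ⊗ term ε ε²≡1 a b (r ⊖ n) ⊗ qfac n ≈[ n ] term ε ε²≡1 a b (r ⊖ n)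
    limit n p r eq = ≈[]-trans
      (≈⇒≈[] (solve 3 (λ x y z → (x :* y) :* z ⊜ (x :* z) :* y) ≈-refl (gauss p r) (term ε ε²≡1 a b (r ⊖ n)) (qfac n)))
      go
      where
      go : gauss p r ⊗ qfac n ⊗ term ε ε²≡1 a b (r ⊖ n) ≈[ n ] term ε ε²≡1 a b (r ⊖ n)
      go with ℕ.≤-total r n
      ... | inj₁ r≤n = absorb (r ⊖ n) _
        (≈[]-trans (⊗-cong[] ≈[]-refl (qfac-trunc r≤n)) (≈[]-mono r≤p (gauss-limʳ p r))) (n≤r+∣r⊖n∣ n r)
        where
        r≤p : r ≤ p
        r≤p = ℕ.≤-trans r≤n (ℕ.+-cancelʳ-≤ n n p (ℕ.≤-trans (ℕ.≤-reflexive (sym eq)) (ℕ.+-monoʳ-≤ p r≤n)))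
      ... | inj₂ n≤r = absorb (r ⊖ n) _
        (≈[]-trans (⊗-cong[] (≈⇒≈[] (gauss-sym p r)) (qfac-trunc p≤n)) (≈[]-mono (ℕ.≤-trans p≤n n≤r) (gauss-limʳ r p)))
        (n≤p+∣r⊖n∣ n p r eq)
        where
        p≤n : p ≤ n
        p≤n = ℕ.+-cancelʳ-≤ n p n (ℕ.≤-trans (ℕ.+-monoʳ-≤ p n≤r) (ℕ.≤-reflexive eq))

    antidiagonal≈sumL : {I : Set} (F : I → PS) (f : ℕ → I) → ∀ M → antidiagonal M (λ _ r → F (f r)) ≈ sumL F (applyUpTo f (suc M))
    antidiagonal≈sumL F f zero    = ≈-sym (⊕-identityʳ _)
    antidiagonal≈sumL F f (suc M) = ⊕-cong ≈-refl (antidiagonal≈sumL F (f ∘ suc) M)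

  -- `finite-triple` with N factors of each kind, times (q^c;q^c)_N: up to q^N every Gaussian
  -- coefficient disappears by `limit`.
  jacobi-triple : GF (θ a b) (pow ε) (triple ε a b)
  jacobi-triple = record
    { cover  = interval
    ; unique = interval-unique
    ; covers = λ N j p → ∈-interval N j (ℕ.≤-trans (∣j∣≤θ a b j) p)
    ; value  = λ N → upto (go N) N ℕ.≤-refl
    }
    where
    go : ∀ N → triple ε a b ≈[ N ] sumL (term ε ε²≡1 a b) (interval N)
    go N = begin
      triple ε a b
        ≈⟨ ⊗-cong[] (⊗-cong[] (infProd-trunc (1+q-convergent ε a c) ℕ.≤-refl) (infProd-trunc (1+q-convergent ε b c) ℕ.≤-refl))
                    (infProd-trunc (1+q-convergent -1ℤ c c) ℕ.≤-refl) ⟩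
      prod (λ i → 1+q ε (a ℕ.+ c ℕ.* i)) N ⊗ prod (λ i → 1+q ε (b ℕ.+ c ℕ.* i)) N ⊗ qfac N
        ≈⟨ ≈⇒≈[] (⊗-cong (finite-triple ε ε²≡1 a b N N) ≈-refl) ⟩
      antidiagonal (N ℕ.+ N) (λ p r → gauss p r ⊗ term ε ε²≡1 a b (r ⊖ N)) ⊗ qfac N
        ≈⟨ ≈⇒≈[] (antidiagonal-⊗ (N ℕ.+ N) (qfac N) _) ⟨
      antidiagonal (N ℕ.+ N) (λ p r → gauss p r ⊗ term ε ε²≡1 a b (r ⊖ N) ⊗ qfac N)
        ≈⟨ antidiagonal-cong[] (N ℕ.+ N) (limit N) ⟩
      antidiagonal (N ℕ.+ N) (λ _ r → term ε ε²≡1 a b (r ⊖ N))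
        ≈⟨ ≈⇒≈[] (antidiagonal≈sumL (term ε ε²≡1 a b) (_⊖ N) (N ℕ.+ N)) ⟩
      sumL (term ε ε²≡1 a b) (interval N) ∎
      where open ≈[]-Reasoning N

-- Odd parts

opaque
  odd : PS → PS
  odd f n = f (suc (2 ℕ.* n))

  odd-at : ∀ f n → odd f n ≡ f (suc (2 ℕ.* n))
  odd-at f n = refl

odd-cong : ∀ {f g} → f ≈ g → odd f ≈ odd g
odd-cong {f} {g} p = mk≈ λ n → trans (odd-at f n) (trans (at p _) (sym (odd-at g n)))

-- the substitution q ↦ q²
dilate : PS → PS
dilate g zero          = g 0
dilate g (suc zero)    = 0ℤ
dilate g (suc (suc n)) = dilate (λ k → g (suc k)) n

opaque
  unfolding _⊗_ mono odd

  -- Linearity of the odd part over series in even powers. The induction strips two coefficients of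
  -- `dilate g` at a time, the second of which is 0.
  odd-⊗-dilate : ∀ f g → odd (f ⊗ dilate g) ≈ odd f ⊗ g
  odd-⊗-dilate f g = mk≈ (go g) where
    open ≡-Reasoning
    lemma : ∀ x y z → x ℤ.* 0ℤ ℤ.+ y ℤ.* z ≡ y ℤ.* z
    lemma = solve-∀
    lemma′ : ∀ x y z → x ℤ.+ y ℤ.* 0ℤ ℤ.+ z ≡ x ℤ.+ z
    lemma′ = solve-∀
    go : ∀ g n → (f ⊛ dilate g) (suc (2 ℕ.* n)) ≡ (odd f ⊛ g) n
    go g zero    = lemma (f 0) (f 1) (g 0)
    go g (suc n) = begin
      (f ⊛ h) (suc (2 ℕ.* suc n))
        ≡⟨ cong (λ k → (f ⊛ h) (suc (suc k))) (ℕ.+-suc n (n ℕ.+ 0)) ⟩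
      (f ⊛ h) (suc (suc m))
        ≡⟨ ⊗-tailʳ f h (suc m) ⟩
      (f ⊛ tail h) (suc m) ℤ.+ f (suc (suc m)) ℤ.* g 0
        ≡⟨ cong (ℤ._+ f (suc (suc m)) ℤ.* g 0) (⊗-tailʳ f (tail h) m) ⟩
      (f ⊛ dilate (tail g)) m ℤ.+ f (suc m) ℤ.* 0ℤ ℤ.+ f (suc (suc m)) ℤ.* g 0
        ≡⟨ lemma′ ((f ⊛ dilate (tail g)) m) (f (suc m)) (f (suc (suc m)) ℤ.* g 0) ⟩
      (f ⊛ dilate (tail g)) m ℤ.+ f (suc (suc m)) ℤ.* g 0
        ≡⟨ cong₂ ℤ._+_ (go (tail g) n) (cong (λ k → f (suc (suc k)) ℤ.* g 0) (sym (ℕ.+-suc n (n ℕ.+ 0)))) ⟩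
      (odd f ⊛ tail g) n ℤ.+ odd f (suc n) ℤ.* g 0
        ≡⟨ ⊗-tailʳ (odd f) g n ⟨
      (odd f ⊛ g) (suc n) ∎
      where
      h : PS
      h = dilate g
      m : ℕ
      m = suc (2 ℕ.* n)

  dilate-⊕ : ∀ f g → dilate (f ⊕ g) ≈ dilate f ⊕ dilate g
  dilate-⊕ f g = mk≈ (go f g) where
    go : ∀ f g n → dilate (f ⊕ g) n ≡ dilate f n ℤ.+ dilate g n
    go f g zero          = refl
    go f g (suc zero)    = refl
    go f g (suc (suc n)) = go (tail f) (tail g) n

  dilate-𝟘 : dilate 𝟘 ≈ 𝟘
  dilate-𝟘 = mk≈ go where
    go : ∀ n → dilate 𝟘 n ≡ 0ℤ
    go zero          = refl
    go (suc zero)    = refl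
    go (suc (suc n)) = go n

  dilate-mono : ∀ c e → dilate (mono c e) ≈ mono c (2 ℕ.* e)
  dilate-mono c e = mk≈ (go e) where
    dilate-0 : ∀ n → dilate (λ _ → 0ℤ) n ≡ 0ℤ
    dilate-0 zero          = refl
    dilate-0 (suc zero)    = refl
    dilate-0 (suc (suc n)) = dilate-0 n
    go : ∀ e n → dilate (mono c e) n ≡ mono c (2 ℕ.* e) n
    go zero    zero          = refl
    go zero    (suc zero)    = refl
    go zero    (suc (suc n)) = dilate-0 n
    go (suc e) zero          = refl
    go (suc e) (suc zero)    = cong (λ k → mono c k 0) (sym (ℕ.+-suc e (e ℕ.+ 0)))
    go (suc e) (suc (suc n)) = trans (go e n) (cong (λ k → mono c k (suc n)) (sym (ℕ.+-suc e (e ℕ.+ 0))))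

dilate-cong[] : ∀ {N f g} → f ≈[ N ] g → dilate f ≈[ N ] dilate g
dilate-cong[] {N} {f} {g} p = mk≈[] λ k k≤N → go f g k (λ i i≤k → upto p i (ℕ.≤-trans i≤k k≤N)) where
  go : ∀ f g k → (∀ i → i ≤ k → f i ≡ g i) → dilate f k ≡ dilate g k
  go f g zero          h = h 0 z≤n
  go f g (suc zero)    h = refl
  go f g (suc (suc k)) h = go (λ i → f (suc i)) (λ i → g (suc i)) k λ i i≤k → h (suc i) (s≤s (ℕ.m≤n⇒m≤1+n i≤k))

GF-dilate : {I : Set} {e : I → ℕ} {σ : I → ℤ} {S : PS} → GF e σ S → GF (λ i → 2 ℕ.* e i) σ (dilate S)
GF-dilate {I} {e} {σ} gf = record
  { cover = cover ; unique = unique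
  ; covers = λ N i h → covers N i (ℕ.≤-trans (ℕ.m≤m+n (e i) _) h)
  ; value = λ N → trans (upto (dilate-cong[] (GF-value[] e σ gf N)) N ℕ.≤-refl) (at (go (cover N)) N) }
  where
  open GF gf
  go : ∀ is → dilate (sumL (λ i → mono (σ i) (e i)) is) ≈ sumL (λ i → mono (σ i) (2 ℕ.* e i)) is
  go []       = dilate-𝟘
  go (i ∷ is) = ≈-trans (dilate-⊕ _ _) (⊕-cong (dilate-mono (σ i) (e i)) (go is))

module _ {J K : Set} (e : K → ℕ) (σ : K → ℤ) (ι : J → K) (e′ : J → ℕ) (σ′ : J → ℤ)
  (classify : ∀ k → (∀ n → e k ≢ suc (2 ℕ.* n)) ⊎ (∃[ j ] ι j ≡ k))
  (ι-injective : ∀ {i j} → ι i ≡ ι j → i ≡ j)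
  (e-ι : ∀ j → e (ι j) ≡ suc (2 ℕ.* e′ j)) (σ-ι : ∀ j → σ (ι j) ≡ σ′ j) where

  private
    collect : List K → List J
    collect []       = []
    collect (k ∷ ks) with classify k
    ... | inj₁ _       = collect ks
    ... | inj₂ (j , _) = j ∷ collect ks

    ∈-collect⁺ : ∀ {j} ks → ι j ∈ ks → j ∈ collect ks
    ∈-collect⁺ {j} (k ∷ ks) (here p) with classify k
    ... | inj₁ ¬odd = ⊥-elim (¬odd (e′ j) (trans (cong e (sym p)) (e-ι j)))
    ... | inj₂ (i , q) = here (ι-injective (trans p (sym q)))
    ∈-collect⁺ {j} (k ∷ ks) (there p) with classify k
    ... | inj₁ _ = ∈-collect⁺ ks p
    ... | inj₂ _ = there (∈-collect⁺ ks p)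

    ∈-collect⁻ : ∀ {j} ks → j ∈ collect ks → ι j ∈ ks
    ∈-collect⁻ (k ∷ ks) p with classify k
    ∈-collect⁻ (k ∷ ks) p             | inj₁ _       = there (∈-collect⁻ ks p)
    ∈-collect⁻ (k ∷ ks) (here refl) | inj₂ (_ , q) = here q
    ∈-collect⁻ (k ∷ ks) (there p)     | inj₂ _       = there (∈-collect⁻ ks p)

    collect-unique : ∀ {ks} → Unique ks → Unique (collect ks)
    collect-unique {[]}     []      = []
    collect-unique {k ∷ ks} (p ∷ u) with classify k
    ... | inj₁ _       = collect-unique u
    ... | inj₂ (j , q) = All.tabulate (λ x∈ j≡x → All.lookup p (∈-collect⁻ ks x∈) (trans (sym q) (cong ι j≡x)))
                         ∷ collect-unique u

    mono-odd : ∀ c m n → mono c (suc (2 ℕ.* m)) (suc (2 ℕ.* n)) ≡ mono c m n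
    mono-odd c m n with m ℕ.≟ n
    ... | yes refl = trans (mono-same c _) (sym (mono-same c m))
    ... | no  m≢n    = trans (mono-diff c _ _ (λ p → m≢n (ℕ.*-cancelˡ-≡ m n 2 (ℕ.suc-injective p)))) (sym (mono-diff c m n m≢n))

    collect-sum : ∀ ks n → sumL (λ k → mono (σ k) (e k)) ks (suc (2 ℕ.* n)) ≡ sumL (λ j → mono (σ′ j) (e′ j)) (collect ks) n
    collect-sum []       n = trans (𝟘-at _) (sym (𝟘-at n))
    collect-sum (k ∷ ks) n with classify k
    ... | inj₁ ¬odd = trans (⊕-at _ _ _) (trans (cong₂ ℤ._+_ (mono-diff (σ k) (e k) _ (¬odd n)) (collect-sum ks n)) (ℤ.+-identityˡ _))
    ... | inj₂ (j , refl) = trans (⊕-at _ _ _) (trans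
      (cong₂ ℤ._+_ (trans (cong₂ (λ c m → mono c m (suc (2 ℕ.* n))) (σ-ι j) (e-ι j)) (mono-odd (σ′ j) (e′ j) n)) (collect-sum ks n))
      (sym (⊕-at _ _ n)))

  -- The map ι parametrises exactly the indices of odd exponent: `e-ι` makes its values odd,
  -- `classify` shows that every other index contributes to no odd exponent, and `collect` pulls the
  -- covers back along it.
  GF-odd : ∀ {S} → GF e σ S → GF e′ σ′ (odd S)
  GF-odd {S} gf = record
    { cover  = λ N → collect (cover (suc (2 ℕ.* N)))
    ; unique = λ N → collect-unique (unique _)
    ; covers = λ N j h → ∈-collect⁺ _ (covers _ (ι j) (ℕ.≤-trans (ℕ.≤-reflexive (e-ι j)) (s≤s (ℕ.*-monoʳ-≤ 2 h))))
    ; value  = λ N → trans (odd-at S N) (trans (value _) (collect-sum (cover (suc (2 ℕ.* N))) N))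
    }
    where open GF gf

-- Uniqueness of division with remainder, and signs

-- The difference s - r is (l - m) k, yet smaller than k in absolute value, so l = m.
divMod-unique : ∀ k {r s l m} → r < k → s < k → + r ℤ.+ l ℤ.* + k ≡ + s ℤ.+ m ℤ.* + k → r ≡ s × l ≡ m
divMod-unique k {r} {s} {l} {m} r<k s<k eq = ℤ.+-injective r≡s , l≡m
  where
  lemma : ∀ r s l m k → r ℤ.+ l ℤ.* k ≡ s ℤ.+ m ℤ.* k → s ℤ.- r ≡ (l ℤ.- m) ℤ.* k
  lemma r s l m k p = trans (step₁ r s l k) (trans (cong (λ x → s ℤ.- (x ℤ.- l ℤ.* k)) p) (step₂ s l m k)) where
    step₁ : ∀ r s l k → s ℤ.- r ≡ s ℤ.- ((r ℤ.+ l ℤ.* k) ℤ.- l ℤ.* k)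
    step₁ = solve-∀
    step₂ : ∀ s l m k → s ℤ.- ((s ℤ.+ m ℤ.* k) ℤ.- l ℤ.* k) ≡ (l ℤ.- m) ℤ.* k
    step₂ = solve-∀
  small : ∣ l ℤ.- m ∣ ℕ.* k < k
  small = ℕ.≤-<-trans (ℕ.≤-reflexive (trans (sym (ℤ.abs-* (l ℤ.- m) (+ k)))
            (cong ∣_∣ (trans (sym (lemma (+ r) (+ s) l m (+ k) eq)) (ℤ.m-n≡m⊖n s r)))))
          (ℕ.≤-<-trans (ℤ.∣m⊝n∣≤m⊔n s r) (ℕ.⊔-lub s<k r<k))
  zero-of : ∀ x → x ℕ.* k < k → x ≡ 0
  zero-of zero    _ = refl
  zero-of (suc x) h = ⊥-elim (ℕ.<⇒≱ h (ℕ.m≤m+n k _))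
  l≡m : l ≡ m
  l≡m = ℤ.i-j≡0⇒i≡j l m (ℤ.∣i∣≡0⇒i≡0 (zero-of _ small))
  r≡s : + r ≡ + s
  r≡s = ℤ+.∙-cancelʳ (l ℤ.* + k) (+ r) (+ s) (trans eq (cong (λ x → + s ℤ.+ x ℤ.* + k) (sym l≡m)))

%ℕ-unique : ∀ k .{{_ : ℕ.NonZero k}} {r} l → r < k → (+ r ℤ.+ l ℤ.* + k) %ℕ k ≡ r × (+ r ℤ.+ l ℤ.* + k) /ℕ k ≡ l
%ℕ-unique k {r} l r<k = divMod-unique k (n%ℕd<d n k) r<k (sym (a≡a%ℕn+[a/ℕn]*n n k))
  where n = + r ℤ.+ l ℤ.* + k

pow-double : ∀ j → pow -1ℤ (j ℤ.+ j) ≡ 1ℤ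
pow-double j = trans (pow-+ -1ℤ refl j j) (go ∣ j ∣) where
  go : ∀ n → -1ℤ ℤ.^ n ℤ.* -1ℤ ℤ.^ n ≡ 1ℤ
  go zero    = refl
  go (suc n) = trans (lemma (-1ℤ ℤ.^ n)) (go n) where
    lemma : ∀ x → (-1ℤ ℤ.* x) ℤ.* (-1ℤ ℤ.* x) ≡ x ℤ.* x
    lemma = solve-∀

2*-+ : ∀ m n → + 2 ℤ.* + (m ℕ.+ n) ≡ + 2 ℤ.* + m ℤ.+ + 2 ℤ.* + n
2*-+ m n = ℤ.*-distribˡ-+ (+ 2) (+ m) (+ n)

2*-θ+θ : ∀ a b i a′ b′ j → + 2 ℤ.* + (θ a b i ℕ.+ θ a′ b′ j) ≡
  ((+ a ℤ.+ + b) ℤ.* (i ℤ.* i) ℤ.+ (+ a ℤ.- + b) ℤ.* i) ℤ.+ ((+ a′ ℤ.+ + b′) ℤ.* (j ℤ.* j) ℤ.+ (+ a′ ℤ.- + b′) ℤ.* j)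
2*-θ+θ a b i a′ b′ j = trans (2*-+ (θ a b i) (θ a′ b′ j)) (cong₂ ℤ._+_ (θ-spec a b i) (θ-spec a′ b′ j))

-- The quintuple product in base x⁵ at z = x²

Q-index : Set
Q-index = ℤ ⊎ ℤ

eQ : Q-index → ℕ
eQ = [ θ 11 4 , (λ l → suc (θ 1 14 l)) ]

σQ : Q-index → ℤ
σQ = [ (λ _ → 1ℤ) , (λ _ → -1ℤ) ]

quintuple₁ quintuple₂ : PS
quintuple₁ = seriesℤ (θ 11 4) (λ _ → 1ℤ)
quintuple₂ = seriesℤ (λ l → suc (θ 1 14 l)) (λ _ → -1ℤ)

quintuple₁-gf : GF (θ 11 4) (λ _ → 1ℤ) quintuple₁
quintuple₁-gf = GF-ℤ (∣j∣≤θ 11 4)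

quintuple₂-gf : GF (λ l → suc (θ 1 14 l)) (λ _ → -1ℤ) quintuple₂
quintuple₂-gf = GF-ℤ (λ l → ℕ.m≤n⇒m≤1+n (∣j∣≤θ 1 14 l))

quintuple : PS
quintuple = quintuple₁ ⊕ quintuple₂

quintuple-gf : GF eQ σQ quintuple
quintuple-gf = GF-⊎ quintuple₁-gf quintuple₂-gf

private
  Index : Set
  Index = (ℤ × ℤ ⊎ ℤ × ℤ) ⊎ ℤ × ℤ

  -- The exponent of the (m , n) term is regrouped by m + 2n = 3l, 3l - 2, 3l - 1: the first two classes factor
  -- into T(10,20) times a part of the quintuple series, the last one is antisymmetric under ν ↦ -1 - ν.
  φ : Index → ℤ × ℤ
  φ (inj₁ (inj₁ (ν , l))) = l ℤ.+ + 2 ℤ.* ν , l ℤ.- ν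
  φ (inj₁ (inj₂ (ν , l))) = l ℤ.- + 2 ℤ.* ν , (ν ℤ.+ l) ℤ.- 1ℤ
  φ (inj₂ (ν , l))        = (l ℤ.- 1ℤ) ℤ.- + 2 ℤ.* ν , ν ℤ.+ l

  -- The inverse of φ on each class: if m + 2n = 3t + r, then l is t for r = 0 and t + 1 otherwise,
  -- and ν follows from n.
  ψ′ : ℕ → ℤ → ℤ → Index
  ψ′ zero          t n = inj₁ (inj₁ (t ℤ.- n , t))
  ψ′ (suc zero)    t n = inj₁ (inj₂ (n ℤ.- t , t ℤ.+ 1ℤ))
  ψ′ (suc (suc _)) t n = inj₂ ((n ℤ.- t) ℤ.- 1ℤ , t ℤ.+ 1ℤ)

  ψ : ℤ × ℤ → Index
  ψ (m , n) = ψ′ ((m ℤ.+ + 2 ℤ.* n) %ℕ 3) ((m ℤ.+ + 2 ℤ.* n) /ℕ 3) n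

  φψ : ∀ p → φ (ψ p) ≡ p
  φψ (m , n) = go _ _ (n%ℕd<d (m ℤ.+ + 2 ℤ.* n) 3) (trans (lemma m n) (cong (ℤ._- + 2 ℤ.* n) (a≡a%ℕn+[a/ℕn]*n (m ℤ.+ + 2 ℤ.* n) 3)))
    where
    lemma : ∀ m n → m ≡ (m ℤ.+ + 2 ℤ.* n) ℤ.- + 2 ℤ.* n
    lemma = solve-∀
    go : ∀ r t → r < 3 → m ≡ (+ r ℤ.+ t ℤ.* + 3) ℤ.- + 2 ℤ.* n → φ (ψ′ r t n) ≡ (m , n)
    go 0 t _ eq = cong₂ _,_ (trans (p₁ t n) (sym eq)) (p₂ t n) where
      p₁ : ∀ t n → t ℤ.+ + 2 ℤ.* (t ℤ.- n) ≡ (+ 0 ℤ.+ t ℤ.* + 3) ℤ.- + 2 ℤ.* n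
      p₁ = solve-∀
      p₂ : ∀ t n → t ℤ.- (t ℤ.- n) ≡ n
      p₂ = solve-∀
    go 1 t _ eq = cong₂ _,_ (trans (p₁ t n) (sym eq)) (p₂ t n) where
      p₁ : ∀ t n → (t ℤ.+ 1ℤ) ℤ.- + 2 ℤ.* (n ℤ.- t) ≡ (+ 1 ℤ.+ t ℤ.* + 3) ℤ.- + 2 ℤ.* n
      p₁ = solve-∀
      p₂ : ∀ t n → ((n ℤ.- t) ℤ.+ (t ℤ.+ 1ℤ)) ℤ.- 1ℤ ≡ n
      p₂ = solve-∀
    go 2 t _ eq = cong₂ _,_ (trans (p₁ t n) (sym eq)) (p₂ t n) where
      p₁ : ∀ t n → ((t ℤ.+ 1ℤ) ℤ.- 1ℤ) ℤ.- + 2 ℤ.* ((n ℤ.- t) ℤ.- 1ℤ) ≡ (+ 2 ℤ.+ t ℤ.* + 3) ℤ.- + 2 ℤ.* n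
      p₁ = solve-∀
      p₂ : ∀ t n → ((n ℤ.- t) ℤ.- 1ℤ) ℤ.+ (t ℤ.+ 1ℤ) ≡ n
      p₂ = solve-∀
    go (suc (suc (suc _))) t (s≤s (s≤s (s≤s ()))) eq

  ψ-value : ∀ m n r t → r < 3 → m ℤ.+ + 2 ℤ.* n ≡ + r ℤ.+ t ℤ.* + 3 → ψ (m , n) ≡ ψ′ r t n
  ψ-value m n r t r<3 eq = cong₂ (λ s u → ψ′ s u n)
    (trans (cong (_%ℕ 3) eq) (proj₁ (%ℕ-unique 3 t r<3))) (trans (cong (_/ℕ 3) eq) (proj₂ (%ℕ-unique 3 t r<3)))

  ψφ : ∀ i → ψ (φ i) ≡ i
  ψφ (inj₁ (inj₁ (ν , l))) = trans (ψ-value (l ℤ.+ + 2 ℤ.* ν) (l ℤ.- ν) 0 l (s≤s z≤n) (p ν l)) (cong (λ x → inj₁ (inj₁ (x , l))) (q ν l)) where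
    p : ∀ ν l → (l ℤ.+ + 2 ℤ.* ν) ℤ.+ + 2 ℤ.* (l ℤ.- ν) ≡ + 0 ℤ.+ l ℤ.* + 3
    p = solve-∀
    q : ∀ ν l → l ℤ.- (l ℤ.- ν) ≡ ν
    q = solve-∀
  ψφ (inj₁ (inj₂ (ν , l))) = trans (ψ-value (l ℤ.- + 2 ℤ.* ν) ((ν ℤ.+ l) ℤ.- 1ℤ) 1 (l ℤ.- 1ℤ) (s≤s (s≤s z≤n)) (p ν l))
    (cong₂ (λ x y → inj₁ (inj₂ (x , y))) (q ν l) (q′ l)) where
    p : ∀ ν l → (l ℤ.- + 2 ℤ.* ν) ℤ.+ + 2 ℤ.* ((ν ℤ.+ l) ℤ.- 1ℤ) ≡ + 1 ℤ.+ (l ℤ.- 1ℤ) ℤ.* + 3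
    p = solve-∀
    q : ∀ ν l → ((ν ℤ.+ l) ℤ.- 1ℤ) ℤ.- (l ℤ.- 1ℤ) ≡ ν
    q = solve-∀
    q′ : ∀ l → (l ℤ.- 1ℤ) ℤ.+ 1ℤ ≡ l
    q′ = solve-∀
  ψφ (inj₂ (ν , l)) = trans (ψ-value ((l ℤ.- 1ℤ) ℤ.- + 2 ℤ.* ν) (ν ℤ.+ l) 2 (l ℤ.- 1ℤ) (s≤s (s≤s (s≤s z≤n))) (p ν l))
    (cong₂ (λ x y → inj₂ (x , y)) (q ν l) (q′ l)) where
    p : ∀ ν l → ((l ℤ.- 1ℤ) ℤ.- + 2 ℤ.* ν) ℤ.+ + 2 ℤ.* (ν ℤ.+ l) ≡ + 2 ℤ.+ (l ℤ.- 1ℤ) ℤ.* + 3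
    p = solve-∀
    q : ∀ ν l → ((ν ℤ.+ l) ℤ.- (l ℤ.- 1ℤ)) ℤ.- 1ℤ ≡ ν
    q = solve-∀
    q′ : ∀ l → (l ℤ.- 1ℤ) ℤ.+ 1ℤ ≡ l
    q′ = solve-∀

  Z₁ Z₂ : PS
  Z₁ = seriesℤ (λ ν → 3 ℕ.+ θ 30 0 ν) (λ ν → ℤ.- pow -1ℤ ν)
  Z₂ = seriesℤ (θ 6 9) (λ _ → 1ℤ)

  -- θ 30 0 vanishes at ν = -1, so `∣j∣≤θ` does not apply; for negative ν the offset 3 supplies the
  -- missing unit.
  Z₁-gf : GF (λ ν → 3 ℕ.+ θ 30 0 ν) (λ ν → ℤ.- pow -1ℤ ν) Z₁
  Z₁-gf = GF-ℤ bound
    where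
    n≤30tri : ∀ n {k} → n ≤ 30 ℕ.* tri n ℕ.+ k
    n≤30tri n = ℕ.≤-trans (n≤tri n) (ℕ.≤-trans (ℕ.m≤n*m (tri n) 30) (ℕ.m≤m+n _ _))
    bound : ∀ ν → ∣ ν ∣ ≤ 3 ℕ.+ θ 30 0 ν
    bound (+ n)    = ℕ.≤-trans (n≤30tri n) (ℕ.m≤n+m _ 3)
    bound -[1+ n ] = s≤s (ℕ.≤-trans (n≤30tri n) (ℕ.m≤n+m _ 2))

  Z₂-gf : GF (θ 6 9) (λ _ → 1ℤ) Z₂
  Z₂-gf = GF-ℤ (∣j∣≤θ 6 9)

  Z₁≈𝟘 : Z₁ ≈ 𝟘
  Z₁≈𝟘 = GF-antisymmetric flip flip² e-flip σ-flip Z₁-gf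
    where
    flip : ℤ → ℤ
    flip ν = -1ℤ ℤ.- ν
    flip² : ∀ ν → -1ℤ ℤ.- (-1ℤ ℤ.- ν) ≡ ν
    flip² = solve-∀
    e-flip : ∀ ν → 3 ℕ.+ θ 30 0 (flip ν) ≡ 3 ℕ.+ θ 30 0 ν
    e-flip ν = cong (3 ℕ.+_) (2*-injective (trans (θ-spec 30 0 (flip ν)) (trans (poly ν) (sym (θ-spec 30 0 ν)))))
      where
      poly : ∀ ν → (+ 30 ℤ.+ + 0) ℤ.* ((-1ℤ ℤ.- ν) ℤ.* (-1ℤ ℤ.- ν)) ℤ.+ (+ 30 ℤ.- + 0) ℤ.* (-1ℤ ℤ.- ν) ≡ (+ 30 ℤ.+ + 0) ℤ.* (ν ℤ.* ν) ℤ.+ (+ 30 ℤ.- + 0) ℤ.* ν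
      poly = solve-∀
    σ-flip : ∀ ν → ℤ.- pow -1ℤ (flip ν) ≡ ℤ.- (ℤ.- pow -1ℤ ν)
    σ-flip ν = cong ℤ.-_ (trans (pow-+ -1ℤ refl -1ℤ (ℤ.- ν)) (trans (ℤ.-1*i≡-i _) (cong (λ k → ℤ.- (-1ℤ ℤ.^ k)) (ℤ.∣-i∣≡∣i∣ ν))))

  sgn : ∀ m n i j → m ℤ.+ n ≡ (i ℤ.+ i) ℤ.+ j → pow -1ℤ m ℤ.* pow -1ℤ n ≡ pow -1ℤ j
  sgn m n i j eq = begin
    pow -1ℤ m ℤ.* pow -1ℤ n          ≡⟨ pow-+ -1ℤ refl m n ⟨
    pow -1ℤ (m ℤ.+ n)                ≡⟨ cong (pow -1ℤ) eq ⟩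
    pow -1ℤ ((i ℤ.+ i) ℤ.+ j)        ≡⟨ pow-+ -1ℤ refl (i ℤ.+ i) j ⟩
    pow -1ℤ (i ℤ.+ i) ℤ.* pow -1ℤ j  ≡⟨ cong (ℤ._* pow -1ℤ j) (pow-double i) ⟩
    1ℤ ℤ.* pow -1ℤ j                 ≡⟨ ℤ.*-identityˡ _ ⟩
    pow -1ℤ j                        ∎
    where open ≡-Reasoning

  pow-1+ : ∀ ν → pow -1ℤ (-1ℤ ℤ.+ ν) ≡ ℤ.- pow -1ℤ ν
  pow-1+ ν = trans (pow-+ -1ℤ refl -1ℤ ν) (ℤ.-1*i≡-i _)

  -- In each class the coefficient of νl cancels, so the exponent separates into one in ν and one in
  -- l. The residue leaves the constants 0, 1 and 3.
  e-φ : ∀ i → θ 2 3 (proj₁ (φ i)) ℕ.+ θ 9 1 (proj₂ (φ i)) ≡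
    [ [ (λ (ν , l) → θ 10 20 ν ℕ.+ θ 11 4 l) , (λ (ν , l) → θ 10 20 ν ℕ.+ suc (θ 1 14 l)) ]
    , (λ (ν , l) → 3 ℕ.+ θ 30 0 ν ℕ.+ θ 6 9 l) ] i
  e-φ (inj₁ (inj₁ (ν , l))) = 2*-injective (trans (2*-θ+θ 2 3 (l ℤ.+ + 2 ℤ.* ν) 9 1 (l ℤ.- ν))
    (trans (poly ν l) (sym (2*-θ+θ 10 20 ν 11 4 l))))
    where
    poly : ∀ ν l →
      ((+ 2 ℤ.+ + 3) ℤ.* ((l ℤ.+ + 2 ℤ.* ν) ℤ.* (l ℤ.+ + 2 ℤ.* ν)) ℤ.+ (+ 2 ℤ.- + 3) ℤ.* (l ℤ.+ + 2 ℤ.* ν))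
        ℤ.+ ((+ 9 ℤ.+ + 1) ℤ.* ((l ℤ.- ν) ℤ.* (l ℤ.- ν)) ℤ.+ (+ 9 ℤ.- + 1) ℤ.* (l ℤ.- ν))
      ≡ ((+ 10 ℤ.+ + 20) ℤ.* (ν ℤ.* ν) ℤ.+ (+ 10 ℤ.- + 20) ℤ.* ν) ℤ.+ ((+ 11 ℤ.+ + 4) ℤ.* (l ℤ.* l) ℤ.+ (+ 11 ℤ.- + 4) ℤ.* l)
    poly = solve-∀
  e-φ (inj₁ (inj₂ (ν , l))) = trans (2*-injective (trans (2*-θ+θ 2 3 (l ℤ.- + 2 ℤ.* ν) 9 1 ((ν ℤ.+ l) ℤ.- 1ℤ))
    (trans (poly ν l) (sym (trans (2*-+ 1 _) (cong (ℤ._+_ (+ 2)) (2*-θ+θ 10 20 ν 1 14 l))))))) (sym (ℕ.+-suc (θ 10 20 ν) (θ 1 14 l)))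
    where
    poly : ∀ ν l →
      ((+ 2 ℤ.+ + 3) ℤ.* ((l ℤ.- + 2 ℤ.* ν) ℤ.* (l ℤ.- + 2 ℤ.* ν)) ℤ.+ (+ 2 ℤ.- + 3) ℤ.* (l ℤ.- + 2 ℤ.* ν))
        ℤ.+ ((+ 9 ℤ.+ + 1) ℤ.* (((ν ℤ.+ l) ℤ.- 1ℤ) ℤ.* ((ν ℤ.+ l) ℤ.- 1ℤ)) ℤ.+ (+ 9 ℤ.- + 1) ℤ.* ((ν ℤ.+ l) ℤ.- 1ℤ))
      ≡ + 2 ℤ.+ (((+ 10 ℤ.+ + 20) ℤ.* (ν ℤ.* ν) ℤ.+ (+ 10 ℤ.- + 20) ℤ.* ν) ℤ.+ ((+ 1 ℤ.+ + 14) ℤ.* (l ℤ.* l) ℤ.+ (+ 1 ℤ.- + 14) ℤ.* l))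
    poly = solve-∀
  e-φ (inj₂ (ν , l)) = 2*-injective (trans (2*-θ+θ 2 3 ((l ℤ.- 1ℤ) ℤ.- + 2 ℤ.* ν) 9 1 (ν ℤ.+ l))
    (trans (poly ν l) (sym (trans (2*-+ 3 _) (cong (ℤ._+_ (+ 6)) (2*-θ+θ 30 0 ν 6 9 l))))))
    where
    poly : ∀ ν l →
      ((+ 2 ℤ.+ + 3) ℤ.* (((l ℤ.- 1ℤ) ℤ.- + 2 ℤ.* ν) ℤ.* ((l ℤ.- 1ℤ) ℤ.- + 2 ℤ.* ν)) ℤ.+ (+ 2 ℤ.- + 3) ℤ.* ((l ℤ.- 1ℤ) ℤ.- + 2 ℤ.* ν))
        ℤ.+ ((+ 9 ℤ.+ + 1) ℤ.* ((ν ℤ.+ l) ℤ.* (ν ℤ.+ l)) ℤ.+ (+ 9 ℤ.- + 1) ℤ.* (ν ℤ.+ l))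
      ≡ + 6 ℤ.+ (((+ 30 ℤ.+ + 0) ℤ.* (ν ℤ.* ν) ℤ.+ (+ 30 ℤ.- + 0) ℤ.* ν) ℤ.+ ((+ 6 ℤ.+ + 9) ℤ.* (l ℤ.* l) ℤ.+ (+ 6 ℤ.- + 9) ℤ.* l))
    poly = solve-∀

  -- m + n has the parity of ν in the first class and of ν - 1 in the others, so the sign does not
  -- depend on l. Hence each half of the quintuple series has a constant sign.
  σ-φ : ∀ i → pow -1ℤ (proj₁ (φ i)) ℤ.* pow -1ℤ (proj₂ (φ i)) ≡
    [ [ (λ (ν , l) → pow -1ℤ ν ℤ.* 1ℤ) , (λ (ν , l) → pow -1ℤ ν ℤ.* -1ℤ) ]
    , (λ (ν , l) → ℤ.- pow -1ℤ ν ℤ.* 1ℤ) ] i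
  σ-φ (inj₁ (inj₁ (ν , l))) = trans (sgn (l ℤ.+ + 2 ℤ.* ν) (l ℤ.- ν) l ν (lin ν l)) (sym (ℤ.*-identityʳ _)) where
    lin : ∀ ν l → (l ℤ.+ + 2 ℤ.* ν) ℤ.+ (l ℤ.- ν) ≡ (l ℤ.+ l) ℤ.+ ν
    lin = solve-∀
  σ-φ (inj₁ (inj₂ (ν , l))) = trans (sgn (l ℤ.- + 2 ℤ.* ν) ((ν ℤ.+ l) ℤ.- 1ℤ) (l ℤ.- ν) (-1ℤ ℤ.+ ν) (lin ν l))
    (trans (pow-1+ ν) (trans (sym (ℤ.-1*i≡-i _)) (ℤ.*-comm -1ℤ _))) where
    lin : ∀ ν l → (l ℤ.- + 2 ℤ.* ν) ℤ.+ ((ν ℤ.+ l) ℤ.- 1ℤ) ≡ ((l ℤ.- ν) ℤ.+ (l ℤ.- ν)) ℤ.+ (-1ℤ ℤ.+ ν)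
    lin = solve-∀
  σ-φ (inj₂ (ν , l)) = trans (sgn ((l ℤ.- 1ℤ) ℤ.- + 2 ℤ.* ν) (ν ℤ.+ l) (l ℤ.- ν) (-1ℤ ℤ.+ ν) (lin ν l))
    (trans (pow-1+ ν) (sym (ℤ.*-identityʳ _))) where
    lin : ∀ ν l → ((l ℤ.- 1ℤ) ℤ.- + 2 ℤ.* ν) ℤ.+ (ν ℤ.+ l) ≡ ((l ℤ.- ν) ℤ.+ (l ℤ.- ν)) ℤ.+ (-1ℤ ℤ.+ ν)
    lin = solve-∀

quintuple-product : triple -1ℤ 2 3 ⊗ triple -1ℤ 9 1 ≈ triple -1ℤ 10 20 ⊗ quintuple
quintuple-product = begin
  triple -1ℤ 2 3 ⊗ triple -1ℤ 9 1
    ≈⟨ GF-unique _ _ (GF-reindex φ ψ φψ ψφ e-φ σ-φ (GF-⊗ (jacobi-triple -1ℤ refl 2 3) (jacobi-triple -1ℤ refl 9 1)))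
         (GF-⊎ (GF-⊎ (GF-⊗ J quintuple₁-gf) (GF-⊗ J quintuple₂-gf)) (GF-⊗ Z₁-gf Z₂-gf)) ⟩
  (triple -1ℤ 10 20 ⊗ quintuple₁ ⊕ triple -1ℤ 10 20 ⊗ quintuple₂) ⊕ Z₁ ⊗ Z₂
    ≈⟨ ⊕-cong ≈-refl (≈-trans (⊗-cong Z₁≈𝟘 ≈-refl) (PSR.zeroˡ Z₂)) ⟩
  (triple -1ℤ 10 20 ⊗ quintuple₁ ⊕ triple -1ℤ 10 20 ⊗ quintuple₂) ⊕ 𝟘
    ≈⟨ ⊕-identityʳ _ ⟩
  triple -1ℤ 10 20 ⊗ quintuple₁ ⊕ triple -1ℤ 10 20 ⊗ quintuple₂
    ≈⟨ PSR.distribˡ _ _ _ ⟨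
  triple -1ℤ 10 20 ⊗ quintuple ∎
  where
  open ≈-Reasoning
  J = jacobi-triple -1ℤ refl 10 20

-- Rearranging the products

poch⁻ : ℕ → ℕ → PS
poch⁻ = pochε -1ℤ

blocks₂ : ∀ b c .{{_ : ℕ.NonZero b}} .{{_ : ℕ.NonZero c}} → poch⁻ b c ≈ poch⁻ b (c ℕ.* 2) ⊗ poch⁻ (b ℕ.+ c) (c ℕ.* 2)
blocks₂ b c = ≈-trans (pochε-blocks -1ℤ 2 b c) (⊗-cong (≈-trans (⊗-identityˡ _)
  (PSR.reflexive (cong (λ x → poch⁻ x (c ℕ.* 2)) (trans (cong (b ℕ.+_) (ℕ.*-zeroʳ c)) (ℕ.+-identityʳ b)))))
  (PSR.reflexive (cong (λ x → poch⁻ (b ℕ.+ x) (c ℕ.* 2)) (ℕ.*-identityʳ c))))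

-- The residues b, 2b, 3b mod 3b exhaust the multiples of b. Writing Euler's product as a triple
-- makes it a theta series (of pentagonal numbers), which `triple-dilate` can handle.
triple-b-2b : ∀ b .{{_ : ℕ.NonZero b}} → triple -1ℤ b (b ℕ.+ b) ≈ poch⁻ b b
triple-b-2b b = ≈-sym (≈-trans (pochε-blocks -1ℤ 3 b b) (⊗-cong (⊗-cong (≈-trans (⊗-identityˡ _) (eq e₀)) (eq e₁)) (eq e₂)))
  where
  c≡ : ∀ b → b ℕ.* 3 ≡ b ℕ.+ (b ℕ.+ b)
  c≡ = ℕ-Solver.solve-∀
  e₀ : b ℕ.+ b ℕ.* 0 ≡ b
  e₀ = trans (cong (b ℕ.+_) (ℕ.*-zeroʳ b)) (ℕ.+-identityʳ b)
  e₁ : b ℕ.+ b ℕ.* 1 ≡ b ℕ.+ b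
  e₁ = cong (b ℕ.+_) (ℕ.*-identityʳ b)
  e₂ : b ℕ.+ b ℕ.* 2 ≡ b ℕ.+ (b ℕ.+ b)
  e₂ = cong (b ℕ.+_) (lem b) where
    lem : ∀ b → b ℕ.* 2 ≡ b ℕ.+ b
    lem = ℕ-Solver.solve-∀
  eq : ∀ {x y} → x ≡ y → poch⁻ x (b ℕ.* 3) ≈ poch⁻ y (b ℕ.+ (b ℕ.+ b))
  eq refl = PSR.reflexive (cong (poch⁻ _) (c≡ b))

quintuple≈product : quintuple ≈ poch⁻ 2 5 ⊗ poch⁻ 3 5 ⊗ poch⁻ 5 5 ⊗ poch⁻ 9 10 ⊗ poch⁻ 1 10
quintuple≈product = ⊗-cancelˡ (poch⁻ 10 10) (pochε-zero -1ℤ 10 10) (begin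
  poch⁻ 10 10 ⊗ quintuple
    ≈⟨ ⊗-cong (triple-b-2b 10) ≈-refl ⟨
  triple -1ℤ 10 20 ⊗ quintuple
    ≈⟨ quintuple-product ⟨
  (poch⁻ 2 5 ⊗ poch⁻ 3 5 ⊗ poch⁻ 5 5) ⊗ (poch⁻ 9 10 ⊗ poch⁻ 1 10 ⊗ poch⁻ 10 10)
    ≈⟨ solve 6 (λ a b c d e f → ((a :* b) :* c) :* ((d :* e) :* f) ⊜ f :* ((((a :* b) :* c) :* d) :* e)) ≈-refl
         (poch⁻ 2 5) (poch⁻ 3 5) (poch⁻ 5 5) (poch⁻ 9 10) (poch⁻ 1 10) (poch⁻ 10 10) ⟩
  poch⁻ 10 10 ⊗ (poch⁻ 2 5 ⊗ poch⁻ 3 5 ⊗ poch⁻ 5 5 ⊗ poch⁻ 9 10 ⊗ poch⁻ 1 10) ∎)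
  where open ≈-Reasoning

quintuple-triple : quintuple ⊗ triple -1ℤ 4 8 ≈ triple -1ℤ 1 3 ⊗ triple -1ℤ 2 8
quintuple-triple = begin
  quintuple ⊗ triple -1ℤ 4 8
    ≈⟨ ⊗-cong quintuple≈product (triple-b-2b 4) ⟩
  poch⁻ 2 5 ⊗ poch⁻ 3 5 ⊗ poch⁻ 5 5 ⊗ poch⁻ 9 10 ⊗ poch⁻ 1 10 ⊗ poch⁻ 4 4
    ≈⟨ ⊗-cong (⊗-cong (⊗-cong (⊗-cong (⊗-cong (blocks₂ 2 5) (blocks₂ 3 5)) (blocks₂ 5 5)) ≈-refl) ≈-refl) ≈-refl ⟩
  (poch⁻ 2 10 ⊗ poch⁻ 7 10) ⊗ (poch⁻ 3 10 ⊗ poch⁻ 8 10) ⊗ (poch⁻ 5 10 ⊗ poch⁻ 10 10) ⊗ poch⁻ 9 10 ⊗ poch⁻ 1 10 ⊗ poch⁻ 4 4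
    -- In the common base 10 the residues 1, 3, 5, 7, 9 are gathered into (x;x²)_∞, and 2, 8, 10
    -- into T(2,8). The `:1` is the empty product with which `prod` begins in `pochε-blocks`.
    ≈⟨ solve 9 (λ p1 p2 p3 p5 p7 p8 p9 p10 p4 →
         (((((p2 :* p7) :* (p3 :* p8)) :* (p5 :* p10)) :* p9) :* p1) :* p4 ⊜
         ((((((:1 :* p1) :* p3) :* p5) :* p7) :* p9) :* p4) :* ((p2 :* p8) :* p10)) ≈-refl
         (poch⁻ 1 10) (poch⁻ 2 10) (poch⁻ 3 10) (poch⁻ 5 10) (poch⁻ 7 10) (poch⁻ 8 10) (poch⁻ 9 10) (poch⁻ 10 10) (poch⁻ 4 4) ⟩
  (𝟙 ⊗ poch⁻ 1 10 ⊗ poch⁻ 3 10 ⊗ poch⁻ 5 10 ⊗ poch⁻ 7 10 ⊗ poch⁻ 9 10) ⊗ poch⁻ 4 4 ⊗ triple -1ℤ 2 8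
    ≈⟨ ⊗-cong (⊗-cong (≈-trans (≈-sym (pochε-blocks -1ℤ 5 1 2)) (blocks₂ 1 2)) ≈-refl) ≈-refl ⟩
  (poch⁻ 1 4 ⊗ poch⁻ 3 4) ⊗ poch⁻ 4 4 ⊗ triple -1ℤ 2 8 ∎
  where open ≈-Reasoning

-- By `pochε-double`, (q²,q^14;q^16)_∞ splits into factors with signs ±q and ±q⁷ in base q⁸. Those
-- without a sign change join residues 3 and 5 to form (q;q²)_∞, and (q²;q²)_∞ completes this to
-- (q;q)_∞, in base q⁵ a product over all residues; 2 and 3 cancel the denominator.
rhs-product : rhsSeries ⊗ triple -1ℤ 2 4 ≈ triple 1ℤ 7 1 ⊗ triple -1ℤ 1 4
rhs-product = begin
  rhsSeries ⊗ triple -1ℤ 2 4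
    ≈⟨ ⊗-cong rhs≈ (triple-b-2b 2) ⟩
  poch⁻ 3 8 ⊗ poch⁻ 5 8 ⊗ poch⁻ 8 8 ⊗ poch⁻ 2 16 ⊗ poch⁻ 14 16 ⊗ pochInv 2 5 ⊗ pochInv 3 5 ⊗ poch⁻ 2 2
    ≈⟨ ⊗-cong (⊗-cong (⊗-cong (⊗-cong (⊗-cong ≈-refl (pochε-double 1 8)) (pochε-double 7 8)) ≈-refl) ≈-refl) ≈-refl ⟨
  poch⁻ 3 8 ⊗ poch⁻ 5 8 ⊗ poch⁻ 8 8 ⊗ (poch⁻ 1 8 ⊗ pochε 1ℤ 1 8) ⊗ (poch⁻ 7 8 ⊗ pochε 1ℤ 7 8) ⊗ pochInv 2 5 ⊗ pochInv 3 5 ⊗ poch⁻ 2 2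
    ≈⟨ solve 10 (λ p1 p3 p5 p7 p8 s1 s7 i2 i3 p2 →
         (((((((p3 :* p5) :* p8) :* (p1 :* s1)) :* (p7 :* s7)) :* i2) :* i3) :* p2) ⊜
         (((((:1 :* p1) :* p3) :* p5) :* p7) :* p2) :* ((((s7 :* s1) :* p8) :* i2) :* i3)) ≈-refl
         (poch⁻ 1 8) (poch⁻ 3 8) (poch⁻ 5 8) (poch⁻ 7 8) (poch⁻ 8 8) (pochε 1ℤ 1 8) (pochε 1ℤ 7 8) (pochInv 2 5) (pochInv 3 5) (poch⁻ 2 2) ⟩
  (𝟙 ⊗ poch⁻ 1 8 ⊗ poch⁻ 3 8 ⊗ poch⁻ 5 8 ⊗ poch⁻ 7 8) ⊗ poch⁻ 2 2 ⊗ (triple 1ℤ 7 1 ⊗ pochInv 2 5 ⊗ pochInv 3 5)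
    ≈⟨ ⊗-cong (≈-trans (⊗-cong (≈-sym (pochε-blocks -1ℤ 4 1 2)) ≈-refl)
         (≈-trans (≈-sym (blocks₂ 1 1)) (pochε-blocks -1ℤ 5 1 1))) ≈-refl ⟩
  (𝟙 ⊗ poch⁻ 1 5 ⊗ poch⁻ 2 5 ⊗ poch⁻ 3 5 ⊗ poch⁻ 4 5 ⊗ poch⁻ 5 5) ⊗ (triple 1ℤ 7 1 ⊗ pochInv 2 5 ⊗ pochInv 3 5)
    ≈⟨ solve 8 (λ p1 p2 p3 p4 p5 t i2 i3 →
         (((((:1 :* p1) :* p2) :* p3) :* p4) :* p5) :* ((t :* i2) :* i3) ⊜
         (t :* ((p1 :* p4) :* p5)) :* ((p2 :* i2) :* (p3 :* i3))) ≈-refl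
         (poch⁻ 1 5) (poch⁻ 2 5) (poch⁻ 3 5) (poch⁻ 4 5) (poch⁻ 5 5) (triple 1ℤ 7 1) (pochInv 2 5) (pochInv 3 5) ⟩
  triple 1ℤ 7 1 ⊗ triple -1ℤ 1 4 ⊗ ((poch⁻ 2 5 ⊗ pochInv 2 5) ⊗ (poch⁻ 3 5 ⊗ pochInv 3 5))
    ≈⟨ ⊗-cong ≈-refl (≈-trans (⊗-cong (pochε⊗pochInv 2 5) (pochε⊗pochInv 3 5)) (⊗-identityˡ 𝟙)) ⟩
  triple 1ℤ 7 1 ⊗ triple -1ℤ 1 4 ⊗ 𝟙
    ≈⟨ PSR.*-identityʳ _ ⟩
  triple 1ℤ 7 1 ⊗ triple -1ℤ 1 4 ∎
  where
  open ≈-Reasoning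
  step : ∀ {f f′ g g′} → f ≈ f′ → g ≈ g′ → f ⊛ g ≈ f′ ⊗ g′
  step {f} {f′} {g} {g′} q r = ≈-trans (≈-sym (⊗≈⊛ f g)) (⊗-cong q r)
  rhs≈ : rhsSeries ≈ poch⁻ 3 8 ⊗ poch⁻ 5 8 ⊗ poch⁻ 8 8 ⊗ poch⁻ 2 16 ⊗ poch⁻ 14 16 ⊗ pochInv 2 5 ⊗ pochInv 3 5
  rhs≈ = step (step (step (step (step (step (poch≈pochε 3 8) (poch≈pochε 5 8)) (poch≈pochε 8 8)) (poch≈pochε 2 16))
    (poch≈pochε 14 16)) ≈-refl) ≈-refl

-- Dilation of triple products and the odd part of T(1,3)

2*θ : ∀ a b j → 2 ℕ.* θ a b j ≡ θ (2 ℕ.* a) (2 ℕ.* b) j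
2*θ a b = λ { (+ n) → lemma a b (tri n) (tri (n ∸ 1)) ; -[1+ n ] → lemma a b (tri n) (tri (suc n)) }
  where
  lemma : ∀ a b x y → 2 ℕ.* (a ℕ.* x ℕ.+ b ℕ.* y) ≡ 2 ℕ.* a ℕ.* x ℕ.+ 2 ℕ.* b ℕ.* y
  lemma = ℕ-Solver.solve-∀

GF-cong : {I : Set} {e e′ : I → ℕ} {σ σ′ : I → ℤ} {S : PS} → (∀ i → e i ≡ e′ i) → (∀ i → σ i ≡ σ′ i) → GF e σ S → GF e′ σ′ S
GF-cong = GF-reindex (λ i → i) (λ i → i) (λ _ → refl) (λ _ → refl)

-- On the theta side dilation only doubles exponents, so the infinite products need not be touched.
triple-dilate : ∀ a b .{{_ : ℕ.NonZero a}} .{{_ : ℕ.NonZero b}} → triple -1ℤ (2 ℕ.* a) (2 ℕ.* b) ≈ dilate (triple -1ℤ a b)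
triple-dilate a@(suc _) b@(suc _) = GF-unique _ _ (jacobi-triple -1ℤ refl (2 ℕ.* a) (2 ℕ.* b))
  (GF-cong (2*θ a b) (λ _ → refl) (GF-dilate (jacobi-triple -1ℤ refl a b)))

2*x≢1 : ∀ x → + 2 ℤ.* x ≢ 1ℤ
2*x≢1 x eq = go ∣ x ∣ (trans (sym (ℤ.abs-* (+ 2) x)) (cong ∣_∣ eq)) where
  go : ∀ n → 2 ℕ.* n ≢ 1
  go (suc n) h with () ← trans (sym (cong suc (ℕ.+-suc n (n ℕ.+ 0)))) h

pow-one : ∀ j → pow 1ℤ j ≡ 1ℤ
pow-one j = ℤ.^-zeroˡ ∣ j ∣

-- The exponent 2j² - j is odd just for odd j = 2t + 1, where it equals 1 + 2(4t² + 3t); all these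
-- terms have sign -1.
odd-triple : odd (triple -1ℤ 1 3) ≈ ⊖ triple 1ℤ 7 1
odd-triple = GF-unique _ _
  (GF-odd (θ 1 3) (pow -1ℤ) ι (θ 7 1) (λ _ → -1ℤ) classify ι-injective e-ι σ-ι (jacobi-triple -1ℤ refl 1 3))
  (GF-cong (λ _ → refl) (λ j → cong ℤ.-_ (pow-one j)) (GF-⊖ (jacobi-triple 1ℤ refl 7 1)))
  where
  open ≡-Reasoning
  ι : ℤ → ℤ
  ι t = + 1 ℤ.+ t ℤ.* + 2
  ι-injective : ∀ {i j} → ι i ≡ ι j → i ≡ j
  ι-injective q = proj₂ (divMod-unique 2 (s≤s (s≤s z≤n)) (s≤s (s≤s z≤n)) q)
  e-ι : ∀ j → θ 1 3 (ι j) ≡ suc (2 ℕ.* θ 7 1 j)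
  e-ι j = 2*-injective (begin
    + 2 ℤ.* + θ 1 3 (ι j)                           ≡⟨ θ-spec 1 3 (ι j) ⟩
    _                                               ≡⟨ poly j ⟩
    + 2 ℤ.+ + 2 ℤ.* ((+ 7 ℤ.+ + 1) ℤ.* (j ℤ.* j) ℤ.+ (+ 7 ℤ.- + 1) ℤ.* j) ≡⟨ cong (λ x → + 2 ℤ.+ + 2 ℤ.* x) (θ-spec 7 1 j) ⟨
    + 2 ℤ.+ + 2 ℤ.* (+ 2 ℤ.* + θ 7 1 j)             ≡⟨ cong (λ x → + 2 ℤ.+ + 2 ℤ.* x) (ℤ.pos-* 2 (θ 7 1 j)) ⟨
    + 2 ℤ.+ + 2 ℤ.* + (2 ℕ.* θ 7 1 j)               ≡⟨ 2*-+ 1 (2 ℕ.* θ 7 1 j) ⟨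
    + 2 ℤ.* + suc (2 ℕ.* θ 7 1 j)                   ∎)
    where
    poly : ∀ j → (+ 1 ℤ.+ + 3) ℤ.* ((+ 1 ℤ.+ j ℤ.* + 2) ℤ.* (+ 1 ℤ.+ j ℤ.* + 2)) ℤ.+ (+ 1 ℤ.- + 3) ℤ.* (+ 1 ℤ.+ j ℤ.* + 2)
      ≡ + 2 ℤ.+ + 2 ℤ.* ((+ 7 ℤ.+ + 1) ℤ.* (j ℤ.* j) ℤ.+ (+ 7 ℤ.- + 1) ℤ.* j)
    poly = solve-∀
  σ-ι : ∀ j → pow -1ℤ (ι j) ≡ -1ℤ
  σ-ι j = begin
    pow -1ℤ (+ 1 ℤ.+ j ℤ.* + 2)        ≡⟨ pow-suc -1ℤ refl (j ℤ.* + 2) ⟩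
    -1ℤ ℤ.* pow -1ℤ (j ℤ.* + 2)        ≡⟨ cong (λ k → -1ℤ ℤ.* pow -1ℤ k) (lemma j) ⟩
    -1ℤ ℤ.* pow -1ℤ (j ℤ.+ j)          ≡⟨ cong (-1ℤ ℤ.*_) (pow-double j) ⟩
    -1ℤ                                ∎
    where
    lemma : ∀ j → j ℤ.* + 2 ≡ j ℤ.+ j
    lemma = solve-∀
  even : ∀ t n → θ 1 3 (+ 0 ℤ.+ t ℤ.* + 2) ≢ suc (2 ℕ.* n)
  even t n q = 2*x≢1 (+ 4 ℤ.* (t ℤ.* t) ℤ.- t ℤ.- + n) (ℤ.*-cancelˡ-≡ (+ 2) _ _ (begin
    + 2 ℤ.* (+ 2 ℤ.* (+ 4 ℤ.* (t ℤ.* t) ℤ.- t ℤ.- + n))              ≡⟨ poly t (+ n) ⟩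
    ((+ 1 ℤ.+ + 3) ℤ.* ((+ 0 ℤ.+ t ℤ.* + 2) ℤ.* (+ 0 ℤ.+ t ℤ.* + 2)) ℤ.+ (+ 1 ℤ.- + 3) ℤ.* (+ 0 ℤ.+ t ℤ.* + 2)) ℤ.- + 4 ℤ.* + n
                                                                     ≡⟨ cong (ℤ._- + 4 ℤ.* + n) (θ-spec 1 3 (+ 0 ℤ.+ t ℤ.* + 2)) ⟨
    + 2 ℤ.* + θ 1 3 (+ 0 ℤ.+ t ℤ.* + 2) ℤ.- + 4 ℤ.* + n              ≡⟨ cong (λ x → + 2 ℤ.* + x ℤ.- + 4 ℤ.* + n) q ⟩
    + 2 ℤ.* (+ 1 ℤ.+ + (2 ℕ.* n)) ℤ.- + 4 ℤ.* + n                    ≡⟨ cong (λ x → + 2 ℤ.* (+ 1 ℤ.+ x) ℤ.- + 4 ℤ.* + n) (ℤ.pos-* 2 n) ⟩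
    + 2 ℤ.* (+ 1 ℤ.+ + 2 ℤ.* + n) ℤ.- + 4 ℤ.* + n                    ≡⟨ poly′ (+ n) ⟩
    + 2 ℤ.* 1ℤ                                                       ∎))
    where
    poly : ∀ t n → + 2 ℤ.* (+ 2 ℤ.* (+ 4 ℤ.* (t ℤ.* t) ℤ.- t ℤ.- n)) ≡
      ((+ 1 ℤ.+ + 3) ℤ.* ((+ 0 ℤ.+ t ℤ.* + 2) ℤ.* (+ 0 ℤ.+ t ℤ.* + 2)) ℤ.+ (+ 1 ℤ.- + 3) ℤ.* (+ 0 ℤ.+ t ℤ.* + 2)) ℤ.- + 4 ℤ.* n
    poly = solve-∀
    poly′ : ∀ n → + 2 ℤ.* (+ 1 ℤ.+ + 2 ℤ.* n) ℤ.- + 4 ℤ.* n ≡ + 2 ℤ.* 1ℤ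
    poly′ = solve-∀
  classify : ∀ k → (∀ n → θ 1 3 k ≢ suc (2 ℕ.* n)) ⊎ (∃[ j ] ι j ≡ k)
  classify k = subst (λ k → (∀ n → θ 1 3 k ≢ suc (2 ℕ.* n)) ⊎ (∃[ j ] ι j ≡ k)) (sym (a≡a%ℕn+[a/ℕn]*n k 2)) (go (k %ℕ 2) (k /ℕ 2) (n%ℕd<d k 2))
    where
    go : ∀ r t → r < 2 → (∀ n → θ 1 3 (+ r ℤ.+ t ℤ.* + 2) ≢ suc (2 ℕ.* n)) ⊎ (∃[ j ] ι j ≡ + r ℤ.+ t ℤ.* + 2)
    go 0 t _ = inj₁ (even t)
    go 1 t _ = inj₂ (t , refl)
    go (suc (suc _)) t (s≤s (s≤s ()))

-- The numbers m with 240 m + 169 a square, in increasing order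

-- The natural numbers k with k² ≡ 169 mod 240. Since (k + 120)² ≡ k² mod 240 they repeat with
-- period 120, and the eight listed values are those below 120.
root : ℕ → ℕ
root 0 = 13
root 1 = 37
root 2 = 43
root 3 = 53
root 4 = 67
root 5 = 77
root 6 = 83
root 7 = 107
root (suc (suc (suc (suc (suc (suc (suc (suc n)))))))) = 120 ℕ.+ root n

-- The number (root n² - 169)/240; the recursion uses ((120 + r)² - r²)/240 = 60 + r.
expo : ℕ → ℕ
expo 0 = 0
expo 1 = 5
expo 2 = 7
expo 3 = 11
expo 4 = 18
expo 5 = 24
expo 6 = 28
expo 7 = 47
expo (suc (suc (suc (suc (suc (suc (suc (suc n)))))))) = 60 ℕ.+ root n ℕ.+ expo n

expo-spec : ∀ n → root n ℕ.* root n ≡ 240 ℕ.* expo n ℕ.+ 169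
expo-spec 0 = refl
expo-spec 1 = refl
expo-spec 2 = refl
expo-spec 3 = refl
expo-spec 4 = refl
expo-spec 5 = refl
expo-spec 6 = refl
expo-spec 7 = refl
expo-spec (suc (suc (suc (suc (suc (suc (suc (suc n)))))))) = step 60 (root n) (expo n) 169 (expo-spec n)
  where
  step : ∀ h r e s → r ℕ.* r ≡ 4 ℕ.* h ℕ.* e ℕ.+ s → (2 ℕ.* h ℕ.+ r) ℕ.* (2 ℕ.* h ℕ.+ r) ≡ 4 ℕ.* h ℕ.* (h ℕ.+ r ℕ.+ e) ℕ.+ s
  step h r e s p = trans (poly h r) (trans (cong (4 ℕ.* h ℕ.* (h ℕ.+ r) ℕ.+_) p) (poly′ h r e s))
    where
    poly : ∀ h r → (2 ℕ.* h ℕ.+ r) ℕ.* (2 ℕ.* h ℕ.+ r) ≡ 4 ℕ.* h ℕ.* (h ℕ.+ r) ℕ.+ r ℕ.* r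
    poly = ℕ-Solver.solve-∀
    poly′ : ∀ h r e s → 4 ℕ.* h ℕ.* (h ℕ.+ r) ℕ.+ (4 ℕ.* h ℕ.* e ℕ.+ s) ≡ 4 ℕ.* h ℕ.* (h ℕ.+ r ℕ.+ e) ℕ.+ s
    poly′ = ℕ-Solver.solve-∀

StrictlyIncreasing : (ℕ → ℕ) → Set
StrictlyIncreasing a = ∀ m n → m < n → a m < a n

strictlyIncreasing : ∀ {a} → (∀ n → a n < a (suc n)) → StrictlyIncreasing a
strictlyIncreasing {a} h m (suc n) (s≤s m≤n) with ℕ.m≤n⇒m<n∨m≡n m≤n
... | inj₁ m<n    = ℕ.<-trans (strictlyIncreasing h m n m<n) (h n)
... | inj₂ refl = h n

root-< : ∀ n → root n < root (suc n)
root-< 0 = toWitness {a? = _ ℕ.<? _} _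
root-< 1 = toWitness {a? = _ ℕ.<? _} _
root-< 2 = toWitness {a? = _ ℕ.<? _} _
root-< 3 = toWitness {a? = _ ℕ.<? _} _
root-< 4 = toWitness {a? = _ ℕ.<? _} _
root-< 5 = toWitness {a? = _ ℕ.<? _} _
root-< 6 = toWitness {a? = _ ℕ.<? _} _
root-< 7 = toWitness {a? = _ ℕ.<? _} _
root-< (suc (suc (suc (suc (suc (suc (suc (suc n)))))))) = ℕ.+-monoʳ-< 120 (root-< n)

expo-increasing : StrictlyIncreasing expo
expo-increasing = strictlyIncreasing λ n → cancel 240 169 (expo n) (expo (suc n))
  (subst₂ _<_ (expo-spec n) (expo-spec (suc n)) (ℕ.*-mono-< (root-< n) (root-< n)))
  where
  cancel : ∀ k s x y → k ℕ.* x ℕ.+ s < k ℕ.* y ℕ.+ s → x < y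
  cancel k s x y h = ℕ.*-cancelˡ-< k x y (ℕ.+-cancelʳ-< s (k ℕ.* x) (k ℕ.* y) h)

increasing-injective : ∀ {a} → StrictlyIncreasing a → ∀ {m n} → a m ≡ a n → m ≡ n
increasing-injective {a} inc {m} {n} eq = ℕ.≤-antisym
  (ℕ.≮⇒≥ λ n<m → ℕ.<⇒≢ (inc n m n<m) (sym eq)) (ℕ.≮⇒≥ λ m<n → ℕ.<⇒≢ (inc m n m<n) eq)

increasing-mono : ∀ {a} → StrictlyIncreasing a → ∀ {m n} → m ≤ n → a m ≤ a n
increasing-mono inc {m} {n} m≤n with ℕ.m≤n⇒m<n∨m≡n m≤n
... | inj₁ m<n    = ℕ.<⇒≤ (inc m n m<n)
... | inj₂ refl = ℕ.≤-refl

increasing-≥ : ∀ {a} → StrictlyIncreasing a → ∀ n → n ≤ a n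
increasing-≥ inc zero    = z≤n
increasing-≥ inc (suc n) = ℕ.≤-<-trans (increasing-≥ inc n) (inc n (suc n) ℕ.≤-refl)

-- Writing b n = a (f n), the function f is strictly increasing, so f n ≥ n and a n ≤ a (f n).
enumeration-≤ : ∀ {a b} → StrictlyIncreasing a → StrictlyIncreasing b → (∀ n → ∃[ k ] a k ≡ b n) → ∀ n → a n ≤ b n
enumeration-≤ {a} {b} inca incb h n = ℕ.≤-trans (increasing-mono inca (increasing-≥ (strictlyIncreasing f-<) n)) (ℕ.≤-reflexive (proj₂ (h n)))
  where
  f : ℕ → ℕ
  f n = proj₁ (h n)
  f-< : ∀ n → f n < f (suc n)
  f-< n = ℕ.≰⇒> λ f≥ → ℕ.<⇒≱ (incb n (suc n) ℕ.≤-refl)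
    (ℕ.≤-trans (ℕ.≤-reflexive (sym (proj₂ (h (suc n))))) (ℕ.≤-trans (increasing-mono inca f≥) (ℕ.≤-reflexive (proj₂ (h n)))))

root-shift : ∀ t r → root (t ℕ.* 8 ℕ.+ r) ≡ t ℕ.* 120 ℕ.+ root r
root-shift zero    r = refl
root-shift (suc t) r = trans (cong (120 ℕ.+_) (root-shift t r)) (sym (ℕ.+-assoc 120 (t ℕ.* 120) (root r)))

-- Decided by running through all ρ below 120.
residues : ∀ {ρ} → ρ < 120 → ρ ℕ.* ρ % 240 ≡ 169 → ∃[ r ] (r < 8 × root r ≡ ρ)
residues = toWitness {a? = ℕ.allUpTo? (λ ρ → (ρ ℕ.* ρ % 240 ℕ.≟ 169) →-dec ℕ.anyUpTo? (λ r → root r ℕ.≟ ρ) 8) 120} _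

-- (ρ + 2ht)² = ρ² + 4h(tρ + ht²), so k mod 2h determines k² mod 4h. It is applied with h = 60.
square-% : ∀ h k .{{_ : ℕ.NonZero (2 ℕ.* h)}} .{{_ : ℕ.NonZero (4 ℕ.* h)}} →
  (k % (2 ℕ.* h)) ℕ.* (k % (2 ℕ.* h)) % (4 ℕ.* h) ≡ k ℕ.* k % (4 ℕ.* h)
square-% h k = begin
  ρ ℕ.* ρ % (4 ℕ.* h)                                                          ≡⟨ ℕ.[m+kn]%n≡m%n (ρ ℕ.* ρ) (t ℕ.* ρ ℕ.+ h ℕ.* (t ℕ.* t)) (4 ℕ.* h) ⟨
  (ρ ℕ.* ρ ℕ.+ (t ℕ.* ρ ℕ.+ h ℕ.* (t ℕ.* t)) ℕ.* (4 ℕ.* h)) % (4 ℕ.* h)        ≡⟨ cong (_% (4 ℕ.* h)) (poly h ρ t) ⟨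
  (ρ ℕ.+ t ℕ.* (2 ℕ.* h)) ℕ.* (ρ ℕ.+ t ℕ.* (2 ℕ.* h)) % (4 ℕ.* h)              ≡⟨ cong (λ x → x ℕ.* x % (4 ℕ.* h)) (ℕ.m≡m%n+[m/n]*n k (2 ℕ.* h)) ⟨
  k ℕ.* k % (4 ℕ.* h)                                                          ∎
  where
  open ≡-Reasoning
  ρ = k % (2 ℕ.* h)
  t = k / (2 ℕ.* h)
  poly : ∀ h ρ t → (ρ ℕ.+ t ℕ.* (2 ℕ.* h)) ℕ.* (ρ ℕ.+ t ℕ.* (2 ℕ.* h)) ≡ ρ ℕ.* ρ ℕ.+ (t ℕ.* ρ ℕ.+ h ℕ.* (t ℕ.* t)) ℕ.* (4 ℕ.* h)
  poly = ℕ-Solver.solve-∀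

[n*m+r]%n : ∀ n m r .{{_ : ℕ.NonZero n}} → (n ℕ.* m ℕ.+ r) % n ≡ r % n
[n*m+r]%n n m r = trans (cong (_% n) (trans (ℕ.+-comm (n ℕ.* m) r) (cong (r ℕ.+_) (ℕ.*-comm n m)))) (ℕ.[m+kn]%n≡m%n r m n)

root-surjective : ∀ m k → k ℕ.* k ≡ 240 ℕ.* m ℕ.+ 169 → ∃[ n ] root n ≡ k
root-surjective m k eq = let (r , _ , q) = residues (ℕ.m%n<n k 120) ρ²%240≡169 in
  k / 120 ℕ.* 8 ℕ.+ r , trans (root-shift (k / 120) r) (divide 120 k (root r) q)
  where
  ρ²%240≡169 : (k % 120) ℕ.* (k % 120) % 240 ≡ 169
  ρ²%240≡169 = trans (square-% 60 k) (trans (cong (_% 240) eq) ([n*m+r]%n 240 m 169))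
  divide : ∀ d k r .{{_ : ℕ.NonZero d}} → r ≡ k % d → k / d ℕ.* d ℕ.+ r ≡ k
  divide d k r q = trans (ℕ.+-comm (k / d ℕ.* d) r) (trans (cong (ℕ._+ k / d ℕ.* d) q) (sym (ℕ.m≡m%n+[m/n]*n k d)))

expo-surjective : ∀ m k → k ℕ.* k ≡ 240 ℕ.* m ℕ.+ 169 → ∃[ n ] expo n ≡ m
expo-surjective m k eq = let (n , q) = root-surjective m k eq in
  n , cancel 240 169 (expo n) m (trans (sym (expo-spec n)) (trans (cong₂ ℕ._*_ q q) eq))
  where
  cancel : ∀ k .{{_ : ℕ.NonZero k}} s x y → k ℕ.* x ℕ.+ s ≡ k ℕ.* y ℕ.+ s → x ≡ y
  cancel k s x y h = ℕ.*-cancelˡ-≡ x y k (ℕ.+-cancelʳ-≡ s (k ℕ.* x) (k ℕ.* y) h)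

-- A strictly increasing sequence is determined by its set of values: `enumeration-≤` applies in
-- both directions.
enumeration-expo : ∀ a → StrictlyIncreasing a → (∀ m → (∃[ n ] a n ≡ m) ⇔ (∃[ k ] k ℕ.* k ≡ 240 ℕ.* m ℕ.+ 169)) → ∀ n → a n ≡ expo n
enumeration-expo a inc squares n = ℕ.≤-antisym
  (enumeration-≤ inc expo-increasing (λ n → Equivalence.from (squares (expo n)) (root n , expo-spec n)) n)
  (enumeration-≤ expo-increasing inc (λ n → let (k , eq) = Equivalence.to (squares (a n)) (n , refl) in expo-surjective (a n) k eq) n)

-- The odd exponents of the quintuple series

W : Q-index → ℤ
W = [ (λ l → + 30 ℤ.* l ℤ.+ + 7) , (λ l → + 30 ℤ.* l ℤ.- + 13) ]

W-spec : ∀ k → + 120 ℤ.* + eQ k ℤ.+ + 49 ≡ W k ℤ.* W k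
W-spec (inj₁ l) = begin
  + 120 ℤ.* + θ 11 4 l ℤ.+ + 49                                                      ≡⟨ split (+ θ 11 4 l) ⟩
  + 60 ℤ.* (+ 2 ℤ.* + θ 11 4 l) ℤ.+ + 49                                             ≡⟨ cong (λ x → + 60 ℤ.* x ℤ.+ + 49) (θ-spec 11 4 l) ⟩
  + 60 ℤ.* ((+ 11 ℤ.+ + 4) ℤ.* (l ℤ.* l) ℤ.+ (+ 11 ℤ.- + 4) ℤ.* l) ℤ.+ + 49          ≡⟨ poly l ⟩
  (+ 30 ℤ.* l ℤ.+ + 7) ℤ.* (+ 30 ℤ.* l ℤ.+ + 7)                                      ∎
  where
  open ≡-Reasoning
  split : ∀ x → + 120 ℤ.* x ℤ.+ + 49 ≡ + 60 ℤ.* (+ 2 ℤ.* x) ℤ.+ + 49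
  split = solve-∀
  poly : ∀ l → + 60 ℤ.* ((+ 11 ℤ.+ + 4) ℤ.* (l ℤ.* l) ℤ.+ (+ 11 ℤ.- + 4) ℤ.* l) ℤ.+ + 49 ≡ (+ 30 ℤ.* l ℤ.+ + 7) ℤ.* (+ 30 ℤ.* l ℤ.+ + 7)
  poly = solve-∀
W-spec (inj₂ l) = begin
  + 120 ℤ.* (1ℤ ℤ.+ + θ 1 14 l) ℤ.+ + 49                                             ≡⟨ split (+ θ 1 14 l) ⟩
  + 60 ℤ.* (+ 2 ℤ.* + θ 1 14 l) ℤ.+ + 169                                            ≡⟨ cong (λ x → + 60 ℤ.* x ℤ.+ + 169) (θ-spec 1 14 l) ⟩
  + 60 ℤ.* ((+ 1 ℤ.+ + 14) ℤ.* (l ℤ.* l) ℤ.+ (+ 1 ℤ.- + 14) ℤ.* l) ℤ.+ + 169         ≡⟨ poly l ⟩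
  (+ 30 ℤ.* l ℤ.- + 13) ℤ.* (+ 30 ℤ.* l ℤ.- + 13)                                    ∎
  where
  open ≡-Reasoning
  split : ∀ x → + 120 ℤ.* (1ℤ ℤ.+ x) ℤ.+ + 49 ≡ + 60 ℤ.* (+ 2 ℤ.* x) ℤ.+ + 169
  split = solve-∀
  poly : ∀ l → + 60 ℤ.* ((+ 1 ℤ.+ + 14) ℤ.* (l ℤ.* l) ℤ.+ (+ 1 ℤ.- + 14) ℤ.* l) ℤ.+ + 169 ≡ (+ 30 ℤ.* l ℤ.- + 13) ℤ.* (+ 30 ℤ.* l ℤ.- + 13)
  poly = solve-∀

-- locate t n is the index k with W k = ± (120 t + root n); here root (8 t + r) = 120 t + root r.
locate : ℕ → ℕ → Q-index
locate t 0 = inj₂ (ℤ.- (+ 4 ℤ.* + t))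
locate t 1 = inj₁ (+ 4 ℤ.* + t ℤ.+ + 1)
locate t 2 = inj₂ (ℤ.- (+ 4 ℤ.* + t ℤ.+ + 1))
locate t 3 = inj₁ (ℤ.- (+ 4 ℤ.* + t ℤ.+ + 2))
locate t 4 = inj₁ (+ 4 ℤ.* + t ℤ.+ + 2)
locate t 5 = inj₂ (+ 4 ℤ.* + t ℤ.+ + 3)
locate t 6 = inj₁ (ℤ.- (+ 4 ℤ.* + t ℤ.+ + 3))
locate t 7 = inj₂ (+ 4 ℤ.* + t ℤ.+ + 4)
locate t (suc (suc (suc (suc (suc (suc (suc (suc n)))))))) = locate (suc t) n

W²-locate : ∀ t n → W (locate t n) ℤ.* W (locate t n) ≡ (+ 120 ℤ.* + t ℤ.+ + root n) ℤ.* (+ 120 ℤ.* + t ℤ.+ + root n)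
W²-locate t 0 = poly (+ t) where
  poly : ∀ t → (+ 30 ℤ.* (ℤ.- (+ 4 ℤ.* t)) ℤ.- + 13) ℤ.* (+ 30 ℤ.* (ℤ.- (+ 4 ℤ.* t)) ℤ.- + 13) ≡ (+ 120 ℤ.* t ℤ.+ + 13) ℤ.* (+ 120 ℤ.* t ℤ.+ + 13)
  poly = solve-∀
W²-locate t 1 = poly (+ t) where
  poly : ∀ t → (+ 30 ℤ.* (+ 4 ℤ.* t ℤ.+ + 1) ℤ.+ + 7) ℤ.* (+ 30 ℤ.* (+ 4 ℤ.* t ℤ.+ + 1) ℤ.+ + 7) ≡ (+ 120 ℤ.* t ℤ.+ + 37) ℤ.* (+ 120 ℤ.* t ℤ.+ + 37)
  poly = solve-∀
W²-locate t 2 = poly (+ t) where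
  poly : ∀ t → (+ 30 ℤ.* (ℤ.- (+ 4 ℤ.* t ℤ.+ + 1)) ℤ.- + 13) ℤ.* (+ 30 ℤ.* (ℤ.- (+ 4 ℤ.* t ℤ.+ + 1)) ℤ.- + 13) ≡ (+ 120 ℤ.* t ℤ.+ + 43) ℤ.* (+ 120 ℤ.* t ℤ.+ + 43)
  poly = solve-∀
W²-locate t 3 = poly (+ t) where
  poly : ∀ t → (+ 30 ℤ.* (ℤ.- (+ 4 ℤ.* t ℤ.+ + 2)) ℤ.+ + 7) ℤ.* (+ 30 ℤ.* (ℤ.- (+ 4 ℤ.* t ℤ.+ + 2)) ℤ.+ + 7) ≡ (+ 120 ℤ.* t ℤ.+ + 53) ℤ.* (+ 120 ℤ.* t ℤ.+ + 53)
  poly = solve-∀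
W²-locate t 4 = poly (+ t) where
  poly : ∀ t → (+ 30 ℤ.* (+ 4 ℤ.* t ℤ.+ + 2) ℤ.+ + 7) ℤ.* (+ 30 ℤ.* (+ 4 ℤ.* t ℤ.+ + 2) ℤ.+ + 7) ≡ (+ 120 ℤ.* t ℤ.+ + 67) ℤ.* (+ 120 ℤ.* t ℤ.+ + 67)
  poly = solve-∀
W²-locate t 5 = poly (+ t) where
  poly : ∀ t → (+ 30 ℤ.* (+ 4 ℤ.* t ℤ.+ + 3) ℤ.- + 13) ℤ.* (+ 30 ℤ.* (+ 4 ℤ.* t ℤ.+ + 3) ℤ.- + 13) ≡ (+ 120 ℤ.* t ℤ.+ + 77) ℤ.* (+ 120 ℤ.* t ℤ.+ + 77)
  poly = solve-∀
W²-locate t 6 = poly (+ t) where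
  poly : ∀ t → (+ 30 ℤ.* (ℤ.- (+ 4 ℤ.* t ℤ.+ + 3)) ℤ.+ + 7) ℤ.* (+ 30 ℤ.* (ℤ.- (+ 4 ℤ.* t ℤ.+ + 3)) ℤ.+ + 7) ≡ (+ 120 ℤ.* t ℤ.+ + 83) ℤ.* (+ 120 ℤ.* t ℤ.+ + 83)
  poly = solve-∀
W²-locate t 7 = poly (+ t) where
  poly : ∀ t → (+ 30 ℤ.* (+ 4 ℤ.* t ℤ.+ + 4) ℤ.- + 13) ℤ.* (+ 30 ℤ.* (+ 4 ℤ.* t ℤ.+ + 4) ℤ.- + 13) ≡ (+ 120 ℤ.* t ℤ.+ + 107) ℤ.* (+ 120 ℤ.* t ℤ.+ + 107)
  poly = solve-∀
W²-locate t (suc (suc (suc (suc (suc (suc (suc (suc n)))))))) =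
  trans (W²-locate (suc t) n) (cong (λ x → x ℤ.* x) (shift (+ 120) (+ t) (+ root n)))
  where
  shift : ∀ c t r → c ℤ.* (1ℤ ℤ.+ t) ℤ.+ r ≡ c ℤ.* t ℤ.+ (c ℤ.+ r)
  shift = solve-∀

locate-shift : ∀ t s r → locate t (s ℕ.* 8 ℕ.+ r) ≡ locate (s ℕ.+ t) r
locate-shift t zero    r = refl
locate-shift t (suc s) r = trans (locate-shift (suc t) s r) (cong (λ x → locate x r) (ℕ.+-suc s t))

-- Advancing n by 8 adds 10, an even number, to the floor of 5n/4.
sign-shift : ∀ n → sign (8 ℕ.+ n) ≡ sign n
sign-shift n = begin
  -1ℤ ℤ.^ (5 ℕ.* (8 ℕ.+ n) / 4)              ≡⟨ cong (λ x → -1ℤ ℤ.^ (x / 4)) (ℕ.*-distribˡ-+ 5 8 n) ⟩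
  -1ℤ ℤ.^ ((40 ℕ.+ 5 ℕ.* n) / 4)             ≡⟨ cong (-1ℤ ℤ.^_) (ℕ.+-distrib-/-∣ˡ {40} (5 ℕ.* n) {4} (divides-refl 10)) ⟩
  -1ℤ ℤ.^ (10 ℕ.+ 5 ℕ.* n / 4)               ≡⟨ ℤ.^-distribˡ-+-* -1ℤ 10 (5 ℕ.* n / 4) ⟩
  1ℤ ℤ.* -1ℤ ℤ.^ (5 ℕ.* n / 4)               ≡⟨ ℤ.*-identityˡ _ ⟩
  -1ℤ ℤ.^ (5 ℕ.* n / 4)                      ∎
  where open ≡-Reasoning

-- The source of the floor in the sign. Over one period the floors are 0, 1, 2, 3, 5, 6, 7, 8; the
-- signs alternate except between n = 3 and n = 4, where `locate` stays in the same half of the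
-- quintuple series.
σQ-locate : ∀ t n → σQ (locate t n) ≡ ℤ.- sign n
σQ-locate t 0 = refl
σQ-locate t 1 = refl
σQ-locate t 2 = refl
σQ-locate t 3 = refl
σQ-locate t 4 = refl
σQ-locate t 5 = refl
σQ-locate t 6 = refl
σQ-locate t 7 = refl
σQ-locate t (suc (suc (suc (suc (suc (suc (suc (suc n)))))))) = trans (σQ-locate (suc t) n) (cong ℤ.-_ (sym (sign-shift n)))

eQ-locate : ∀ n → eQ (locate 0 n) ≡ suc (2 ℕ.* expo n)
eQ-locate n = ℤ.+-injective (ℤ.*-cancelˡ-≡ (+ 120) (+ eQ (locate 0 n)) (+ suc (2 ℕ.* expo n))
  (ℤ+.∙-cancelʳ (+ 49) (+ 120 ℤ.* + eQ (locate 0 n)) (+ 120 ℤ.* + suc (2 ℕ.* expo n)) (begin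
    + 120 ℤ.* + eQ (locate 0 n) ℤ.+ + 49               ≡⟨ W-spec (locate 0 n) ⟩
    W (locate 0 n) ℤ.* W (locate 0 n)                  ≡⟨ W²-locate 0 n ⟩
    (+ 0 ℤ.+ + root n) ℤ.* (+ 0 ℤ.+ + root n)          ≡⟨ cong₂ ℤ._*_ (ℤ.+-identityˡ (+ root n)) (ℤ.+-identityˡ (+ root n)) ⟩
    + root n ℤ.* + root n                              ≡⟨ ℤ.pos-* (root n) (root n) ⟨
    + (root n ℕ.* root n)                              ≡⟨ cong +_ (expo-spec n) ⟩
    + (240 ℕ.* expo n) ℤ.+ + 169                       ≡⟨ cong (ℤ._+ + 169) (ℤ.pos-* 240 (expo n)) ⟩
    + 240 ℤ.* + expo n ℤ.+ + 169                       ≡⟨ poly (+ expo n) ⟩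
    + 120 ℤ.* (1ℤ ℤ.+ + 2 ℤ.* + expo n) ℤ.+ + 49       ≡⟨ cong (λ x → + 120 ℤ.* (1ℤ ℤ.+ x) ℤ.+ + 49) (ℤ.pos-* 2 (expo n)) ⟨
    + 120 ℤ.* + suc (2 ℕ.* expo n) ℤ.+ + 49            ∎)))
  where
  open ≡-Reasoning
  poly : ∀ x → + 240 ℤ.* x ℤ.+ + 169 ≡ + 120 ℤ.* (1ℤ ℤ.+ + 2 ℤ.* x) ℤ.+ + 49
  poly = solve-∀

locate-injective : ∀ {m n} → locate 0 m ≡ locate 0 n → m ≡ n
locate-injective {m} {n} eq = increasing-injective expo-increasing
  (ℕ.*-cancelˡ-≡ (expo m) (expo n) 2 (ℕ.suc-injective (trans (sym (eQ-locate m)) (trans (cong eQ eq) (eQ-locate n)))))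

NotOdd : Q-index → Set
NotOdd k = ∀ n → eQ k ≢ suc (2 ℕ.* n)

-- From W ≡ ρ mod 120 follows W² ≡ ρ² ≡ 49 mod 240, so 120 `eQ k` is divisible by 240 and the
-- exponent is even. The number γ is the quotient (ρ² - 49)/240.
W⇒NotOdd : ∀ k ρ γ t → W k ≡ + 120 ℤ.* t ℤ.+ ρ → ρ ℤ.* ρ ≡ + 240 ℤ.* γ ℤ.+ + 49 → NotOdd k
W⇒NotOdd k ρ γ t Wk ρ² n eq = 2*x≢1 x (ℤ.*-cancelˡ-≡ (+ 120) (+ 2 ℤ.* x) 1ℤ
  (ℤ+.∙-cancelʳ (+ 240 ℤ.* + n ℤ.+ + 49) (+ 120 ℤ.* (+ 2 ℤ.* x)) (+ 120 ℤ.* 1ℤ) (begin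
    + 120 ℤ.* (+ 2 ℤ.* x) ℤ.+ (+ 240 ℤ.* + n ℤ.+ + 49)        ≡⟨ poly t ρ γ (+ n) ⟩
    + 14400 ℤ.* (t ℤ.* t) ℤ.+ + 240 ℤ.* (t ℤ.* ρ) ℤ.+ (+ 240 ℤ.* γ ℤ.+ + 49) ≡⟨ cong (λ y → + 14400 ℤ.* (t ℤ.* t) ℤ.+ + 240 ℤ.* (t ℤ.* ρ) ℤ.+ y) ρ² ⟨
    + 14400 ℤ.* (t ℤ.* t) ℤ.+ + 240 ℤ.* (t ℤ.* ρ) ℤ.+ ρ ℤ.* ρ  ≡⟨ poly₁ t ρ ⟩
    (+ 120 ℤ.* t ℤ.+ ρ) ℤ.* (+ 120 ℤ.* t ℤ.+ ρ)               ≡⟨ cong₂ ℤ._*_ Wk Wk ⟨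
    W k ℤ.* W k                                               ≡⟨ W-spec k ⟨
    + 120 ℤ.* + eQ k ℤ.+ + 49                                 ≡⟨ cong (λ y → + 120 ℤ.* + y ℤ.+ + 49) eq ⟩
    + 120 ℤ.* (1ℤ ℤ.+ + (2 ℕ.* n)) ℤ.+ + 49                   ≡⟨ cong (λ y → + 120 ℤ.* (1ℤ ℤ.+ y) ℤ.+ + 49) (ℤ.pos-* 2 n) ⟩
    + 120 ℤ.* (1ℤ ℤ.+ + 2 ℤ.* + n) ℤ.+ + 49                   ≡⟨ poly₂ (+ n) ⟩
    + 120 ℤ.* 1ℤ ℤ.+ (+ 240 ℤ.* + n ℤ.+ + 49)                 ∎)))
  where
  open ≡-Reasoning
  x = + 60 ℤ.* (t ℤ.* t) ℤ.+ t ℤ.* ρ ℤ.+ γ ℤ.- + n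
  poly : ∀ t ρ γ n → + 120 ℤ.* (+ 2 ℤ.* (+ 60 ℤ.* (t ℤ.* t) ℤ.+ t ℤ.* ρ ℤ.+ γ ℤ.- n)) ℤ.+ (+ 240 ℤ.* n ℤ.+ + 49)
    ≡ + 14400 ℤ.* (t ℤ.* t) ℤ.+ + 240 ℤ.* (t ℤ.* ρ) ℤ.+ (+ 240 ℤ.* γ ℤ.+ + 49)
  poly = solve-∀
  poly₁ : ∀ t ρ → + 14400 ℤ.* (t ℤ.* t) ℤ.+ + 240 ℤ.* (t ℤ.* ρ) ℤ.+ ρ ℤ.* ρ ≡ (+ 120 ℤ.* t ℤ.+ ρ) ℤ.* (+ 120 ℤ.* t ℤ.+ ρ)
  poly₁ = solve-∀
  poly₂ : ∀ n → + 120 ℤ.* (1ℤ ℤ.+ + 2 ℤ.* n) ℤ.+ + 49 ≡ + 120 ℤ.* 1ℤ ℤ.+ (+ 240 ℤ.* n ℤ.+ + 49)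
  poly₂ = solve-∀

Classified : Q-index → Set
Classified k = NotOdd k ⊎ (∃[ n ] locate 0 n ≡ k)

located : ∀ {k} s r → locate s r ≡ k → Classified k
located s r eq = inj₂ (s ℕ.* 8 ℕ.+ r , trans (locate-shift 0 s r) (trans (cong (λ x → locate x r) (ℕ.+-identityʳ s)) eq))

-- Mod 120, 30l + 7 is 7, 37, 67 or 97 according to l mod 4. The squares of 7 and 97 are 49 mod 240;
-- those of 37 and 67 are 169, and there the sign of W, which is that of the quotient, selects one
-- of two roots.
classify₁ : ∀ r t → r < 4 → Classified (inj₁ (+ r ℤ.+ t ℤ.* + 4))
classify₁ 0 t _ = inj₁ (W⇒NotOdd (inj₁ (+ 0 ℤ.+ t ℤ.* + 4)) (+ 7) (+ 0) t (lin t) refl) where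
  lin : ∀ t → + 30 ℤ.* (+ 0 ℤ.+ t ℤ.* + 4) ℤ.+ + 7 ≡ + 120 ℤ.* t ℤ.+ + 7
  lin = solve-∀
classify₁ 1 (+ s) _ = located s 1 (cong inj₁ (lin (+ s))) where
  lin : ∀ s → + 4 ℤ.* s ℤ.+ + 1 ≡ + 1 ℤ.+ s ℤ.* + 4
  lin = solve-∀
classify₁ 1 -[1+ s ] _ = located s 6 (cong inj₁ (lin (+ s))) where
  lin : ∀ s → ℤ.- (+ 4 ℤ.* s ℤ.+ + 3) ≡ + 1 ℤ.+ (ℤ.- (1ℤ ℤ.+ s)) ℤ.* + 4
  lin = solve-∀
classify₁ 2 (+ s) _ = located s 4 (cong inj₁ (lin (+ s))) where
  lin : ∀ s → + 4 ℤ.* s ℤ.+ + 2 ≡ + 2 ℤ.+ s ℤ.* + 4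
  lin = solve-∀
classify₁ 2 -[1+ s ] _ = located s 3 (cong inj₁ (lin (+ s))) where
  lin : ∀ s → ℤ.- (+ 4 ℤ.* s ℤ.+ + 2) ≡ + 2 ℤ.+ (ℤ.- (1ℤ ℤ.+ s)) ℤ.* + 4
  lin = solve-∀
classify₁ 3 t _ = inj₁ (W⇒NotOdd (inj₁ (+ 3 ℤ.+ t ℤ.* + 4)) (+ 97) (+ 39) t (lin t) refl) where
  lin : ∀ t → + 30 ℤ.* (+ 3 ℤ.+ t ℤ.* + 4) ℤ.+ + 7 ≡ + 120 ℤ.* t ℤ.+ + 97
  lin = solve-∀
classify₁ (suc (suc (suc (suc _)))) t (s≤s (s≤s (s≤s (s≤s ()))))

-- Mod 120, 30l - 13 is -13, 17, 47 or 77. The squares of 17 and 47 are 49 mod 240; the other two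
-- classes give the roots.
classify₂ : ∀ r t → r < 4 → Classified (inj₂ (+ r ℤ.+ t ℤ.* + 4))
-- W is -13 at l = 0, so zero belongs with the negative l, under root 13, and not with the positive
-- ones, whose W is positive.
classify₂ 0 (+ 0) _ = located 0 0 refl
classify₂ 0 (+ suc s) _ = located s 7 (cong inj₂ (lin (+ s))) where
  lin : ∀ s → + 4 ℤ.* s ℤ.+ + 4 ≡ + 0 ℤ.+ (1ℤ ℤ.+ s) ℤ.* + 4
  lin = solve-∀
classify₂ 0 -[1+ s ] _ = located (suc s) 0 (cong inj₂ (lin (+ s))) where
  lin : ∀ s → ℤ.- (+ 4 ℤ.* (1ℤ ℤ.+ s)) ≡ + 0 ℤ.+ (ℤ.- (1ℤ ℤ.+ s)) ℤ.* + 4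
  lin = solve-∀
classify₂ 1 t _ = inj₁ (W⇒NotOdd (inj₂ (+ 1 ℤ.+ t ℤ.* + 4)) (+ 17) (+ 1) t (lin t) refl) where
  lin : ∀ t → + 30 ℤ.* (+ 1 ℤ.+ t ℤ.* + 4) ℤ.- + 13 ≡ + 120 ℤ.* t ℤ.+ + 17
  lin = solve-∀
classify₂ 2 t _ = inj₁ (W⇒NotOdd (inj₂ (+ 2 ℤ.+ t ℤ.* + 4)) (+ 47) (+ 9) t (lin t) refl) where
  lin : ∀ t → + 30 ℤ.* (+ 2 ℤ.+ t ℤ.* + 4) ℤ.- + 13 ≡ + 120 ℤ.* t ℤ.+ + 47
  lin = solve-∀
classify₂ 3 (+ s) _ = located s 5 (cong inj₂ (lin (+ s))) where
  lin : ∀ s → + 4 ℤ.* s ℤ.+ + 3 ≡ + 3 ℤ.+ s ℤ.* + 4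
  lin = solve-∀
classify₂ 3 -[1+ s ] _ = located s 2 (cong inj₂ (lin (+ s))) where
  lin : ∀ s → ℤ.- (+ 4 ℤ.* s ℤ.+ + 1) ≡ + 3 ℤ.+ (ℤ.- (1ℤ ℤ.+ s)) ℤ.* + 4
  lin = solve-∀
classify₂ (suc (suc (suc (suc _)))) t (s≤s (s≤s (s≤s (s≤s ()))))

classify : ∀ k → Classified k
classify (inj₁ l) = subst (Classified ∘ inj₁) (sym (a≡a%ℕn+[a/ℕn]*n l 4)) (classify₁ (l %ℕ 4) (l /ℕ 4) (n%ℕd<d l 4))
classify (inj₂ l) = subst (Classified ∘ inj₂) (sym (a≡a%ℕn+[a/ℕn]*n l 4)) (classify₂ (l %ℕ 4) (l /ℕ 4) (n%ℕd<d l 4))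

odd-quintuple-gf : GF expo (λ n → ℤ.- sign n) (odd quintuple)
odd-quintuple-gf = GF-odd eQ σQ (locate 0) expo (λ n → ℤ.- sign n) classify locate-injective eQ-locate (σQ-locate 0) quintuple-gf

-- The left-hand side and the comparison

lhs-gf : ∀ {a} → StrictlyIncreasing a → GF a sign (lhsSeries a)
lhs-gf {a} inc = record
  { cover  = λ N → upTo (suc N)
  ; unique = λ N → Unique.upTo⁺ (suc N)
  ; covers = λ N n h → ∈-upTo⁺ (s≤s (ℕ.≤-trans (increasing-≥ inc n) h))
  ; value  = λ N → trans (sumTo-cong N (λ n _ → ifᵇ≡mono (sign n) (a n) N)) (sym (go N N (λ n → n)))
  }
  where
  F : ℕ → PS
  F n = mono (sign n) (a n)
  go : ∀ N n f → sumL F (applyUpTo f (suc n)) N ≡ sumTo n (λ k → F (f k) N)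
  go N zero    f = at (⊕-identityʳ (F (f 0))) N
  go N (suc n) f = trans (⊕-at (F (f 0)) _ N) (trans (cong (ℤ._+_ (F (f 0) N)) (go N n (f ∘ suc))) (sym (sumTo-head n (λ k → F (f k) N))))

-- Both odd parts carry a minus sign, that of the quintuple series and that of T(1,3); `negate`
-- introduces the first at the start and removes the second at the end.
lhs-product : ∀ {a} → StrictlyIncreasing a → (∀ n → a n ≡ expo n) → lhsSeries a ⊗ triple -1ℤ 2 4 ≈ triple 1ℤ 7 1 ⊗ triple -1ℤ 1 4
lhs-product {a} inc a≡expo = begin
  lhsSeries a ⊗ triple -1ℤ 2 4
    ≈⟨ negate (lhsSeries a) (triple -1ℤ 2 4) ⟩
  ⊖ (⊖ lhsSeries a ⊗ triple -1ℤ 2 4)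
    ≈⟨ ⊖-cong (⊗-cong lhs≈ ≈-refl) ⟩
  ⊖ (odd quintuple ⊗ triple -1ℤ 2 4)
    ≈⟨ ⊖-cong (odd-⊗-dilate quintuple (triple -1ℤ 2 4)) ⟨
  ⊖ odd (quintuple ⊗ dilate (triple -1ℤ 2 4))
    ≈⟨ ⊖-cong (odd-cong (⊗-cong ≈-refl (triple-dilate 2 4))) ⟨
  ⊖ odd (quintuple ⊗ triple -1ℤ 4 8)
    ≈⟨ ⊖-cong (odd-cong quintuple-triple) ⟩
  ⊖ odd (triple -1ℤ 1 3 ⊗ triple -1ℤ 2 8)
    ≈⟨ ⊖-cong (odd-cong (⊗-cong ≈-refl (triple-dilate 1 4))) ⟩
  ⊖ odd (triple -1ℤ 1 3 ⊗ dilate (triple -1ℤ 1 4))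
    ≈⟨ ⊖-cong (odd-⊗-dilate (triple -1ℤ 1 3) (triple -1ℤ 1 4)) ⟩
  ⊖ (odd (triple -1ℤ 1 3) ⊗ triple -1ℤ 1 4)
    ≈⟨ ⊖-cong (⊗-cong odd-triple ≈-refl) ⟩
  ⊖ (⊖ triple 1ℤ 7 1 ⊗ triple -1ℤ 1 4)
    ≈⟨ negate (triple 1ℤ 7 1) (triple -1ℤ 1 4) ⟨
  triple 1ℤ 7 1 ⊗ triple -1ℤ 1 4 ∎
  where
  open ≈-Reasoning
  open PS-Solver using (_:=_; :-_) renaming (_:*_ to _:×_)
  negate : ∀ f g → f ⊗ g ≈ ⊖ (⊖ f ⊗ g)
  negate = PS-Solver.solve 2 (λ f g → f :× g := :- ((:- f) :× g)) ≈-refl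
  lhs≈ : ⊖ lhsSeries a ≈ odd quintuple
  lhs≈ = GF-unique _ _ (GF-cong a≡expo (λ _ → refl) (GF-⊖ (lhs-gf inc))) odd-quintuple-gf

theorem10 : (a : ℕ → ℕ)
    → (∀ m n → m < n → a m < a n)
    → (∀ m → (∃[ n ] a n ≡ m) ⇔ (∃[ k ] k * k ≡ 240 * m + 169))
    → ∀ N → lhsSeries a N ≡ rhsSeries N
theorem10 a inc squares N = at (⊗-cancelˡ (triple -1ℤ 2 4) triple-zero
  (≈-trans (⊗-comm (triple -1ℤ 2 4) (lhsSeries a))
  (≈-trans (lhs-product inc (enumeration-expo a inc squares))
  (≈-trans (≈-sym rhs-product) (⊗-comm rhsSeries (triple -1ℤ 2 4)))))) N
  where
  triple-zero : triple -1ℤ 2 4 0 ≡ 1ℤ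
  triple-zero = trans (at (triple-b-2b 2) 0) (pochε-zero -1ℤ 2 2)
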